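{- Let $r\ge 3$, let $q$ be a prime power and let $\mathcal L$ be an $m$-cover of lines of $\mathrm{PG}(r,q)$. Embed $\mathrm{PG}(r,q)$ in $\mathrm{PG}(r,q^2)$ and let $\bar{\mathcal L}$ be the set of points of $\mathrm{PG}(r,q^2)$ lying on the extended lines of $\mathcal L$. Then $\bar{\mathcal L}$ is a two-character set of $\mathrm{PG}(r,q^2)$ if and only if $\mathcal L$ is an $(r-2)$-dual $m$-cover of $\mathrm{PG}(r,q)$.
   Context: An $n$-space is an $n$-dimensional projective subspace. $\theta_{n,q}=q^n+\dots+q+1$ for $n\ge 0$ and $\theta_{ -1,q}=0$. An $m$-cover of lines of $\mathrm{PG}(r,q)$ is a set $\mathcal L$ of lines of $\mathrm{PG}(r,q)$ such that every point of $\mathrm{PG}(r,q)$ lies on exactly $m$ lines of $\mathcal L$, where $0<m<\theta_{r-1,q}$. An $m$-cover $\mathcal L$ of $\mathrm{PG}(r,q)$ is an $(r-2)$-dual $m$-cover if every $(r-2)$-space of $\mathrm{PG}(r,q)$ contains either $\frac{m\theta_{r-4,q}}{q+1}+q^{r-3}$ or $\frac{m\theta_{r-4,q}}{q+1}$ lines of $\mathcal L$. $\mathrm{PG}(r,q)$ is embedded in $\mathrm{PG}(r,q^2)$ in the natural way (by extending scalars from $\mathbb F_q$ to $\mathbb F_{q^2}$). The extended line of a line $\ell$ of $\mathrm{PG}(r,q)$ is the unique line of $\mathrm{PG}(r,q^2)$ meeting $\mathrm{PG}(r,q)$ in the $q+1$ points of $\ell$. A two-character set of $\mathrm{PG}(n,q)$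 is a set of points whose intersection sizes with the hyperplanes take exactly two values. -}

module Defs where

open import Algebra.Apartness.Bundles using (HeytingField; HeytingCommutativeRing)
open import Algebra.Bundles using (CommutativeRing; RawRing)
open import Algebra.Morphism.Structures using (module RingMorphisms)
import Algebra.Properties.CommutativeMonoid.Sum as Sum
open import Data.Fin using (Fin)
import Data.Fin as Fin
open import Data.Integer using (ℤ; +_; -[1+_]; _⊖_)
open import Data.Nat using (ℕ; zero; suc; _+_; _*_; _∸_; _^_; _≤_; _<_)
open import Data.Nat.Primality using (Prime)
open import Data.Product using (_×_; ∃; ∃₂; Σ; proj₁)
open import Data.Rational.Unnormalised as ℚᵘ using (ℚᵘ; _≃_)
open import Data.Sum using (_⊎_)
open import Data.Vec.Functional using (Vector; map)
open import Data.Vec.Functional.Relation.Binary.Equality.Setoid using (_≋_)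
open import Function.Bundles using (Inverse; _⇔_)
open import Level using (Level; _⊔_)
open import Relation.Binary.Bundles using (Setoid)
import Relation.Binary.Construct.On as On
open import Relation.Binary.PropositionalEquality using (_≡_; _≢_; setoid)
open import Relation.Unary using (Pred; _∈_; _⊆_; _∩_)
open import Relation.Unary.Relation.Binary.Equality using (≐-setoid)

-- The elements of S satisfying P form exactly N classes for the equality of S.
HasSize : ∀ {a ℓ p} (S : Setoid a ℓ) → Pred (Setoid.Carrier S) p → ℕ → Set (a ⊔ ℓ ⊔ p)
HasSize S P N = Inverse (On.setoid {B = Σ (Setoid.Carrier S) P} S proj₁) (setoid (Fin N))

PrimePower : ℕ → Set
PrimePower q = ∃₂ λ p h → Prime p × 1 ≤ h × q ≡ p ^ h

-- θ n q = qⁿ + ⋯ + q + 1. Only the value 0 at n = -1 matters among negative n.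
θ : ℤ → ℕ → ℕ
θ (+ zero)  q = 1
θ (+ suc n) q = q ^ suc n + θ (+ n) q
θ -[1+ _ ]  q = 0

module _ {c ℓ₁ ℓ₂} (F : HeytingField c ℓ₁ ℓ₂) where

  commutativeRing : CommutativeRing c ℓ₁
  commutativeRing = HeytingCommutativeRing.commutativeRing (HeytingField.heytingCommutativeRing F)

  rawRing : RawRing c ℓ₁
  rawRing = CommutativeRing.rawRing commutativeRing

  -- A Heyting field with finitely many elements is a field in the classical
  -- sense: its equality is decidable and every nonzero element is invertible.
  HasOrder : ℕ → Set (c ⊔ ℓ₁)
  HasOrder q = Inverse (CommutativeRing.setoid commutativeRing) (setoid (Fin q))

-- PG(n, F): the subspaces of Fⁿ⁺¹ ordered by inclusion.
module PG {c ℓ₁ ℓ₂} (F : HeytingField c ℓ₁ ℓ₂) (n : ℕ) where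

  open CommutativeRing (commutativeRing F) using (Carrier; _≈_; 0#)
    renaming (_*_ to _·_; setoid to F-setoid; +-commutativeMonoid to F-+)

  V : Set c
  V = Vector Carrier (suc n)

  combination : ∀ {k} → Vector Carrier k → Vector V k → V
  combination a b j = Sum.sum F-+ (λ i → a i · b i j)

  -- A k-space, of vector space dimension k + 1, presented by a basis.
  record Space (k : ℕ) : Set (c ⊔ ℓ₁) where
    field
      basis       : Vector V (suc k)
      independent : ∀ a → (∀ j → combination a basis j ≈ 0#) → ∀ i → a i ≈ 0#

    span : Pred V (c ⊔ ℓ₁)
    span v = ∃ λ a → _≋_ F-setoid v (combination a basis)

  open Space public

  -- Two presentations give the same k-space when their spans coincide.
  Spaces : ℕ → Setoid (c ⊔ ℓ₁) (c ⊔ ℓ₁)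
  Spaces k = On.setoid {B = Space k} (≐-setoid V (c ⊔ ℓ₁)) span

  infix 4 _≈ₛ_ _⊑_

  _≈ₛ_ : ∀ {k} → Space k → Space k → Set (c ⊔ ℓ₁)
  _≈ₛ_ {k} = Setoid._≈_ (Spaces k)

  _⊑_ : ∀ {k l} → Space k → Space l → Set (c ⊔ ℓ₁)
  S ⊑ T = span S ⊆ span T

  Point Line Hyperplane : Set (c ⊔ ℓ₁)
  Point      = Space 0
  Line       = Space 1
  Hyperplane = Space (n ∸ 1)

  record IsCover {p} (q m : ℕ) (𝓛 : Pred Line p) : Set (c ⊔ ℓ₁ ⊔ p) where
    field
      positive : 0 < m
      bounded  : m < θ (n ⊖ 1) q
      covers   : (P : Point) → HasSize (Spaces 1) (𝓛 ∩ (P ⊑_)) m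

  -- The number of lines is compared in ℚ, since m θ / (q + 1) is not assumed
  -- to be an integer. The truncated subtractions are exact for n ≥ 3.
  IsDualCover : ∀ {p} (q m : ℕ) → Pred Line p → Set (c ⊔ ℓ₁ ⊔ p)
  IsDualCover q m 𝓛 = (S : Space (n ∸ 2)) →
    ∃ λ N → HasSize (Spaces 1) (𝓛 ∩ (_⊑ S)) N ×
      (fromℕ N ≃ base ℚᵘ.+ fromℕ (q ^ (n ∸ 3)) ⊎ fromℕ N ≃ base)
    where
    fromℕ : ℕ → ℚᵘ
    fromℕ N = + N ℚᵘ./ 1

    base : ℚᵘ
    base = + (m * θ (n ⊖ 4) q) ℚᵘ./ suc q

  IsTwoCharacter : ∀ {p} → Pred Point p → Set (c ⊔ ℓ₁ ⊔ p)
  IsTwoCharacter X = ∃₂ λ h₁ h₂ → h₁ ≢ h₂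
    × ((H : Hyperplane) → meets H h₁ ⊎ meets H h₂)
    × (∃ λ H → meets H h₁)
    × (∃ λ H → meets H h₂)
    where
    meets : Hyperplane → ℕ → Set _
    meets H = HasSize (Spaces 0) (X ∩ (_⊑ H))

IsFieldEmbedding : ∀ {c ℓ₁ ℓ₂ c′ ℓ₁′ ℓ₂′} (F : HeytingField c ℓ₁ ℓ₂) (K : HeytingField c′ ℓ₁′ ℓ₂′) →
  (HeytingField.Carrier F → HeytingField.Carrier K) → Set (c ⊔ ℓ₁ ⊔ ℓ₁′)
IsFieldEmbedding F K = RingMorphisms.IsRingMonomorphism (rawRing F) (rawRing K)

module Extension {c ℓ₁ ℓ₂ c′ ℓ₁′ ℓ₂′}
  (F : HeytingField c ℓ₁ ℓ₂) (K : HeytingField c′ ℓ₁′ ℓ₂′)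
  (ι : HeytingField.Carrier F → HeytingField.Carrier K) (n : ℕ) where

  private
    module PGF = PG F n
    module PGK = PG K n

  -- The image in PG(n, K) of the point P lies in the subspace T.
  _liesIn_ : ∀ {k} → PGF.Point → PGK.Space k → Set (c′ ⊔ ℓ₁′)
  P liesIn T = map ι (PGF.basis P Fin.zero) ∈ PGK.span T

  IsExtendedLine : PGF.Line → PGK.Line → Set (c ⊔ ℓ₁ ⊔ c′ ⊔ ℓ₁′)
  IsExtendedLine ℓ ℓ̄ = (P : PGF.Point) → (P liesIn ℓ̄) ⇔ (P PGF.⊑ ℓ)

  extendedPoints : ∀ {p} → Pred PGF.Line p → Pred PGK.Point (c ⊔ ℓ₁ ⊔ c′ ⊔ ℓ₁′ ⊔ p)
  extendedPoints 𝓛 Q = ∃₂ λ ℓ ℓ̄ → ℓ ∈ 𝓛 × IsExtendedLine ℓ ℓ̄ × Q PGK.⊑ ℓ̄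

{-# OPTIONS --safe #-}
-- Let K = F + ω F. A point of PG(r, K) is spanned by a + ω b with a, b over F; it lies on an extended
-- line of 𝓛 iff a and b are dependent or span a line of 𝓛. For a linear form φ over K one counts the
-- vectors of the cone over 𝓛̄ that φ kills. If the kernel of φ is a real hyperplane, the count is a
-- constant h. Otherwise the kernel meets PG(r, F) in an (r - 2)-space, each such space occurs, and the
-- count is an increasing affine function of the number of lines of 𝓛 in that space; it equals h, or
-- h - (q² - 1) q ^ (r - 1), exactly for the two numbers in the definition of a dual m-cover.
-- Summing the counts and their squares over all φ shows that they are not all equal to h (as
-- m < θ_{r-1}), and that a single second value can only be h - (q² - 1) q ^ (r - 1).
module Submission where

open import Defs
open import Algebra.Apartness.Bundles using (HeytingField)
open import Algebra.Bundles using (CommutativeRing)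
open import Algebra.Morphism.Structures using (module RingMorphisms)
import Algebra.Properties.Ring as RingProperties
import Algebra.Properties.Semiring.Mult.TCOptimised as Mult
import Algebra.Properties.Semiring.Sum as SemiringSum
import Algebra.Solver.Ring
open import Algebra.Solver.Ring.AlmostCommutativeRing using (_-Raw-AlmostCommutative⟶_; fromCommutativeRing)
open import Data.Fin using (Fin; zero; suc; fromℕ<)
import Data.Fin.Properties as Fin
open import Data.Integer as ℤ using (ℤ; +_; -[1+_]; _⊖_)
import Data.Integer.Properties as ℤ
import Data.Integer.Solver as ℤSolver
open import Data.Maybe using (map)
open import Data.Nat as ℕ using (ℕ; zero; suc; _≤_; _^_)
open import Data.Nat.Primality using (prime⇒nonTrivial; prime⇒nonZero)
import Data.Nat.Properties as ℕ
import Data.Nat.Solver as ℕSolver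
open import Data.Product using (_×_; _,_; ∃; ∃₂; Σ; proj₁; proj₂)
open import Data.Product.Relation.Binary.Pointwise.NonDependent using (×-setoid)
import Data.Rational.Unnormalised as ℚᵘ
import Data.Sign as Sign
open import Data.Sum as Sum using (_⊎_; inj₁; inj₂)
open import Data.Unit using (⊤; tt)
open import Data.Vec.Functional using (Vector; []; _∷_; tail; head)
import Data.Vec.Functional.Relation.Binary.Equality.Setoid as VecEq
open VecEq using (≋-setoid)
open import Function using (_∘_)
open import Function.Bundles using (Inverse; Equivalence; mk⇔; _⇔_)
import Function.Construct.Composition as Compose
import Function.Construct.Identity as Identity
import Function.Construct.Symmetry as Symmetry
open import Level using (Level; _⊔_)
open import Relation.Binary.Bundles using (Setoid)
open import Relation.Binary.Consequences using (dec⇒weaklyDec)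
open import Relation.Binary.Definitions using (_Respects_)
import Relation.Binary.PropositionalEquality as ≡
open ≡ using (_≡_; _≢_)
import Relation.Binary.Reasoning.Setoid as SetoidReasoning
open import Relation.Nullary using (Dec; yes; no; ¬_; contradiction)
open import Relation.Nullary.Decidable using (_×-dec_; _⊎-dec_; ¬?; map′; decidable-stable)
open import Relation.Unary using (Pred; _∩_)

open ℕSolver.+-*-Solver using ()
  renaming (solve to ℕsolve; _:+_ to _ℕ:+_; _:*_ to _ℕ:*_; _:=_ to _ℕ:=_; con to ℕcon)

-- Why the count is affine: the extension of a line of 𝓛 lies in a hyperplane H of PG(r, K) or meets
-- it in one point, and a non-real point lies on at most one extended line. If H is not real, the
-- number of its real points is fixed and each lies on m lines of 𝓛. So the number N of lines inside
-- H determines how many other lines meet H in a real point. The remaining lines contribute one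
-- non-real point each, the N lines inside q² - q each. Why the second value is forced: if every
-- nonzero form has size h or b, each size x satisfies (x - h)(x - b) = 0. Summed over the D nonzero
-- forms this is linear in b, with coefficient D h - S₁, where S₁ is the sum of the sizes. The
-- coefficient is a nonzero multiple of θ_{r-1} - m, so b is determined. The logic is constructive.
-- Dimensions are compared through numbers of vectors, witnesses are found by search in finite sets,
-- and counts stay in ℕ, with negative terms moved across, until the arithmetic passes to ℤ.

private variable
  c ℓ₁ ℓ₂ c′ ℓ₁′ ℓ₂′ p u : Level

-- Counting in finite setoids

module Counting where
  open import Relation.Binary.PropositionalEquality using (refl; sym; trans; cong; cong₂; subst; setoid; module ≡-Reasoning)
  open import Data.Fin using (combine; remQuot; finToFun; funToFin)
  open import Data.Nat using (_+_; _*_; _<_; z≤n; s≤s)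
  open SemiringSum ℕ.+-*-semiring
    using (sum; sum-cong-≗; ∑-distrib-+; ∑-comm; *-distribˡ-sum; sum-permute)

  private variable
    a b ℓ ℓ′ ℓ″ p′ : Level

  𝟙 : {P : Set p} → Dec P → ℕ
  𝟙 (yes _) = 1
  𝟙 (no _)  = 0

  𝟙-yes : {P : Set p} (d : Dec P) → P → 𝟙 d ≡ 1
  𝟙-yes (yes _) _ = refl
  𝟙-yes (no ¬x) x = contradiction x ¬x

  𝟙-no : {P : Set p} (d : Dec P) → ¬ P → 𝟙 d ≡ 0
  𝟙-no (yes x) ¬x = contradiction x ¬x
  𝟙-no (no _)  _  = refl

  𝟙-cong : {P : Set p} {Q : Set p′} (d : Dec P) (e : Dec Q) → (P → Q) → (Q → P) → 𝟙 d ≡ 𝟙 e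
  𝟙-cong (yes x) e f g = sym (𝟙-yes e (f x))
  𝟙-cong (no ¬x) e f g = sym (𝟙-no e (¬x ∘ g))

  𝟙-× : {P : Set p} {Q : Set p′} (d : Dec P) (e : Dec Q) → 𝟙 (d ×-dec e) ≡ 𝟙 d * 𝟙 e
  𝟙-× (yes x) (yes y) = refl
  𝟙-× (yes x) (no ¬y) = refl
  𝟙-× (no ¬x) (yes y) = refl
  𝟙-× (no ¬x) (no ¬y) = refl

  𝟙≡1⇒ : {P : Set p} (d : Dec P) → 𝟙 d ≡ 1 → P
  𝟙≡1⇒ (yes x) _ = x

  Finite : Setoid a ℓ → ℕ → Set (a ⊔ ℓ)
  Finite S N = Inverse S (setoid (Fin N))

  sum-const : ∀ N k → sum {N} (λ _ → k) ≡ N * k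
  sum-const zero    k = refl
  sum-const (suc N) k = cong (λ x → k + x) (sum-const N k)

  sum-single : ∀ {N} (t : Vector ℕ N) i → (∀ j → j ≢ i → t j ≡ 0) → sum t ≡ t i
  sum-single {suc N} t zero    z = trans
    (cong (λ x → t zero + x) (trans (sum-cong-≗ (λ j → z (suc j) λ ()))
      (trans (sum-const N 0) (ℕ.*-zeroʳ N)))) (ℕ.+-identityʳ _)
  sum-single {suc N} t (suc i) z = trans (cong (_+ sum (t ∘ suc)) (z zero λ ()))
    (sum-single (t ∘ suc) i λ j j≢i → z (suc j) (j≢i ∘ Fin.suc-injective))

  sum-mono : ∀ {N} (s t : Vector ℕ N) → (∀ i → s i ≤ t i) → sum s ≤ sum t
  sum-mono {zero}  s t s≤t = z≤n
  sum-mono {suc N} s t s≤t = ℕ.+-mono-≤ (s≤t zero) (sum-mono (s ∘ suc) (t ∘ suc) (s≤t ∘ suc))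

  ≤-summands : ∀ {a b c d} → a ≤ b → c ≤ d → a + c ≡ b + d → a ≡ b × c ≡ d
  ≤-summands {a} {b} {c} {d} a≤b c≤d eq with ℕ.m≤n⇒m<n∨m≡n a≤b
  ... | inj₁ a<b  = contradiction eq (ℕ.<⇒≢ (ℕ.+-mono-<-≤ a<b c≤d))
  ... | inj₂ refl = refl , ℕ.+-cancelˡ-≡ a c d eq

  sum-rigid : ∀ {N} (s t : Vector ℕ N) → (∀ i → s i ≤ t i) → sum s ≡ sum t → ∀ i → s i ≡ t i
  sum-rigid {suc N} s t s≤t eq i
    with ≤-summands (s≤t zero) (sum-mono (s ∘ suc) (t ∘ suc) (s≤t ∘ suc)) eq
  sum-rigid {suc N} s t s≤t eq zero    | p , _ = p
  sum-rigid {suc N} s t s≤t eq (suc i) | _ , p = sum-rigid (s ∘ suc) (t ∘ suc) (s≤t ∘ suc) p i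

  module _ {S : Setoid a ℓ} {N} (e : Finite S N) where
    open Setoid S using (Carrier; _≈_) renaming (refl to ≈-refl; sym to ≈-sym; trans to ≈-trans)
    open Inverse e

    opaque
      ∑ : (Carrier → ℕ) → ℕ
      ∑ f = sum (f ∘ from)

    from∘to : ∀ x → from (to x) ≈ x
    from∘to x = inverseʳ refl

    to-injective : ∀ {x y} → to x ≡ to y → x ≈ y
    to-injective eq = ≈-trans (≈-sym (inverseʳ refl)) (inverseʳ eq)

    opaque
      ≈-dec : ∀ x y → Dec (x ≈ y)
      ≈-dec x y = map′ to-injective to-cong (to x Fin.≟ to y)

    opaque
      unfolding ∑

      ∑-cong : ∀ {f g} → (∀ x → f x ≡ g x) → ∑ f ≡ ∑ g
      ∑-cong f≗g = sum-cong-≗ (f≗g ∘ from)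

      ∑-+ : ∀ f g → ∑ (λ x → f x + g x) ≡ ∑ f + ∑ g
      ∑-+ f g = ∑-distrib-+ (f ∘ from) (g ∘ from)

      ∑-*ˡ : ∀ k f → ∑ (λ x → k * f x) ≡ k * ∑ f
      ∑-*ˡ k f = sym (*-distribˡ-sum k (f ∘ from))

      ∑-const : ∀ k → ∑ (λ _ → k) ≡ N * k
      ∑-const k = sum-const N k

      ∑-single : ∀ {f : Carrier → ℕ} → (∀ {x y} → x ≈ y → f x ≡ f y) →
                 ∀ x₀ → (∀ x → ¬ x ≈ x₀ → f x ≡ 0) → ∑ f ≡ f x₀
      ∑-single {f} resp x₀ z = trans
        (sum-single (f ∘ from) (to x₀) λ j j≢ → z (from j) λ eq → j≢ (sym (inverseˡ (≈-sym eq))))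
        (resp (from∘to x₀))

      ∑-mono : ∀ f g → (∀ x → f x ≤ g x) → ∑ f ≤ ∑ g
      ∑-mono f g f≤g = sum-mono (f ∘ from) (g ∘ from) (f≤g ∘ from)

      ∑-rigid : ∀ f g → (∀ x → f x ≤ g x) → ∑ f ≡ ∑ g → ∀ i → f (from i) ≡ g (from i)
      ∑-rigid f g f≤g = sum-rigid (f ∘ from) (g ∘ from) (f≤g ∘ from)

    ∑-*ʳ : ∀ k f → ∑ (λ x → f x * k) ≡ ∑ f * k
    ∑-*ʳ k f = trans (∑-cong λ x → ℕ.*-comm (f x) k) (trans (∑-*ˡ k f) (ℕ.*-comm k (∑ f)))

    ∑-zero : ∀ {f} → (∀ x → f x ≡ 0) → ∑ f ≡ 0
    ∑-zero z = trans (∑-cong z) (trans (∑-const 0) (ℕ.*-zeroʳ N))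

    ∑-unique : {P : Pred Carrier p} (P? : ∀ x → Dec (P x)) → P Respects _≈_ →
               ∀ x₀ → P x₀ → (∀ x → P x → x ≈ x₀) → ∑ (𝟙 ∘ P?) ≡ 1
    ∑-unique P? resp x₀ px₀ uniq = trans
      (∑-single (λ {x} {y} x≈y → 𝟙-cong (P? x) (P? y) (resp x≈y) (resp (≈-sym x≈y))) x₀
        λ x x≉ → 𝟙-no (P? x) (x≉ ∘ uniq x))
      (𝟙-yes (P? x₀) px₀)

    ∑-≈ : ∀ x₀ → ∑ (λ x → 𝟙 (≈-dec x x₀)) ≡ 1
    ∑-≈ x₀ = ∑-unique (λ x → ≈-dec x x₀) (λ x≈y x≈x₀ → ≈-trans (≈-sym x≈y) x≈x₀) x₀ ≈-refl λ _ x≈ → x≈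

    ∑-≈-* : ∀ {f : Carrier → ℕ} → (∀ {x y} → x ≈ y → f x ≡ f y) → ∀ x₀ → ∑ (λ x → 𝟙 (≈-dec x x₀) * f x) ≡ f x₀
    ∑-≈-* {f} resp x₀ = begin
      ∑ (λ x → 𝟙 (≈-dec x x₀) * f x)   ≡⟨ ∑-cong at-x₀ ⟩
      ∑ (λ x → 𝟙 (≈-dec x x₀) * f x₀)  ≡⟨ ∑-*ʳ (f x₀) _ ⟩
      ∑ (λ x → 𝟙 (≈-dec x x₀)) * f x₀  ≡⟨ cong (_* f x₀) (∑-≈ x₀) ⟩
      1 * f x₀                         ≡⟨ ℕ.*-identityˡ (f x₀) ⟩
      f x₀                             ∎
      where
      open ≡-Reasoning
      at-x₀ : ∀ x → 𝟙 (≈-dec x x₀) * f x ≡ 𝟙 (≈-dec x x₀) * f x₀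
      at-x₀ x with ≈-dec x x₀
      ... | yes x≈ = cong (1 *_) (resp x≈)
      ... | no _   = refl

    ∑-complement : {P : Pred Carrier p} (P? : ∀ x → Dec (P x)) → ∑ (λ x → 𝟙 (¬? (P? x))) + ∑ (𝟙 ∘ P?) ≡ N
    ∑-complement P? = trans (sym (∑-+ _ _)) (trans (∑-cong one) (trans (∑-const 1) (ℕ.*-identityʳ N)))
      where
      one : ∀ x → 𝟙 (¬? (P? x)) + 𝟙 (P? x) ≡ 1
      one x with P? x
      ... | yes _ = refl
      ... | no _  = refl

    opaque
      search : {P : Pred Carrier p} → P Respects _≈_ → (∀ x → Dec (P x)) → Dec (∃ P)
      search resp P? = map′ (λ (i , pi) → from i , pi)
        (λ (x , px) → to x , resp (≈-sym (from∘to x)) px) (Fin.any? (P? ∘ from))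

    ∑𝟙≢0⇒∃ : {P : Pred Carrier p} (P? : ∀ x → Dec (P x)) → P Respects _≈_ → ∑ (𝟙 ∘ P?) ≢ 0 → ∃ P
    ∑𝟙≢0⇒∃ P? resp ≢0 with search resp P?
    ... | yes ∃x = ∃x
    ... | no ∄x  = contradiction (∑-zero λ x → 𝟙-no (P? x) λ px → ∄x (x , px)) ≢0

    module _ {P : Pred Carrier p} {Q : Pred Carrier p′} (P? : ∀ x → Dec (P x)) (Q? : ∀ x → Dec (Q x))
             (P-resp : P Respects _≈_) (Q-resp : Q Respects _≈_) where

      ⊂-extra : ∑ (𝟙 ∘ P?) < ∑ (𝟙 ∘ Q?) → ∃ λ x → Q x × ¬ P x
      ⊂-extra lt with search (λ x≈y (q , ¬p) → Q-resp x≈y q , ¬p ∘ P-resp (≈-sym x≈y))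
                             (λ x → Q? x ×-dec ¬? (P? x))
      ... | yes found = found
      ... | no none   = contradiction (∑-mono _ _ Q≤P) (ℕ.<⇒≱ lt)
        where
        Q≤P : ∀ x → 𝟙 (Q? x) ≤ 𝟙 (P? x)
        Q≤P x with Q? x | P? x
        ... | yes q | yes _ = ℕ.≤-refl
        ... | yes q | no ¬p = contradiction (x , q , ¬p) none
        ... | no _  | _     = z≤n

      -- The indicators compare termwise and have equal sums, so they agree at every enumerated
      -- element. Below, this replaces dimension arguments: a subspace inside another of the same
      -- cardinality is all of it.
      ⊂-full : (∀ {x} → P x → Q x) → ∑ (𝟙 ∘ P?) ≡ ∑ (𝟙 ∘ Q?) → ∀ {x} → Q x → P x
      ⊂-full P⊂Q eq {x} qx = P-resp (from∘to x) (𝟙≡1⇒ (P? (from (to x)))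
        (trans (∑-rigid (𝟙 ∘ P?) (𝟙 ∘ Q?) P≤Q eq (to x))
               (𝟙-yes (Q? _) (Q-resp (≈-sym (from∘to x)) qx))))
        where
        P≤Q : ∀ x → 𝟙 (P? x) ≤ 𝟙 (Q? x)
        P≤Q x with P? x
        ... | yes px = ℕ.≤-reflexive (sym (𝟙-yes (Q? x) (P⊂Q px)))
        ... | no _   = z≤n

  infixr 5 ∑-syntax
  ∑-syntax : {S : Setoid a ℓ} {N : ℕ} → Finite S N → (Setoid.Carrier S → ℕ) → ℕ
  ∑-syntax = ∑
  syntax ∑-syntax e (λ x → f) = ∑[ x ∈ e ] f

  module _ {S : Setoid a ℓ} {T : Setoid b ℓ′} {M N} (e : Finite S M) (e′ : Finite T N) where
    private
      module S = Setoid S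
      module T = Setoid T
      module e = Inverse e
      module e′ = Inverse e′

    opaque
      unfolding ∑

      ∑-swap : ∀ (f : S.Carrier → T.Carrier → ℕ) →
               ∑[ x ∈ e ] ∑[ y ∈ e′ ] f x y ≡ ∑[ y ∈ e′ ] ∑[ x ∈ e ] f x y
      ∑-swap f = ∑-comm (λ i j → f (e.from i) (e′.from j))

      ∑-bijection : (σ : Inverse S T) {f : T.Carrier → ℕ} → (∀ {x y} → x T.≈ y → f x ≡ f y) →
                    ∑[ x ∈ e ] f (Inverse.to σ x) ≡ ∑[ y ∈ e′ ] f y
      ∑-bijection σ {f} resp = sym (trans (sum-permute (f ∘ e′.from) π)
        (sum-cong-≗ λ i → resp (from∘to e′ (Inverse.to σ (e.from i)))))
        where
        π : Inverse (setoid (Fin M)) (setoid (Fin N))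
        π = Compose.inverse (Symmetry.inverse e) (Compose.inverse σ e′)

    module _ (w : S.Carrier → T.Carrier → ℕ) where

      ∑∑ : (S.Carrier → T.Carrier → ℕ) → ℕ
      ∑∑ f = ∑[ x ∈ e ] ∑[ y ∈ e′ ] w x y * f x y

      ∑∑-+ : ∀ f g → ∑∑ (λ x y → f x y + g x y) ≡ ∑∑ f + ∑∑ g
      ∑∑-+ f g = trans (∑-cong e λ x → trans
          (∑-cong e′ λ y → ℕ.*-distribˡ-+ (w x y) (f x y) (g x y))
          (∑-+ e′ (λ y → w x y * f x y) (λ y → w x y * g x y)))
        (∑-+ e (λ x → ∑[ y ∈ e′ ] w x y * f x y) (λ x → ∑[ y ∈ e′ ] w x y * g x y))

      ∑∑-*ˡ : ∀ k f → ∑∑ (λ x y → k * f x y) ≡ k * ∑∑ f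
      ∑∑-*ˡ k f = trans (∑-cong e λ x → trans
          (∑-cong e′ λ y → trans (sym (ℕ.*-assoc (w x y) k (f x y)))
            (trans (cong (_* f x y) (ℕ.*-comm (w x y) k)) (ℕ.*-assoc k (w x y) (f x y))))
          (∑-*ˡ e′ k (λ y → w x y * f x y)))
        (∑-*ˡ e k (λ x → ∑[ y ∈ e′ ] w x y * f x y))

    module _ (g : S.Carrier → T.Carrier) (g-cong : ∀ {x y} → x S.≈ y → g x T.≈ g y)
             (g-injective : ∀ {x y} → g x T.≈ g y → x S.≈ y) where

      image? : ∀ y → Dec (∃ λ x → y T.≈ g x)
      image? y = search e (λ x≈x′ y≈ → T.trans y≈ (g-cong x≈x′)) (λ x → ≈-dec e′ y (g x))

      -- Injectivity leaves at most one preimage, so counting preimages yields an indicator.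
      -- Exchanging sums then counts an image by its source.
      fibre : ∀ y → ∑[ x ∈ e ] 𝟙 (≈-dec e′ y (g x)) ≡ 𝟙 (image? y)
      fibre y with image? y
      ... | no ∄x = ∑-zero e λ x → 𝟙-no (≈-dec e′ y (g x)) λ y≈ → ∄x (x , y≈)
      ... | yes (x₀ , y≈) = ∑-unique e (λ x → ≈-dec e′ y (g x)) (λ x≈x′ y≈ → T.trans y≈ (g-cong x≈x′))
                              x₀ y≈ λ x y≈′ → g-injective (T.trans (T.sym y≈′) y≈)

      ∑-image : ∀ {f : T.Carrier → ℕ} → (∀ {x y} → x T.≈ y → f x ≡ f y) →
                ∑[ y ∈ e′ ] 𝟙 (image? y) * f y ≡ ∑[ x ∈ e ] f (g x)
      ∑-image {f} resp = begin
        ∑[ y ∈ e′ ] 𝟙 (image? y) * f y                          ≡⟨ ∑-cong e′ (λ y → cong (_* f y) (fibre y)) ⟨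
        ∑[ y ∈ e′ ] (∑[ x ∈ e ] 𝟙 (≈-dec e′ y (g x))) * f y     ≡⟨ ∑-cong e′ (λ y → ∑-*ʳ e (f y) _) ⟨
        ∑[ y ∈ e′ ] ∑[ x ∈ e ] 𝟙 (≈-dec e′ y (g x)) * f y       ≡⟨ ∑-swap (λ x y → 𝟙 (≈-dec e′ y (g x)) * f y) ⟨
        ∑[ x ∈ e ] ∑[ y ∈ e′ ] 𝟙 (≈-dec e′ y (g x)) * f y       ≡⟨ ∑-cong e (λ x → ∑-≈-* e′ resp (g x)) ⟩
        ∑[ x ∈ e ] f (g x)                                      ∎
        where open ≡-Reasoning

      count-image : ∑[ y ∈ e′ ] 𝟙 (image? y) ≡ M
      count-image = begin
        ∑[ y ∈ e′ ] 𝟙 (image? y)      ≡⟨ ∑-cong e′ (λ y → ℕ.*-identityʳ (𝟙 (image? y))) ⟨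
        ∑[ y ∈ e′ ] 𝟙 (image? y) * 1  ≡⟨ ∑-image (λ _ → refl) ⟩
        ∑[ x ∈ e ] 1                  ≡⟨ ∑-const e 1 ⟩
        M * 1                         ≡⟨ ℕ.*-identityʳ M ⟩
        M                             ∎
        where open ≡-Reasoning

      injective⇒surjective : M ≡ N → ∀ y → ∃ λ x → y T.≈ g x
      injective⇒surjective M≡N y = ⊂-full e′ {Q = λ _ → ⊤} image? (λ _ → yes tt)
        (λ y≈y′ (x , y≈) → x , T.trans (T.sym y≈y′) y≈) (λ _ _ → tt) (λ _ → tt)
        (trans count-image (trans M≡N (sym (trans (∑-const e′ 1) (ℕ.*-identityʳ N))))) {y} tt

    opaque
      ×-finite : Finite (×-setoid S T) (M * N)
      ×-finite = record
        { to        = λ (x , y) → combine (e.to x) (e′.to y)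
        ; from      = λ k → e.from (proj₁ (remQuot N k)) , e′.from (proj₂ (remQuot {M} N k))
        ; to-cong   = λ (p , q) → cong₂ combine (e.to-cong p) (e′.to-cong q)
        ; from-cong = λ { refl → S.refl , T.refl }
        ; inverse   =
            (λ {k} (p , q) → trans (cong₂ combine (e.inverseˡ p) (e′.inverseˡ q)) (Fin.combine-remQuot {M} N k)) ,
            λ { {x , y} refl →
                  e.inverseʳ (cong proj₁ (Fin.remQuot-combine (e.to x) (e′.to y))) ,
                  e′.inverseʳ (cong proj₂ (Fin.remQuot-combine (e.to x) (e′.to y))) }
        }

  opaque
    ≋-finite : {S : Setoid a ℓ} {N : ℕ} → Finite S N → ∀ k → Finite (≋-setoid S k) (N ^ k)
    ≋-finite {S = S} {N} e k = record
      { to        = λ v → funToFin (to ∘ v)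
      ; from      = λ i → from ∘ finToFun {N} {k} i
      ; to-cong   = λ {v} {w} v≋w → funToFin-cong (λ i → to-cong (v≋w i))
      ; from-cong = λ { refl i → Setoid.refl S }
      ; inverse   = (λ {i} v≋ → trans (funToFin-cong (λ j → inverseˡ (v≋ j))) (Fin.funToFin-finToFin {k} {N} i)) ,
                    λ { {v} refl j → inverseʳ (Fin.finToFun-funToFin (to ∘ v) j) }
      }
      where
      open Inverse e
      funToFin-cong : ∀ {m} {f g : Fin m → Fin N} → (∀ i → f i ≡ g i) → funToFin f ≡ funToFin g
      funToFin-cong {zero}  f≗g = refl
      funToFin-cong {suc m} f≗g = cong₂ combine (f≗g zero) (funToFin-cong (f≗g ∘ suc))

  module _ {S : Setoid a ℓ} {T : Setoid b ℓ′} {U : Setoid c ℓ″} {L M N}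
           (e : Finite S L) (e′ : Finite T M) (e″ : Finite U N) where
    private
      module S = Setoid S
      module T = Setoid T
      module U = Setoid U

    -- Each z is weighted by the number of its expressions `g x y`, which is 1. Surjectivity is
    -- asked only as existence, so that coordinates such as real and imaginary parts need not form a
    -- congruent inverse map.
    ∑-bijection₂ : (g : S.Carrier → T.Carrier → U.Carrier) →
      (∀ {x x′ y y′} → x S.≈ x′ → y T.≈ y′ → g x y U.≈ g x′ y′) →
      (∀ {x x′ y y′} → g x y U.≈ g x′ y′ → x S.≈ x′ × y T.≈ y′) →
      (∀ z → ∃ λ x → ∃ λ y → z U.≈ g x y) →
      ∀ {f : U.Carrier → ℕ} → (∀ {x y} → x U.≈ y → f x ≡ f y) →
      ∑[ z ∈ e″ ] f z ≡ ∑[ x ∈ e ] ∑[ y ∈ e′ ] f (g x y)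
    ∑-bijection₂ g g-cong g-injective g-surjective {f} resp = begin
      ∑[ z ∈ e″ ] f z
        ≡⟨ ∑-cong e″ (λ z → trans (cong (_* f z) (total z)) (ℕ.*-identityˡ (f z))) ⟨
      ∑[ z ∈ e″ ] (∑[ x ∈ e ] ∑[ y ∈ e′ ] 𝟙 (z ≟ g x y)) * f z
        ≡⟨ ∑-cong e″ (λ z → trans (∑-cong e λ x → ∑-*ʳ e′ (f z) _) (∑-*ʳ e (f z) _)) ⟨
      ∑[ z ∈ e″ ] ∑[ x ∈ e ] ∑[ y ∈ e′ ] 𝟙 (z ≟ g x y) * f z
        ≡⟨ ∑-swap e″ e _ ⟩
      ∑[ x ∈ e ] ∑[ z ∈ e″ ] ∑[ y ∈ e′ ] 𝟙 (z ≟ g x y) * f z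
        ≡⟨ ∑-cong e (λ x → ∑-swap e″ e′ _) ⟩
      ∑[ x ∈ e ] ∑[ y ∈ e′ ] ∑[ z ∈ e″ ] 𝟙 (z ≟ g x y) * f z
        ≡⟨ ∑-cong e (λ x → ∑-cong e′ λ y → ∑-≈-* e″ resp (g x y)) ⟩
      ∑[ x ∈ e ] ∑[ y ∈ e′ ] f (g x y) ∎
      where
      open ≡-Reasoning
      _≟_ = ≈-dec e″
      row? : ∀ z x → Dec (∃ λ y → z U.≈ g x y)
      row? z x = search e′ (λ y≈ z≈ → U.trans z≈ (g-cong S.refl y≈)) (λ y → z ≟ g x y)
      row : ∀ z x → ∑[ y ∈ e′ ] 𝟙 (z ≟ g x y) ≡ 𝟙 (row? z x)
      row z x = trans (fibre e′ e″ (g x) (g-cong S.refl) (proj₂ ∘ g-injective) z) (𝟙-cong _ (row? z x) (λ r → r) (λ r → r))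
      total : ∀ z → ∑[ x ∈ e ] ∑[ y ∈ e′ ] 𝟙 (z ≟ g x y) ≡ 1
      total z with g-surjective z
      ... | x₀ , y₀ , z≈ = trans (∑-cong e (row z)) (∑-unique e (row? z)
        (λ { x≈ (y , z≈) → y , U.trans z≈ (g-cong x≈ T.refl) }) x₀ (y₀ , z≈)
        λ { x (y , z≈′) → proj₁ (g-injective (U.trans (U.sym z≈′) z≈)) })

  ∑-× : {S : Setoid a ℓ} {T : Setoid b ℓ′} {M N : ℕ} (e : Finite S M) (e′ : Finite T N) →
    let open Setoid (×-setoid S T) in ∀ {f : Carrier → ℕ} → (∀ {x y} → x ≈ y → f x ≡ f y) →
    ∑[ z ∈ ×-finite e e′ ] f z ≡ ∑[ x ∈ e ] ∑[ y ∈ e′ ] f (x , y)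
  ∑-× {S = S} {T} e e′ = ∑-bijection₂ e e′ (×-finite e e′) _,_ _,_ (λ r → r)
    λ (x , y) → x , y , Setoid.refl S , Setoid.refl T

  -- A class of objects (the classes of S satisfying P) is counted through finitely many
  -- frames (the elements of A satisfying R), each of which determines one object.
  record Frames {S : Setoid a ℓ} (P : Pred (Setoid.Carrier S) p) {A : Setoid b ℓ′} {M}
                (e : Finite A M) {r} (R : Pred (Setoid.Carrier A) r) s : Set (a ⊔ ℓ ⊔ p ⊔ b ⊔ ℓ′ ⊔ r ⊔ Level.suc s) where
    private
      module S = Setoid S
      module A = Setoid A
    field
      R?         : ∀ x → Dec (R x)
      Frames-of  : A.Carrier → S.Carrier → Set s
      frame?     : ∀ x s → Dec (Frames-of x s)
      sound      : ∀ {x s} → P s → Frames-of x s → R x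
      object     : ∀ {x} → R x → ∃ λ s → P s × Frames-of x s
      object-unique : ∀ {x s s′} → Frames-of x s → Frames-of x s′ → s S.≈ s′
      respects   : ∀ {x s s′} → s S.≈ s′ → Frames-of x s → Frames-of x s′
      respectsˡ  : ∀ {x x′ s} → x A.≈ x′ → Frames-of x s → Frames-of x′ s
      count      : ℕ
      counts     : ∀ {s} → P s → ∑[ x ∈ e ] 𝟙 (frame? x s) ≡ count
      nonempty   : count ≢ 0

  module _ {S : Setoid a ℓ} {P : Pred (Setoid.Carrier S) p} {A : Setoid b ℓ′} {M}
           {e : Finite A M} {r} {R : Pred (Setoid.Carrier A) r} {s} (frames : Frames {S = S} P e R s) where
    open Frames frames
    private
      module S = Setoid S
      module A = Setoid A

    -- Double counting of the incident pairs of a frame and an enumerated object: a frame has one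
    -- object, an object has `count` frames.
    count-frames : ∀ {N} → HasSize S P N → ∑[ x ∈ e ] 𝟙 (R? x) ≡ N * count
    count-frames {N} h = begin
      ∑[ x ∈ e ] 𝟙 (R? x)                                      ≡⟨ ∑-cong e one-object ⟨
      ∑[ x ∈ e ] ∑[ i ∈ fin ] 𝟙 (frame? x (proj₁ (from i)))    ≡⟨ ∑-swap e fin _ ⟩
      ∑[ i ∈ fin ] ∑[ x ∈ e ] 𝟙 (frame? x (proj₁ (from i)))    ≡⟨ ∑-cong fin (λ i → counts (proj₂ (from i))) ⟩
      ∑[ i ∈ fin ] count                                   ≡⟨ ∑-const fin (count) ⟩
      N * count                                            ∎
      where
      open ≡-Reasoning
      open Inverse h
      fin : Finite (setoid (Fin N)) N
      fin = Identity.inverse (setoid (Fin N))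
      one-object : ∀ x → ∑[ i ∈ fin ] 𝟙 (frame? x (proj₁ (from i))) ≡ 𝟙 (R? x)
      one-object x with R? x
      ... | no ¬r = ∑-zero fin λ i → 𝟙-no (frame? x _) λ f → ¬r (sound (proj₂ (from i)) f)
      ... | yes rx with object rx
      ... | s , ps , fs = ∑-unique fin (λ i → frame? x (proj₁ (from i))) (λ { refl f → f })
        (to (s , ps)) (respects (S.sym (inverseʳ refl)) fs) λ j f → sym (inverseˡ (object-unique fs f))

    private
      -- One frame decides equality: `s` has a frame because `count` is nonzero, and `t` is the same
      -- object exactly when that frame is also a frame of `t`.
      _≟_ : (s t : Σ S.Carrier P) → Dec (proj₁ s S.≈ proj₁ t)
      (s , ps) ≟ (t , _) with ∑𝟙≢0⇒∃ e (λ x → frame? x s) respectsˡ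
                                (λ ≡0 → nonempty (trans (sym (counts ps)) ≡0))
      ... | x , fs = map′ (object-unique fs) (λ s≈t → respects s≈t fs) (frame? x t)

      -- k representatives, pairwise inequivalent, covering the objects with a frame among the first n.
      representatives : ∀ n (t : Fin n → A.Carrier) → ∃ λ k → ∃ λ (f : Fin k → Σ S.Carrier P) →
        (∀ {i j} → proj₁ (f i) S.≈ proj₁ (f j) → i ≡ j) ×
        (∀ i {s} → P s → Frames-of (t i) s → ∃ λ j → s S.≈ proj₁ (f j))
      representatives zero    t = 0 , (λ ()) , (λ {}) , λ ()
      representatives (suc n) t with representatives n (t ∘ suc) | R? (t zero)
      ... | k , f , inj , cov | no ¬r = k , f , inj ,
        λ { zero ps fs → contradiction (sound ps fs) ¬r ; (suc i) → cov i }
      ... | k , f , inj , cov | yes r with object r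
      ... | s₀ , ps₀ , fs₀ with Fin.any? (λ j → (s₀ , ps₀) ≟ f j)
      ... | yes (j , s₀≈) = k , f , inj ,
        λ { zero ps fs → j , S.trans (object-unique fs fs₀) s₀≈ ; (suc i) → cov i }
      ... | no new = suc k , f′ , inj′ , cov′
        where
        f′ : Fin (suc k) → Σ S.Carrier P
        f′ zero    = s₀ , ps₀
        f′ (suc i) = f i
        inj′ : ∀ {i j} → proj₁ (f′ i) S.≈ proj₁ (f′ j) → i ≡ j
        inj′ {zero}  {zero}  _  = refl
        inj′ {zero}  {suc j} eq = contradiction (j , eq) new
        inj′ {suc i} {zero}  eq = contradiction (i , S.sym eq) new
        inj′ {suc i} {suc j} eq = cong suc (inj eq)
        cov′ : ∀ i {s} → P s → Frames-of (t i) s → ∃ λ j → s S.≈ proj₁ (f′ j)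
        cov′ zero    ps fs = zero , object-unique fs fs₀
        cov′ (suc i) ps fs with cov i ps fs
        ... | j , eq = suc j , eq

    -- Every object has a frame, found by search, and this frame equals one of the M enumerated
    -- elements of `A`. The list of representatives therefore reaches every object.
    hasSize : ∃ (HasSize S P)
    hasSize with representatives M (Inverse.from e)
    ... | N , f , inj , cov = N , record
      { to        = λ s → proj₁ (index s)
      ; from      = f
      ; to-cong   = λ {s} {t} s≈t → inj (S.trans (S.sym (proj₂ (index s))) (S.trans s≈t (proj₂ (index t))))
      ; from-cong = λ { refl → S.refl }
      ; inverse   = (λ {i} {s} s≈ → inj (S.trans (S.sym (proj₂ (index s))) s≈)) ,
                    λ { {s} refl → S.sym (proj₂ (index s)) }
      }
      where
      index : ∀ s → ∃ λ i → proj₁ s S.≈ proj₁ (f i)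
      index (s , ps) with ∑𝟙≢0⇒∃ e (λ x → frame? x s) respectsˡ
                            (λ ≡0 → nonempty (trans (sym (counts ps)) ≡0))
      ... | x , fs = cov (Inverse.to e x) ps (respectsˡ (A.sym (from∘to e x)) fs)

open Counting

-- Linear algebra over a finite field

-- The canonical homomorphism from ℤ. Integer coefficients have decidable equality, so the ring
-- solver can cancel terms over an arbitrary commutative ring.
module IntegerCoefficients (R : CommutativeRing c ℓ₁) where
  open CommutativeRing R
  open RingProperties ring
  open Mult semiring renaming (_×_ to _×ₙ_)
  open SetoidReasoning setoid

  ⟦_⟧ℤ : ℤ → Carrier
  ⟦ + n ⟧ℤ      = n ×ₙ 1#
  ⟦ -[1+ n ] ⟧ℤ = - (suc n ×ₙ 1#)

  ⊖-homo : ∀ m n → ⟦ m ⊖ n ⟧ℤ ≈ m ×ₙ 1# - n ×ₙ 1#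
  ⊖-homo m       zero    = sym (trans (+-congˡ -0#≈0#) (+-identityʳ _))
  ⊖-homo zero    (suc n) = sym (+-identityˡ _)
  ⊖-homo (suc m) (suc n) = begin
    ⟦ suc m ⊖ suc n ⟧ℤ                  ≡⟨ ≡.cong ⟦_⟧ℤ (ℤ.[1+m]⊖[1+n]≡m⊖n m n) ⟩
    ⟦ m ⊖ n ⟧ℤ                          ≈⟨ ⊖-homo m n ⟩
    m ×ₙ 1# - n ×ₙ 1#                     ≈⟨ +-congˡ (+-identityˡ _) ⟨
    m ×ₙ 1# + (0# - n ×ₙ 1#)              ≈⟨ +-congˡ (+-congʳ (-‿inverseʳ 1#)) ⟨
    m ×ₙ 1# + (1# - 1# - n ×ₙ 1#)         ≈⟨ +-congˡ (+-assoc _ _ _) ⟩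
    m ×ₙ 1# + (1# + (- 1# - n ×ₙ 1#))     ≈⟨ +-assoc _ _ _ ⟨
    m ×ₙ 1# + 1# + (- 1# - n ×ₙ 1#)       ≈⟨ +-cong (+-comm _ _) (-‿+-comm 1# (n ×ₙ 1#)) ⟩
    1# + m ×ₙ 1# - (1# + n ×ₙ 1#)         ≈⟨ +-cong (1+× m 1#) (-‿cong (1+× n 1#)) ⟨
    suc m ×ₙ 1# - suc n ×ₙ 1#             ∎

  +-homo : ∀ i j → ⟦ i ℤ.+ j ⟧ℤ ≈ ⟦ i ⟧ℤ + ⟦ j ⟧ℤ
  +-homo (+ m)      (+ n)      = ×-homo-+ 1# m n
  +-homo (+ m)      -[1+ n ]   = ⊖-homo m (suc n)
  +-homo -[1+ m ]   (+ n)      = trans (⊖-homo n (suc m)) (+-comm _ _)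
  +-homo -[1+ m ]   -[1+ n ]   = begin
    - (suc (suc (m ℕ.+ n)) ×ₙ 1#)      ≡⟨ ≡.cong (λ k → - (suc k ×ₙ 1#)) (ℕ.+-suc m n) ⟨
    - ((suc m ℕ.+ suc n) ×ₙ 1#)        ≈⟨ -‿cong (×-homo-+ 1# (suc m) (suc n)) ⟩
    - (suc m ×ₙ 1# + suc n ×ₙ 1#)       ≈⟨ -‿+-comm _ _ ⟨
    - (suc m ×ₙ 1#) - (suc n ×ₙ 1#)     ∎

  -◃-homo : ∀ n → ⟦ Sign.- ℤ.◃ n ⟧ℤ ≈ - (n ×ₙ 1#)
  -◃-homo zero    = sym -0#≈0#
  -◃-homo (suc n) = refl

  +◃-homo : ∀ n → ⟦ Sign.+ ℤ.◃ n ⟧ℤ ≈ n ×ₙ 1#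
  +◃-homo zero    = refl
  +◃-homo (suc n) = refl

  neg-* : ∀ x y → - x * - y ≈ x * y
  neg-* x y = trans (sym (-‿distribˡ-* x (- y)))
    (trans (-‿cong (sym (-‿distribʳ-* x y))) (-‿involutive _))

  *-homo : ∀ i j → ⟦ i ℤ.* j ⟧ℤ ≈ ⟦ i ⟧ℤ * ⟦ j ⟧ℤ
  *-homo (+ m)    (+ n)    = trans (+◃-homo (m ℕ.* n)) (×1-homo-* m n)
  *-homo (+ m)    -[1+ n ] = trans (-◃-homo (m ℕ.* suc n))
    (trans (-‿cong (×1-homo-* m (suc n))) (-‿distribʳ-* _ _))
  *-homo -[1+ m ] (+ n)    = trans (-◃-homo (suc m ℕ.* n))
    (trans (-‿cong (×1-homo-* (suc m) n)) (-‿distribˡ-* _ _))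
  *-homo -[1+ m ] -[1+ n ] = begin
    ⟦ Sign.+ ℤ.◃ suc m ℕ.* suc n ⟧ℤ    ≈⟨ +◃-homo (suc m ℕ.* suc n) ⟩
    (suc m ℕ.* suc n) ×ₙ 1#             ≈⟨ ×1-homo-* (suc m) (suc n) ⟩
    (suc m ×ₙ 1#) * (suc n ×ₙ 1#)        ≈⟨ neg-* _ _ ⟨
    - (suc m ×ₙ 1#) * - (suc n ×ₙ 1#)    ∎

  -‿homo : ∀ i → ⟦ ℤ.- i ⟧ℤ ≈ - ⟦ i ⟧ℤ
  -‿homo (+ zero)  = sym -0#≈0#
  -‿homo (+ suc n) = refl
  -‿homo -[1+ n ]  = sym (-‿involutive _)

  morphism : ℤ.+-*-rawRing -Raw-AlmostCommutative⟶ fromCommutativeRing R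
  morphism = record
    { ⟦_⟧ = ⟦_⟧ℤ ; +-homo = +-homo ; *-homo = *-homo ; -‿homo = -‿homo ; 0-homo = refl ; 1-homo = refl }

  open Algebra.Solver.Ring ℤ.+-*-rawRing (fromCommutativeRing R) morphism
    (λ i j → map (λ i≡j → reflexive (≡.cong ⟦_⟧ℤ i≡j)) (dec⇒weaklyDec ℤ._≟_ i j))
    public using (solve; _:=_; _:+_; _:*_; _:-_; :-_; con)

-- Vectors, linear forms and dependence over a finite field

module FiniteField (F : HeytingField c ℓ₁ ℓ₂) {q} (order : HasOrder F q) (1<q : 1 ℕ.< q) where
  open CommutativeRing (commutativeRing F) public hiding (zero)
  open RingProperties ring public
  open SemiringSum semiring
    using (sum; sum-cong-≋; ∑-distrib-+; *-distribˡ-sum)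
  open IntegerCoefficients (commutativeRing F) public
  open VecEq setoid public using (_≋_; ≋-refl; ≋-sym; ≋-trans)

  infix 4 _≟_
  _≟_ : (x y : Carrier) → Dec (x ≈ y)
  _≟_ = ≈-dec order

  𝟙-≟ : ∀ {x y} z → x ≈ y → 𝟙 (x ≟ z) ≡ 𝟙 (y ≟ z)
  𝟙-≟ {x} {y} z x≈y = 𝟙-cong (x ≟ z) (y ≟ z) (trans (sym x≈y)) (trans x≈y)

  opaque
    1≉0 : ¬ 1# ≈ 0#
    1≉0 1≈0 = two-elements order 1<q
      where
      all≈0 : ∀ x → x ≈ 0#
      all≈0 x = trans (sym (*-identityʳ x)) (trans (*-congˡ 1≈0) (zeroʳ x))
      two-elements : ∀ {N} → Finite setoid N → ¬ 1 ℕ.< N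
      two-elements e (ℕ.s≤s (ℕ.s≤s _)) = contradiction
        (≡.trans (≡.sym (inverseˡ {zero} refl)) (inverseˡ {suc zero} (trans (all≈0 _) (sym (all≈0 _))))) λ ()
        where open Inverse e

    -- A Heyting field only gives ¬¬ (x # 0); the inverse is then found by search.
    inverse : ∀ x → ¬ x ≈ 0# → ∃ λ y → y * x ≈ 1#
    inverse x x≉0 = decidable-stable (search order (λ y≈z yx≈1 → trans (*-congʳ (sym y≈z)) yx≈1) (λ y → y * x ≟ 1#))
      λ none → x≉0 (proj₁ (HeytingField.tight F x 0#) λ x#0 →
        let y , y[x-0]≈1 , _ = HeytingField.#⇒invertible F x#0 in
        none (y , trans (*-congˡ (sym (trans (+-congˡ -0#≈0#) (+-identityʳ x)))) y[x-0]≈1))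

  *-≈0 : ∀ {x y} → ¬ x ≈ 0# → x * y ≈ 0# → y ≈ 0#
  *-≈0 {x} {y} x≉0 xy≈0 with inverse x x≉0
  ... | z , zx≈1 = begin
    y            ≈⟨ *-identityˡ y ⟨
    1# * y       ≈⟨ *-congʳ zx≈1 ⟨
    z * x * y    ≈⟨ *-assoc z x y ⟩
    z * (x * y)  ≈⟨ *-congˡ xy≈0 ⟩
    z * 0#       ≈⟨ zeroʳ z ⟩
    0#           ∎
    where open SetoidReasoning setoid

  *-≉0 : ∀ {x y} → ¬ x ≈ 0# → ¬ y ≈ 0# → ¬ x * y ≈ 0#
  *-≉0 x≉0 y≉0 xy≈0 = y≉0 (*-≈0 x≉0 xy≈0)

  -≈0⇒≈ : ∀ {x y} → x - y ≈ 0# → x ≈ y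
  -≈0⇒≈ {x} {y} = x∙y⁻¹≈ε⇒x≈y x y

  ≈⇒-≈0 : ∀ {x y} → x ≈ y → x - y ≈ 0#
  ≈⇒-≈0 = x≈y⇒x∙y⁻¹≈ε

  vectors : ∀ n → Finite (≋-setoid setoid n) (q ^ n)
  vectors = ≋-finite order

  infix 4 _≋?_
  infixl 6 _⊕_
  infixr 7 _⊙_

  _⊕_ : ∀ {n} → Vector Carrier n → Vector Carrier n → Vector Carrier n
  (u ⊕ v) j = u j + v j

  _⊙_ : ∀ {n} → Carrier → Vector Carrier n → Vector Carrier n
  (t ⊙ v) j = t * v j

  0ᵛ : ∀ {n} → Vector Carrier n
  0ᵛ _ = 0#

  _≋?_ : ∀ {n} (u v : Vector Carrier n) → Dec (u ≋ v)
  _≋?_ {n} = ≈-dec (vectors n)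

  ⊕-cong : ∀ {n} {u u′ v v′ : Vector Carrier n} → u ≋ u′ → v ≋ v′ → u ⊕ v ≋ u′ ⊕ v′
  ⊕-cong u≋ v≋ j = +-cong (u≋ j) (v≋ j)

  ⊙-cong : ∀ {n} {s t} {u v : Vector Carrier n} → s ≈ t → u ≋ v → s ⊙ u ≋ t ⊙ v
  ⊙-cong s≈ u≋ j = *-cong s≈ (u≋ j)

  ⊙-≋0 : ∀ {n} {t} {v : Vector Carrier n} → ¬ t ≈ 0# → t ⊙ v ≋ 0ᵛ → v ≋ 0ᵛ
  ⊙-≋0 t≉0 tv≋0 j = *-≈0 t≉0 (tv≋0 j)

  opaque
    pivot : ∀ {n} {v : Vector Carrier n} → ¬ v ≋ 0ᵛ → ∃ λ i → ¬ v i ≈ 0#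
    pivot {v = v} v≉0 = decidable-stable (Fin.any? λ i → ¬? (v i ≟ 0#))
      λ none → v≉0 λ i → decidable-stable (v i ≟ 0#) λ vi≉0 → none (i , vi≉0)

  dot : ∀ {n} → Vector Carrier n → Vector Carrier n → Carrier
  dot u v = sum (λ j → u j * v j)

  dot-cong : ∀ {n} {u u′ v v′ : Vector Carrier n} → u ≋ u′ → v ≋ v′ → dot u v ≈ dot u′ v′
  dot-cong u≋ v≋ = sum-cong-≋ λ j → *-cong (u≋ j) (v≋ j)

  dot-comm : ∀ {n} (u v : Vector Carrier n) → dot u v ≈ dot v u
  dot-comm u v = sum-cong-≋ λ j → *-comm (u j) (v j)

  dot-⊕ʳ : ∀ {n} (u v w : Vector Carrier n) → dot u (v ⊕ w) ≈ dot u v + dot u w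
  dot-⊕ʳ u v w = trans (sum-cong-≋ λ j → distribˡ (u j) (v j) (w j)) (∑-distrib-+ (λ j → u j * v j) (λ j → u j * w j))

  dot-⊙ʳ : ∀ {n} (u : Vector Carrier n) t v → dot u (t ⊙ v) ≈ t * dot u v
  dot-⊙ʳ u t v = trans
    (sum-cong-≋ λ j → solve 3 (λ x y z → x :* (y :* z) := y :* (x :* z)) refl (u j) t (v j))
    (sym (*-distribˡ-sum t (λ j → u j * v j)))

  dot-⊕ˡ : ∀ {n} (u v w : Vector Carrier n) → dot (u ⊕ v) w ≈ dot u w + dot v w
  dot-⊕ˡ u v w = trans (dot-comm (u ⊕ v) w) (trans (dot-⊕ʳ w u v) (+-cong (dot-comm w u) (dot-comm w v)))

  dot-⊙ˡ : ∀ {n} t (u v : Vector Carrier n) → dot (t ⊙ u) v ≈ t * dot u v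
  dot-⊙ˡ t u v = trans (dot-comm (t ⊙ u) v) (trans (dot-⊙ʳ v t u) (*-congˡ (dot-comm v u)))

  dot-0ʳ : ∀ {n} (u : Vector Carrier n) {v} → v ≋ 0ᵛ → dot u v ≈ 0#
  dot-0ʳ u {v} v≋0 = trans (dot-cong {u = u} (λ _ → refl) (λ j → trans (v≋0 j) (sym (zeroˡ (v j)))))
    (trans (dot-⊙ʳ u 0# v) (zeroˡ (dot u v)))

  dot-0ˡ : ∀ {n} {u} (v : Vector Carrier n) → u ≋ 0ᵛ → dot u v ≈ 0#
  dot-0ˡ {u = u} v u≋0 = trans (dot-comm u v) (dot-0ʳ v u≋0)

  unit : ∀ {n} → Fin n → Vector Carrier n
  unit zero    zero    = 1#
  unit zero    (suc j) = 0#
  unit (suc i) zero    = 0#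
  unit (suc i) (suc j) = unit i j

  dot-unit : ∀ {n} i (v : Vector Carrier n) → dot (unit i) v ≈ v i
  dot-unit zero    v = trans (+-cong (*-identityˡ _) (dot-0ˡ (tail v) (λ _ → refl))) (+-identityʳ _)
  dot-unit (suc i) v = trans (+-cong (zeroˡ _) (dot-unit i (tail v))) (+-identityˡ _)

  -- Over a field this is linear dependence of the pair. The asymmetric form leaves a single unknown
  -- scalar, which is found by search and over which the later counts are summed.
  Dep : ∀ {n} → Vector Carrier n → Vector Carrier n → Set _
  Dep u v = u ≋ 0ᵛ ⊎ ∃ λ t → v ≋ t ⊙ u

  opaque
    dep? : ∀ {n} (u v : Vector Carrier n) → Dec (Dep u v)
    dep? u v = (u ≋? 0ᵛ) ⊎-dec
      search order (λ s≈t v≋ j → trans (v≋ j) (*-congʳ s≈t)) (λ t → v ≋? (t ⊙ u))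

  Dep-resp : ∀ {n} {u u′ v v′ : Vector Carrier n} → u ≋ u′ → v ≋ v′ → Dep u v → Dep u′ v′
  Dep-resp u≋ v≋ (inj₁ u≋0)      = inj₁ λ j → trans (sym (u≋ j)) (u≋0 j)
  Dep-resp u≋ v≋ (inj₂ (t , v≋tu)) = inj₂ (t , λ j → trans (sym (v≋ j)) (trans (v≋tu j) (*-congˡ (u≋ j))))

  ¬Dep⇒≉0ʳ : ∀ {n} {u v : Vector Carrier n} → ¬ Dep u v → ¬ v ≋ 0ᵛ
  ¬Dep⇒≉0ʳ ¬dep v≋0 = ¬dep (inj₂ (0# , λ j → trans (v≋0 j) (sym (zeroˡ _))))

  ¬Dep⇒trivial : ∀ {n} {u v : Vector Carrier n} → ¬ Dep u v →
                 ∀ {s t} → s ⊙ u ⊕ t ⊙ v ≋ 0ᵛ → s ≈ 0# × t ≈ 0#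
  ¬Dep⇒trivial {u = u} {v} ¬dep {s} {t} eq with t ≟ 0#
  ... | yes t≈0 = decidable-stable (s ≟ 0#) (λ s≉0 → ¬dep (inj₁ (⊙-≋0 s≉0 λ j →
          trans (sym (trans (+-congˡ (trans (*-congʳ t≈0) (zeroˡ _))) (+-identityʳ _))) (eq j)))) , t≈0
  ... | no t≉0 with inverse t t≉0
  ... | z , zt≈1 = contradiction (inj₂ (- z * s , λ j → begin
    v j                                       ≈⟨ solve 1 (λ v → v := con (+ 1) :* v) refl (v j) ⟩
    1# * v j                                  ≈⟨ *-congʳ zt≈1 ⟨
    z * t * v j                               ≈⟨ solve 5 (λ z t v s u → z :* t :* v := z :* (s :* u :+ t :* v) :+ :- z :* s :* u)
                                                   refl z t (v j) s (u j) ⟩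
    z * (s * u j + t * v j) + - z * s * u j   ≈⟨ +-congʳ (trans (*-congˡ (eq j)) (zeroʳ z)) ⟩
    0# + - z * s * u j                        ≈⟨ +-identityˡ _ ⟩
    - z * s * u j                             ∎)) ¬dep
    where open SetoidReasoning setoid

  trivial⇒¬Dep : ∀ {n} {u v : Vector Carrier n} →
                 (∀ {s t} → s ⊙ u ⊕ t ⊙ v ≋ 0ᵛ → s ≈ 0# × t ≈ 0#) → ¬ Dep u v
  trivial⇒¬Dep {u = u} {v} triv (inj₁ u≋0) = 1≉0 (proj₁ (triv {1#} {0#} λ j →
    trans (+-cong (trans (*-identityˡ _) (u≋0 j)) (zeroˡ _)) (+-identityˡ _)))
  trivial⇒¬Dep {u = u} {v} triv (inj₂ (t , v≋tu)) = 1≉0 (proj₂ (triv {s = - t} {1#} λ j →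
    trans (+-congˡ (trans (*-identityˡ _) (v≋tu j))) (solve 2 (λ t u → :- t :* u :+ t :* u := con (+ 0)) refl t (u j))))

  -- One affine bijection serves twice: as a translation when slices of a set are compared, and as
  -- the change of the second basis vector of a line.
  shear : ∀ {n} (u : Vector Carrier n) {s} → ¬ s ≈ 0# → Inverse (≋-setoid setoid n) (≋-setoid setoid n)
  shear u {s} s≉0 with inverse s s≉0
  ... | z , zs≈1 = record
    { to        = λ v → u ⊕ s ⊙ v
    ; from      = λ w → z ⊙ (w ⊕ - 1# ⊙ u)
    ; to-cong   = λ v≋ j → +-congˡ (*-congˡ (v≋ j))
    ; from-cong = λ w≋ j → *-congˡ (+-congʳ (w≋ j))
    ; inverse   =
        (λ {w} v≋ j → trans (+-congˡ (trans (*-congˡ (v≋ j)) (trans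
          (solve 4 (λ s z w u → s :* (z :* (w :+ :- con (+ 1) :* u)) := z :* s :* (w :- u)) refl s z (w j) (u j))
          (trans (*-congʳ zs≈1) (*-identityˡ _)))))
          (solve 2 (λ u w → u :+ (w :- u) := w) refl (u j) (w j))) ,
        (λ {v} w≋ j → trans (*-congˡ (+-congʳ (w≋ j))) (trans
          (solve 4 (λ z u s v → z :* (u :+ s :* v :+ :- con (+ 1) :* u) := z :* s :* v) refl z (u j) s (v j))
          (trans (*-congʳ zs≈1) (*-identityˡ _))))
    }

  ∑-shear : ∀ {n} (u : Vector Carrier n) {s} → ¬ s ≈ 0# → {f : Vector Carrier n → ℕ} →
            (∀ {v w} → v ≋ w → f v ≡ f w) →
            ∑[ v ∈ vectors n ] f (u ⊕ s ⊙ v) ≡ (∑[ v ∈ vectors n ] f v)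
  ∑-shear u {s} s≉0 {f} resp with inverse s s≉0 | ∑-bijection (vectors _) (vectors _) (shear u s≉0) resp
  ... | _ | eq = eq

  count-nonzero : (∑[ x ∈ order ] 𝟙 (¬? (x ≟ 0#))) ℕ.+ 1 ≡ q
  count-nonzero = ≡.trans (≡.cong ((∑[ x ∈ order ] 𝟙 (¬? (x ≟ 0#))) ℕ.+_) (≡.sym (∑-≈ order 0#))) (∑-complement order (_≟ 0#))

-- Subspaces as spans and as kernels of linear forms

module Subspaces (F : HeytingField c ℓ₁ ℓ₂) {q} (order : HasOrder F q) (1<q : 1 ℕ.< q) (r : ℕ) where
  open FiniteField F order 1<q
  open PG F r

  points : Finite (≋-setoid setoid (suc r)) (q ^ suc r)
  points = vectors (suc r)

  combination-⊕ : ∀ {k} (a a′ : Vector Carrier k) b → combination (a ⊕ a′) b ≋ combination a b ⊕ combination a′ b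
  combination-⊕ a a′ b j = dot-⊕ˡ a a′ (λ i → b i j)

  combination-⊙ : ∀ {k} t (a : Vector Carrier k) b → combination (t ⊙ a) b ≋ t ⊙ combination a b
  combination-⊙ t a b j = dot-⊙ˡ t a (λ i → b i j)

  combination-congˡ : ∀ {k} {a a′ : Vector Carrier k} (b : Vector V k) → a ≋ a′ → combination a b ≋ combination a′ b
  combination-congˡ b a≋ j = dot-cong a≋ (λ i → refl)

  Span : ∀ {k} → Vector V k → Pred V _
  Span b v = ∃ λ a → v ≋ combination a b

  opaque
    span? : ∀ {k} (b : Vector V k) v → Dec (Span b v)
    span? {k} b v = search (vectors k) (λ {a} {a′} a≋ v≋ → ≋-trans v≋ (combination-congˡ b a≋))
      (λ a → v ≋? combination a b)

  record IsSubspace (U : Pred V u) : Set (c ⊔ ℓ₁ ⊔ u) where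
    field
      resp : ∀ {v w} → v ≋ w → U v → U w
      0∈   : U 0ᵛ
      ⊕∈   : ∀ {v w} → U v → U w → U (v ⊕ w)
      ⊙∈   : ∀ {t v} → U v → U (t ⊙ v)

    combination∈ : ∀ {k} (a : Vector Carrier k) {b} → (∀ i → U (b i)) → U (combination a b)
    combination∈ {zero}  a b∈ = 0∈
    combination∈ {suc k} a b∈ = ⊕∈ (⊙∈ (b∈ zero)) (combination∈ (tail a) (b∈ ∘ suc))

    Span⊂ : ∀ {k} {b : Vector V k} → (∀ i → U (b i)) → ∀ {v} → Span b v → U v
    Span⊂ b∈ (a , v≋) = resp (≋-sym v≋) (combination∈ a b∈)

  open IsSubspace public

  Span-subspace : ∀ {k} (b : Vector V k) → IsSubspace (Span b)
  Span-subspace b = record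
    { resp = λ v≋w (a , v≋) → a , ≋-trans (≋-sym v≋w) v≋
    ; 0∈   = 0ᵛ , λ j → sym (dot-0ˡ (λ i → b i j) (λ _ → refl))
    ; ⊕∈   = λ (a , v≋) (a′ , w≋) → a ⊕ a′ , ≋-trans (⊕-cong v≋ w≋) (≋-sym (combination-⊕ a a′ b))
    ; ⊙∈   = λ {t} (a , v≋) → t ⊙ a , ≋-trans (⊙-cong refl v≋) (≋-sym (combination-⊙ t a b))
    }

  basis∈Span : ∀ {k} (b : Vector V k) i → Span b (b i)
  basis∈Span b i = unit i , λ j → sym (dot-unit i (λ i → b i j))

  ker-subspace : (φ : V) → IsSubspace (λ v → dot φ v ≈ 0#)
  ker-subspace φ = record
    { resp = λ v≋w φv≈0 → trans (dot-cong {u = φ} ≋-refl (≋-sym v≋w)) φv≈0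
    ; 0∈   = dot-0ʳ φ (λ _ → refl)
    ; ⊕∈   = λ {v} {w} φv≈0 φw≈0 → trans (dot-⊕ʳ φ v w) (trans (+-cong φv≈0 φw≈0) (+-identityˡ _))
    ; ⊙∈   = λ {t} {v} φv≈0 → trans (dot-⊙ʳ φ t v) (trans (*-congˡ φv≈0) (zeroʳ t))
    }

  ∩-subspace : {U : Pred V u} {W : Pred V p} → IsSubspace U → IsSubspace W → IsSubspace (λ v → U v × W v)
  ∩-subspace us ws = record
    { resp = λ v≋w (uv , wv) → resp us v≋w uv , resp ws v≋w wv
    ; 0∈   = 0∈ us , 0∈ ws
    ; ⊕∈   = λ (uv , wv) (uv′ , wv′) → ⊕∈ us uv uv′ , ⊕∈ ws wv wv′
    ; ⊙∈   = λ (uv , wv) → ⊙∈ us uv , ⊙∈ ws wv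
    }

  Indep : ∀ {k} → Vector V k → Set _
  Indep b = ∀ a → (∀ j → combination a b j ≈ 0#) → ∀ i → a i ≈ 0#

  difference≋0 : ∀ {n} {v w : Vector Carrier n} → v ⊕ - 1# ⊙ w ≋ 0ᵛ → v ≋ w
  difference≋0 {v = v} {w} eq j = -≈0⇒≈ (trans
    (solve 2 (λ x y → x :- y := x :+ :- con (+ 1) :* y) refl (v j) (w j)) (eq j))

  ≋⇒difference≋0 : ∀ {n} {v w : Vector Carrier n} → v ≋ w → v ⊕ - 1# ⊙ w ≋ 0ᵛ
  ≋⇒difference≋0 {v = v} {w} v≋w j = trans (+-congʳ (v≋w j))
    (solve 1 (λ y → y :+ :- con (+ 1) :* y := con (+ 0)) refl (w j))

  combination-injective : ∀ {k} {b : Vector V k} → Indep b → ∀ {a a′} → combination a b ≋ combination a′ b → a ≋ a′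
  combination-injective {b = b} ind {a} {a′} eq = difference≋0 (ind _ λ j →
    trans (combination-⊕ a (- 1# ⊙ a′) b j) (trans (+-congˡ (combination-⊙ (- 1#) a′ b j)) (≋⇒difference≋0 eq j)))

  -- Independence makes `combination` injective, so the span is an image of the q ^ k coefficient
  -- vectors. This cardinality plays the role of dimension from here on.
  count-span : ∀ {k} {b : Vector V k} → Indep b → ∑[ v ∈ points ] 𝟙 (span? b v) ≡ q ^ k
  count-span {k} {b} ind = ≡.trans (∑-cong points λ v → 𝟙-cong (span? b v) _ (λ s → s) (λ s → s))
    (count-image (vectors k) points (λ a → combination a b) (combination-congˡ b) (combination-injective ind))

  -- Both spans have q ^ k elements and one contains the other; no exchange argument is needed.
  span-full : ∀ {k} {b b′ : Vector V k} → Indep b → Indep b′ → (∀ i → Span b (b′ i)) → ∀ {v} → Span b v → Span b′ v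
  span-full {b = b} {b′} ind ind′ b′∈ = ⊂-full points (span? b′) (span? b)
    (resp (Span-subspace b′)) (resp (Span-subspace b))
    (Span⊂ (Span-subspace b) b′∈) (≡.trans (count-span ind′) (≡.sym (count-span ind)))

  opaque
    -- Pigeonhole: there are q ^ (r + 1) forms but only q ^ k tuples of values on `b`, so two
    -- different forms agree on `b`, and their difference is the required form.
    annihilator : ∀ {k} → k ℕ.< suc r → (b : Vector V k) → ∃ λ φ → ¬ φ ≋ 0ᵛ × (∀ i → dot φ (b i) ≈ 0#)
    annihilator {k} k<n b
      with i , j , i<j , eq ← Fin.pigeonhole (ℕ.^-monoʳ-< q 1<q k<n)
             (λ x → Inverse.to (vectors k) λ i → dot (Inverse.from points x) (b i))
      = φ₁ ⊕ - 1# ⊙ φ₂ , φ≉0 , kills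
      where
      φ₁ φ₂ : V
      φ₁ = Inverse.from points i
      φ₂ = Inverse.from points j
      φ≉0 : ¬ φ₁ ⊕ - 1# ⊙ φ₂ ≋ 0ᵛ
      φ≉0 eq = Fin.<⇒≢ i<j (≡.trans (≡.sym (Inverse.inverseˡ points {y = φ₂} (≋-sym (difference≋0 eq)))) (Inverse.inverseˡ points (≋-refl {x = φ₂})))
      kills : ∀ i → dot (φ₁ ⊕ - 1# ⊙ φ₂) (b i) ≈ 0#
      kills i = trans (dot-⊕ˡ φ₁ (- 1# ⊙ φ₂) (b i)) (trans (+-congˡ (dot-⊙ˡ (- 1#) φ₂ (b i)))
        (≋⇒difference≋0 (to-injective (vectors k) eq) i))

  extend : ∀ {k} {b : Vector V k} {v} → Indep b → ¬ Span b v → Indep (v ∷ b)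
  extend {b = b} {v} ind v∉ a eq with head a ≟ 0#
  ... | yes a₀≈0 = λ { zero → a₀≈0 ; (suc i) → ind (tail a) (λ j →
          trans (sym (trans (+-congʳ (trans (*-congʳ a₀≈0) (zeroˡ _))) (+-identityˡ _))) (eq j)) i }
  ... | no a₀≉0 with inverse (head a) a₀≉0
  ... | z , za₀≈1 = contradiction (resp sub v≋ (⊙∈ sub {t = - z} (combination∈ sub (tail a) (basis∈Span b)))) v∉
    where
    open SetoidReasoning setoid
    sub = Span-subspace b
    v≋ : - z ⊙ combination (tail a) b ≋ v
    v≋ j = begin
      - z * combination (tail a) b j
        ≈⟨ solve 4 (λ z a v s → :- z :* s := z :* a :* v :- z :* (a :* v :+ s)) refl z (head a) (v j) _ ⟩
      z * head a * v j - z * (head a * v j + combination (tail a) b j)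
        ≈⟨ +-cong (trans (*-congʳ za₀≈1) (*-identityˡ _)) (-‿cong (trans (*-congˡ (eq j)) (zeroʳ z))) ⟩
      v j - 0#
        ≈⟨ solve 1 (λ x → x :- con (+ 0) := x) refl (v j) ⟩
      v j ∎

  module _ {U : Pred V u} (sub : IsSubspace U) (U? : ∀ v → Dec (U v))
           {k} (size : ∑[ v ∈ points ] 𝟙 (U? v) ≡ q ^ k) where

    -- The basis is grown greedily: for i < k a span of i vectors has fewer elements than `U`, so
    -- `U` contains a vector outside it.
    independent-in : ∀ i → i ℕ.≤ k → ∃ λ (b : Vector V i) → Indep b × (∀ j → U (b j))
    independent-in zero    _   = [] , (λ a _ ()) , λ ()
    independent-in (suc i) i<k with independent-in i (ℕ.<⇒≤ i<k)
    ... | b , ind , b∈ with ⊂-extra points (span? b) U? (resp (Span-subspace b)) (resp sub)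
                              (≡.subst₂ ℕ._<_ (≡.sym (count-span ind)) (≡.sym size) (ℕ.^-monoʳ-< q 1<q i<k))
    ... | v , v∈U , v∉ = v ∷ b , extend ind v∉ , λ { zero → v∈U ; (suc j) → b∈ j }

    basis-of : ∃ λ (b : Vector V k) → Indep b × (∀ {v} → Span b v → U v) × (∀ {v} → U v → Span b v)
    basis-of with independent-in k ℕ.≤-refl
    ... | b , ind , b∈ = b , ind , Span⊂ sub b∈ ,
      ⊂-full points (span? b) U? (resp (Span-subspace b)) (resp sub) (Span⊂ sub b∈)
        (≡.trans (count-span ind) (≡.sym size))

  -- A set invariant under the translations by multiples of ψ is cut by the values of φ into q
  -- slices. As φ takes the value 1 at ψ, translation by t ψ carries the slice of value 0 onto the
  -- slice of value t.
  count-shift : {P : Pred V p} (P? : ∀ v → Dec (P v)) → (∀ {v w} → v ≋ w → P v → P w) →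
    (φ ψ : V) → dot φ ψ ≈ 1# → (∀ t {v} → P v → P (t ⊙ ψ ⊕ 1# ⊙ v)) → (∀ t {v} → P (t ⊙ ψ ⊕ 1# ⊙ v) → P v) →
    ∑[ v ∈ points ] 𝟙 (P? v) ≡ q ℕ.* (∑[ v ∈ points ] 𝟙 (P? v) ℕ.* 𝟙 (dot φ v ≟ 0#))
  count-shift P? P-resp φ ψ φψ≈1 P-shift P-unshift = begin
    ∑[ v ∈ points ] 𝟙 (P? v)
      ≡⟨ ∑-cong points (λ v → ≡.trans (≡.cong (𝟙 (P? v) ℕ.*_) (one-value v)) (ℕ.*-identityʳ _)) ⟨
    ∑[ v ∈ points ] 𝟙 (P? v) ℕ.* (∑[ t ∈ order ] 𝟙 (dot φ v ≟ t))
      ≡⟨ ∑-cong points (λ v → ∑-*ˡ order (𝟙 (P? v)) _) ⟨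
    ∑[ v ∈ points ] ∑[ t ∈ order ] 𝟙 (P? v) ℕ.* 𝟙 (dot φ v ≟ t)
      ≡⟨ ∑-swap points order _ ⟩
    ∑[ t ∈ order ] ∑[ v ∈ points ] 𝟙 (P? v) ℕ.* 𝟙 (dot φ v ≟ t)
      ≡⟨ ∑-cong order level ⟩
    ∑[ t ∈ order ] ∑[ v ∈ points ] 𝟙 (P? v) ℕ.* 𝟙 (dot φ v ≟ 0#)
      ≡⟨ ∑-const order _ ⟩
    q ℕ.* (∑[ v ∈ points ] 𝟙 (P? v) ℕ.* 𝟙 (dot φ v ≟ 0#)) ∎
    where
    open ≡.≡-Reasoning
    one-value : ∀ v → ∑[ t ∈ order ] 𝟙 (dot φ v ≟ t) ≡ 1
    one-value v = ∑-unique order (dot φ v ≟_) (λ s≈t eq → trans eq s≈t) (dot φ v) refl (λ _ → sym)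
    dot-shift : ∀ t v → dot φ (t ⊙ ψ ⊕ 1# ⊙ v) ≈ t + dot φ v
    dot-shift t v = trans (dot-⊕ʳ φ (t ⊙ ψ) (1# ⊙ v)) (+-cong
      (trans (dot-⊙ʳ φ t ψ) (trans (*-congˡ φψ≈1) (*-identityʳ t)))
      (trans (dot-⊙ʳ φ 1# v) (*-identityˡ _)))
    level : ∀ t → ∑[ v ∈ points ] 𝟙 (P? v) ℕ.* 𝟙 (dot φ v ≟ t) ≡ (∑[ v ∈ points ] 𝟙 (P? v) ℕ.* 𝟙 (dot φ v ≟ 0#))
    level t = ≡.trans
      (≡.sym (∑-shear (t ⊙ ψ) 1≉0 λ {v} {w} v≋w → ≡.cong₂ ℕ._*_
        (𝟙-cong (P? v) (P? w) (P-resp v≋w) (P-resp (≋-sym v≋w)))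
        (𝟙-cong (dot φ v ≟ t) (dot φ w ≟ t)
          (trans (dot-cong {u = φ} ≋-refl (≋-sym v≋w))) (trans (dot-cong {u = φ} ≋-refl v≋w)))))
      (∑-cong points λ v → ≡.cong₂ ℕ._*_ (𝟙-cong (P? (t ⊙ ψ ⊕ 1# ⊙ v)) (P? v) (P-unshift t) (P-shift t))
        (𝟙-cong (dot φ (t ⊙ ψ ⊕ 1# ⊙ v) ≟ t) (dot φ v ≟ 0#)
          (λ eq → trans (solve 2 (λ t x → x := (t :+ x) :- t) refl t (dot φ v))
                    (≈⇒-≈0 (trans (sym (dot-shift t v)) eq)))
          (λ eq → trans (dot-shift t v) (trans (+-congˡ eq) (+-identityʳ t)))))

  opaque
    dual-vector : ∀ {w : V} → ¬ w ≋ 0ᵛ → ∃ λ ψ → dot w ψ ≈ 1#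
    dual-vector {w} w≉0 with pivot w≉0
    ... | i , wi≉0 with inverse (w i) wi≉0
    ... | z , zwi≈1 = z ⊙ unit i , trans (dot-⊙ʳ w z (unit i))
      (trans (*-congˡ (trans (dot-comm w (unit i)) (dot-unit i w))) zwi≈1)

    -- Cramer's rule. For a nonzero entry `v i`, the vector v i w - w i v is nonzero by
    -- independence. A nonzero entry j of it is the 2 × 2 minor of v and w in columns i and j, and v
    -- i e_j - v j e_i divided by this minor has the required products.
    dual-vector₂ : ∀ {v w : V} → ¬ Dep v w → ∃ λ ψ → dot v ψ ≈ 0# × dot w ψ ≈ 1#
    dual-vector₂ {v} {w} ¬dep with pivot {v = v} (¬dep ∘ inj₁)
    ... | i , vi≉0 with inverse (v i) vi≉0 | pivot {v = λ j → v i * w j + - w i * v j} minor≉0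
      where
      minor≉0 : ¬ (λ j → v i * w j + - w i * v j) ≋ 0ᵛ
      minor≉0 eq = 1≉0 (⊥-from (¬Dep⇒trivial ¬dep {s = - w i} {v i} λ j → trans (+-comm _ _) (eq j)))
        where
        ⊥-from : - w i ≈ 0# × v i ≈ 0# → 1# ≈ 0#
        ⊥-from (_ , vi≈0) = contradiction vi≈0 vi≉0
    ... | _ | j , d≉0 with inverse _ d≉0
    ... | z , zd≈1 = z ⊙ ψ , trans (dot-⊙ʳ v z ψ) (trans (*-congˡ (trans (eval v)
                         (solve 2 (λ x y → x :* y :+ :- y :* x := con (+ 0)) refl (v i) (v j)))) (zeroʳ z)) ,
                     trans (dot-⊙ʳ w z ψ) (trans (*-congˡ (trans (eval w)
                       (solve 4 (λ vi wj vj wi → vi :* wj :+ :- vj :* wi := vi :* wj :+ :- wi :* vj) refl (v i) (w j) (v j) (w i)))) zd≈1)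
      where
      ψ : V
      ψ = v i ⊙ unit j ⊕ - v j ⊙ unit i
      eval : ∀ x → dot x ψ ≈ v i * x j + - v j * x i
      eval x = trans (dot-⊕ʳ x (v i ⊙ unit j) (- v j ⊙ unit i)) (+-cong
        (trans (dot-⊙ʳ x (v i) (unit j)) (*-congˡ (trans (dot-comm x (unit j)) (dot-unit j x))))
        (trans (dot-⊙ʳ x (- v j) (unit i)) (*-congˡ (trans (dot-comm x (unit i)) (dot-unit i x)))))

  q-cancel : ∀ {x y} → q ℕ.* x ≡ q ℕ.* y → x ≡ y
  q-cancel {x} {y} = ℕ.*-cancelˡ-≡ x y q {{ℕ.>-nonZero (ℕ.<-trans (ℕ.s≤s ℕ.z≤n) 1<q)}}

  count-ker : ∀ {w : V} → ¬ w ≋ 0ᵛ → ∑[ v ∈ points ] 𝟙 (dot w v ≟ 0#) ≡ q ^ r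
  count-ker {w} w≉0 = q-cancel (≡.sym (≡.trans (≡.sym all) (≡.trans shift (≡.cong (q ℕ.*_)
    (∑-cong points λ v → ℕ.*-identityˡ (𝟙 (dot w v ≟ 0#)))))))
    where
    all : ∑[ v ∈ points ] 1 ≡ q ℕ.* q ^ r
    all = ≡.trans (∑-const points 1) (ℕ.*-identityʳ (q ^ suc r))
    shift : ∑[ v ∈ points ] 1 ≡ q ℕ.* (∑[ v ∈ points ] 1 ℕ.* 𝟙 (dot w v ≟ 0#))
    shift = count-shift {P = λ _ → ⊤} (λ _ → yes tt) (λ _ _ → tt)
      w (proj₁ (dual-vector w≉0)) (proj₂ (dual-vector w≉0)) (λ _ _ → tt) (λ _ _ → tt)

  -- The kernel of v is sliced by the values of w, with a translation vector chosen inside that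
  -- kernel. The factor q stays on the left because r is not assumed positive here, so q ^ (r - 1)
  -- would be awkward.
  count-ker₂ : ∀ {v w : V} → ¬ Dep v w →
               q ℕ.* (∑[ x ∈ points ] 𝟙 (dot v x ≟ 0#) ℕ.* 𝟙 (dot w x ≟ 0#)) ≡ q ^ r
  count-ker₂ {v} {w} ¬dep = ≡.trans (≡.sym shift) (count-ker (¬dep ∘ inj₁))
    where
    ψ : V
    ψ = proj₁ (dual-vector₂ ¬dep)
    ker : IsSubspace (λ x → dot v x ≈ 0#)
    ker = ker-subspace v
    ψ∈ : dot v ψ ≈ 0#
    ψ∈ = proj₁ (proj₂ (dual-vector₂ ¬dep))
    unshift : ∀ t {x} → dot v (t ⊙ ψ ⊕ 1# ⊙ x) ≈ 0# → dot v x ≈ 0#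
    unshift t {x} eq = resp ker
      (λ j → solve 3 (λ t y x → :- t :* y :+ (t :* y :+ con (+ 1) :* x) := x) refl t (ψ j) (x j))
      (⊕∈ ker {v = - t ⊙ ψ} {t ⊙ ψ ⊕ 1# ⊙ x} (⊙∈ ker {t = - t} {ψ} ψ∈) eq)
    shift : ∑[ x ∈ points ] 𝟙 (dot v x ≟ 0#) ≡ q ℕ.* (∑[ x ∈ points ] 𝟙 (dot v x ≟ 0#) ℕ.* 𝟙 (dot w x ≟ 0#))
    shift = count-shift (λ x → dot v x ≟ 0#) (resp ker) w ψ (proj₂ (proj₂ (dual-vector₂ ¬dep)))
      (λ t {x} vx≈0 → ⊕∈ ker {v = t ⊙ ψ} {1# ⊙ x} (⊙∈ ker {t = t} {ψ} ψ∈) (⊙∈ ker {t = 1#} {x} vx≈0)) unshift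

  opaque
    -- An annihilating form kills a span of q ^ r vectors, and its kernel has exactly q ^ r of them,
    -- so the two coincide.
    hyperplane-form : (b : Vector V r) → Indep b → ∃ λ φ → ¬ φ ≋ 0ᵛ ×
      (∀ {v} → Span b v → dot φ v ≈ 0#) × (∀ {v} → dot φ v ≈ 0# → Span b v)
    hyperplane-form b ind with annihilator ℕ.≤-refl b
    ... | φ , φ≉0 , kills = φ , φ≉0 , Span⊂ (ker-subspace φ) kills ,
      ⊂-full points (span? b) (λ v → dot φ v ≟ 0#) (resp (Span-subspace b)) (resp (ker-subspace φ))
        (Span⊂ (ker-subspace φ) kills) (≡.trans (count-span ind) (≡.sym (count-ker φ≉0)))

    form-hyperplane : ∀ {φ} → ¬ φ ≋ 0ᵛ → ∃ λ (b : Vector V r) → Indep b ×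
      (∀ {v} → Span b v → dot φ v ≈ 0#) × (∀ {v} → dot φ v ≈ 0# → Span b v)
    form-hyperplane {φ} φ≉0 = basis-of (ker-subspace φ) (λ v → dot φ v ≟ 0#) (count-ker φ≉0)

  module _ {s} (r≡ : r ≡ suc s) where

    private
      ker₂-subspace : ∀ α β → IsSubspace (λ v → dot α v ≈ 0# × dot β v ≈ 0#)
      ker₂-subspace α β = ∩-subspace (ker-subspace α) (ker-subspace β)

      ker₂? : ∀ α β (v : V) → Dec (dot α v ≈ 0# × dot β v ≈ 0#)
      ker₂? α β v = (dot α v ≟ 0#) ×-dec (dot β v ≟ 0#)

      size : ∀ {α β} → ¬ Dep α β → ∑[ v ∈ points ] 𝟙 (ker₂? α β v) ≡ q ^ s
      size {α} {β} ¬dep = ≡.trans (∑-cong points (λ v → 𝟙-× (dot α v ≟ 0#) (dot β v ≟ 0#)))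
        (q-cancel (≡.trans (count-ker₂ ¬dep) (≡.cong (q ℕ.^_) r≡)))

    opaque
      -- The second form β is chosen to kill not only `b` but also a vector e at which α is 1. This
      -- forces independence: β = t α evaluated at e gives t = 0.
      codim₂-forms : (b : Vector V s) → Indep b → ∃₂ λ α β → ¬ Dep α β ×
        (∀ {v} → Span b v → dot α v ≈ 0# × dot β v ≈ 0#) × (∀ {v} → dot α v ≈ 0# × dot β v ≈ 0# → Span b v)
      codim₂-forms b ind
        with α , α≉0 , α-kills ← annihilator (≡.subst (λ n → s ℕ.< suc n) (≡.sym r≡) (ℕ.m≤n⇒m≤1+n ℕ.≤-refl)) b
        with e , αe≈1 ← dual-vector α≉0
        with β , β≉0 , β-kills ← annihilator (≡.subst (λ n → suc s ℕ.< suc n) (≡.sym r≡) ℕ.≤-refl) (e ∷ b)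
        = α , β , ¬dep , ⊂ker , ⊂-full points (span? b) (ker₂? α β) (resp (Span-subspace b))
            (resp (ker₂-subspace α β)) ⊂ker (≡.trans (count-span ind) (≡.sym (size {α} {β} ¬dep)))
        where
        ⊂ker : ∀ {v} → Span b v → dot α v ≈ 0# × dot β v ≈ 0#
        ⊂ker = Span⊂ (ker₂-subspace α β) λ i → α-kills i , β-kills (suc i)
        ¬dep : ¬ Dep α β
        ¬dep (inj₁ α≋0)       = α≉0 α≋0
        ¬dep (inj₂ (t , β≋tα)) = β≉0 λ j → trans (β≋tα j) (trans (*-congʳ t≈0) (zeroˡ _))
          where
          t≈0 : t ≈ 0#
          t≈0 = trans (sym (trans (*-congˡ αe≈1) (*-identityʳ t)))
            (trans (sym (trans (dot-cong {u = β} {t ⊙ α} {e} {e} β≋tα ≋-refl) (dot-⊙ˡ t α e))) (β-kills zero))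

      forms-codim₂ : ∀ {α β} → ¬ Dep α β → ∃ λ (b : Vector V s) → Indep b ×
        (∀ {v} → Span b v → dot α v ≈ 0# × dot β v ≈ 0#) × (∀ {v} → dot α v ≈ 0# × dot β v ≈ 0# → Span b v)
      forms-codim₂ {α} {β} ¬dep = basis-of (ker₂-subspace α β) (ker₂? α β) (size {α} {β} ¬dep)

-- Points, lines and the cover

module Lines (F : HeytingField c ℓ₁ ℓ₂) {q} (order : HasOrder F q) (1<q : 1 ℕ.< q) (r : ℕ) where
  open FiniteField F order 1<q
  open PG F r
  open Subspaces F order 1<q r

  pair : V → V → Vector V 2
  pair u v = u ∷ v ∷ []

  pair-combination : ∀ (a : Vector Carrier 2) u v → combination a (pair u v) ≋ a zero ⊙ u ⊕ a (suc zero) ⊙ v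
  pair-combination a u v j = +-congˡ (+-identityʳ _)

  opaque
    ¬Dep⇒Indep : ∀ {u v} → ¬ Dep u v → Indep (pair u v)
    ¬Dep⇒Indep {u} {v} ¬dep a eq
      with ¬Dep⇒trivial ¬dep {a zero} {a (suc zero)} (λ j → trans (sym (pair-combination a u v j)) (eq j))
    ... | a₀≈0 , a₁≈0 = λ { zero → a₀≈0 ; (suc zero) → a₁≈0 }

  line : ∀ u v → ¬ Dep u v → Line
  line u v ¬dep = record { basis = pair u v ; independent = ¬Dep⇒Indep ¬dep }

  _∈Sp_ : ∀ {k} → V → Space k → Set _
  v ∈Sp S = span S v

  ∈Sp? : ∀ {k} v (S : Space k) → Dec (v ∈Sp S)
  ∈Sp? v S = span? (basis S) v

  Sp-subspace : ∀ {k} (S : Space k) → IsSubspace (span S)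
  Sp-subspace S = Span-subspace (basis S)

  line⊂ : ∀ {u v U} {P : Pred V U} → IsSubspace P → P u → P v → ∀ {w} → Span (pair u v) w → P w
  line⊂ {u} {v} sub pu pv = Span⊂ sub {b = pair u v} λ { zero → pu ; (suc zero) → pv }

  left∈ : ∀ u v → Span (pair u v) u
  left∈ u v = basis∈Span (pair u v) zero

  right∈ : ∀ u v → Span (pair u v) v
  right∈ u v = basis∈Span (pair u v) (suc zero)

  ∈pair : ∀ {u v w} s t → w ≋ s ⊙ u ⊕ t ⊙ v → Span (pair u v) w
  ∈pair {u} {v} s t w≋ = s ∷ t ∷ [] , λ j → trans (w≋ j) (sym (pair-combination (s ∷ t ∷ []) u v j))

  ⊂line : ∀ {u v} → ¬ Dep u v → (ℓ : Line) → u ∈Sp ℓ → v ∈Sp ℓ → ∀ {w} → w ∈Sp ℓ → Span (pair u v) w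
  ⊂line {u} {v} ¬dep ℓ u∈ v∈ = span-full {b = basis ℓ} {pair u v} (independent ℓ) (¬Dep⇒Indep ¬dep) λ { zero → u∈ ; (suc zero) → v∈ }

  line≈ : ∀ {u v} (¬dep : ¬ Dep u v) (ℓ : Line) → u ∈Sp ℓ → v ∈Sp ℓ → line u v ¬dep ≈ₛ ℓ
  line≈ ¬dep ℓ u∈ v∈ = line⊂ (Sp-subspace ℓ) u∈ v∈ , ⊂line ¬dep ℓ u∈ v∈

  line-unique : ∀ {u v} → ¬ Dep u v → (ℓ ℓ′ : Line) → u ∈Sp ℓ → v ∈Sp ℓ → u ∈Sp ℓ′ → v ∈Sp ℓ′ → ℓ ≈ₛ ℓ′
  line-unique ¬dep ℓ ℓ′ u∈ v∈ u∈′ v∈′ =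
    (λ w∈ → line⊂ (Sp-subspace ℓ′) u∈′ v∈′ (⊂line ¬dep ℓ u∈ v∈ w∈)) ,
    (λ w∈ → line⊂ (Sp-subspace ℓ) u∈ v∈ (⊂line ¬dep ℓ′ u∈′ v∈′ w∈))

  single : V → Vector V 1
  single u = u ∷ []

  point : ∀ u → ¬ u ≋ 0ᵛ → Point
  point u u≉0 = record
    { basis = single u
    ; independent = λ a eq → λ { zero → ¬≋0⇒ (a zero) λ j → trans (sym (+-identityʳ _)) (eq j) } }
    where
    ¬≋0⇒ : ∀ t → t ⊙ u ≋ 0ᵛ → t ≈ 0#
    ¬≋0⇒ t tu≋0 with t ≟ 0#
    ... | yes t≈0 = t≈0
    ... | no t≉0  = contradiction (⊙-≋0 t≉0 tu≋0) u≉0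

  ∈single : ∀ {u w} t → w ≋ t ⊙ u → Span (single u) w
  ∈single t w≋ = t ∷ [] , λ j → trans (w≋ j) (sym (+-identityʳ _))

  single∈ : ∀ {u w} → Span (single u) w → ∃ λ t → w ≋ t ⊙ u
  single∈ (a , w≋) = a zero , λ j → trans (w≋ j) (+-identityʳ _)

  u∈single : ∀ u → Span (single u) u
  u∈single u = basis∈Span (single u) zero

  single⊂ : ∀ {k u} (S : Space k) → u ∈Sp S → ∀ {w} → Span (single u) w → w ∈Sp S
  single⊂ {u = u} S u∈ = Span⊂ (Sp-subspace S) {b = single u} λ { zero → u∈ }

  representative : Point → V
  representative P = basis P zero

  representative∈ : ∀ (P : Point) → representative P ∈Sp P
  representative∈ P = basis∈Span (basis P) zero

  ⊑⇒∈ : ∀ {k} (P : Point) (S : Space k) → P ⊑ S → representative P ∈Sp S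
  ⊑⇒∈ P S P⊑S = P⊑S (representative∈ P)

  ∈⇒⊑ : ∀ {k} (P : Point) (S : Space k) → representative P ∈Sp S → P ⊑ S
  ∈⇒⊑ P S u∈ = Span⊂ (Sp-subspace S) {b = basis P} λ { zero → u∈ }

  Nonzero : V → Set _
  Nonzero u = ¬ u ≋ 0ᵛ

  nonzero? : ∀ u → Dec (Nonzero u)
  nonzero? u = ¬? (u ≋? 0ᵛ)

  Nonzero-resp : ∀ {u v} → u ≋ v → Nonzero u → Nonzero v
  Nonzero-resp u≋v u≉0 v≋0 = u≉0 (≋-trans u≋v v≋0)

  count-nonzero-in : ∀ {k} (S : Space k) → (∑[ w ∈ points ] 𝟙 (nonzero? w ×-dec ∈Sp? w S)) ℕ.+ 1 ≡ q ^ suc k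
  count-nonzero-in {k} S = begin
    N ℕ.+ 1
      ≡⟨ ≡.cong (N ℕ.+_) (∑-≈ points 0ᵛ) ⟨
    N ℕ.+ (∑[ w ∈ points ] 𝟙 (w ≋? 0ᵛ))
      ≡⟨ ∑-+ points _ _ ⟨
    ∑[ w ∈ points ] 𝟙 (nonzero? w ×-dec ∈Sp? w S) ℕ.+ 𝟙 (w ≋? 0ᵛ)
      ≡⟨ ∑-cong points split ⟩
    ∑[ w ∈ points ] 𝟙 (∈Sp? w S)
      ≡⟨ count-span (independent S) ⟩
    q ^ suc k ∎
    where
    open ≡.≡-Reasoning
    N : ℕ
    N = ∑[ w ∈ points ] 𝟙 (nonzero? w ×-dec ∈Sp? w S)
    split : ∀ w → 𝟙 (nonzero? w ×-dec ∈Sp? w S) ℕ.+ 𝟙 (w ≋? 0ᵛ) ≡ 𝟙 (∈Sp? w S)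
    split w with w ≋? 0ᵛ | ∈Sp? w S
    ... | yes w≋0 | yes _  = ≡.refl
    ... | yes w≋0 | no w∉  = contradiction (resp (Sp-subspace S) (≋-sym w≋0) (0∈ (Sp-subspace S))) w∉
    ... | no w≉0  | yes w∈ = ≡.refl
    ... | no w≉0  | no w∉  = ≡.refl

  Frame : V → V → Line → Set _
  Frame u v ℓ = ¬ Dep u v × u ∈Sp ℓ × v ∈Sp ℓ

  frame? : ∀ u v ℓ → Dec (Frame u v ℓ)
  frame? u v ℓ = ¬? (dep? u v) ×-dec (∈Sp? u ℓ ×-dec ∈Sp? v ℓ)

  Frame-resp : ∀ {u u′ v v′ ℓ} → u ≋ u′ → v ≋ v′ → Frame u v ℓ → Frame u′ v′ ℓ
  Frame-resp {ℓ = ℓ} u≋ v≋ (¬dep , u∈ , v∈) = (λ dep → ¬dep (Dep-resp (≋-sym u≋) (≋-sym v≋) dep)) ,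
    resp (Sp-subspace ℓ) u≋ u∈ , resp (Sp-subspace ℓ) v≋ v∈

  count-second : ∀ {u} ℓ → Nonzero u → u ∈Sp ℓ → (∑[ v ∈ points ] 𝟙 (frame? u v ℓ)) ℕ.+ q ≡ q ℕ.* q
  count-second {u} ℓ u≉0 u∈ = begin
    N ℕ.+ q
      ≡⟨ ≡.cong (N ℕ.+_) (≡.trans (count-span (independent (point u u≉0))) (ℕ.*-identityʳ q)) ⟨
    N ℕ.+ (∑[ v ∈ points ] 𝟙 (span? (single u) v))
      ≡⟨ ∑-+ points _ _ ⟨
    ∑[ v ∈ points ] 𝟙 (frame? u v ℓ) ℕ.+ 𝟙 (span? (single u) v)
      ≡⟨ ∑-cong points split ⟩
    ∑[ v ∈ points ] 𝟙 (∈Sp? v ℓ)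
      ≡⟨ count-span (independent ℓ) ⟩
    q ℕ.* (q ℕ.* 1)
      ≡⟨ ≡.cong (q ℕ.*_) (ℕ.*-identityʳ q) ⟩
    q ℕ.* q ∎
    where
    open ≡.≡-Reasoning
    N : ℕ
    N = ∑[ v ∈ points ] 𝟙 (frame? u v ℓ)
    split : ∀ v → 𝟙 (frame? u v ℓ) ℕ.+ 𝟙 (span? (single u) v) ≡ 𝟙 (∈Sp? v ℓ)
    split v with span? (single u) v
    ... | yes v∈u = ≡.trans (≡.cong (ℕ._+ 1) (𝟙-no (frame? u v ℓ) λ (¬dep , _) → ¬dep (inj₂ (single∈ v∈u))))
                      (≡.sym (𝟙-yes (∈Sp? v ℓ) (single⊂ ℓ u∈ v∈u)))
    ... | no v∉u = ≡.trans (ℕ.+-identityʳ _) (𝟙-cong (frame? u v ℓ) (∈Sp? v ℓ) (λ (_ , _ , v∈) → v∈)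
                     λ v∈ → (λ { (inj₁ u≋0) → u≉0 u≋0 ; (inj₂ (t , v≋)) → v∉u (∈single t v≋) }) , u∈ , v∈)

  -- A line has (q² - 1)(q² - q) ordered bases, the order of GL₂(F), and q² - q of them have a
  -- prescribed first vector.
  frames-per-line frames-per-point : ℕ
  frames-per-point = q ℕ.* q ℕ.∸ q
  frames-per-line  = (q ℕ.* q ℕ.∸ 1) ℕ.* frames-per-point

  count-second′ : ∀ {u} ℓ → Nonzero u → u ∈Sp ℓ → ∑[ v ∈ points ] 𝟙 (frame? u v ℓ) ≡ frames-per-point
  count-second′ {u} ℓ u≉0 u∈ = ≡.trans (≡.sym (ℕ.m+n∸n≡m _ q)) (≡.cong (ℕ._∸ q) (count-second ℓ u≉0 u∈))

  pairs : Finite (×-setoid (≋-setoid setoid (suc r)) (≋-setoid setoid (suc r))) (q ^ suc r ℕ.* q ^ suc r)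
  pairs = ×-finite points points

  count-frames-of : ∀ ℓ → ∑[ z ∈ pairs ] 𝟙 (frame? (proj₁ z) (proj₂ z) ℓ) ≡ frames-per-line
  count-frames-of ℓ = begin
    ∑[ z ∈ pairs ] 𝟙 (frame? (proj₁ z) (proj₂ z) ℓ)
      ≡⟨ ∑-× points points (λ { {u , v} {u′ , v′} (u≋ , v≋) → 𝟙-cong (frame? u v ℓ) (frame? u′ v′ ℓ)
           (Frame-resp {ℓ = ℓ} u≋ v≋) (Frame-resp {ℓ = ℓ} (≋-sym u≋) (≋-sym v≋)) }) ⟩
    ∑[ u ∈ points ] ∑[ v ∈ points ] 𝟙 (frame? u v ℓ)
      ≡⟨ ∑-cong points first ⟩
    ∑[ u ∈ points ] 𝟙 (nonzero? u ×-dec ∈Sp? u ℓ) ℕ.* frames-per-point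
      ≡⟨ ∑-*ʳ points frames-per-point _ ⟩
    (∑[ u ∈ points ] 𝟙 (nonzero? u ×-dec ∈Sp? u ℓ)) ℕ.* frames-per-point
      ≡⟨ ≡.cong (ℕ._* frames-per-point) (≡.trans (≡.sym (ℕ.m+n∸n≡m (∑[ u ∈ points ] 𝟙 (nonzero? u ×-dec ∈Sp? u ℓ)) 1))
           (≡.cong (ℕ._∸ 1) (≡.trans (count-nonzero-in ℓ) (≡.cong (q ℕ.*_) (ℕ.*-identityʳ q))))) ⟩
    frames-per-line ∎
    where
    open ≡.≡-Reasoning
    first : ∀ u → ∑[ v ∈ points ] 𝟙 (frame? u v ℓ) ≡ 𝟙 (nonzero? u ×-dec ∈Sp? u ℓ) ℕ.* frames-per-point
    first u with nonzero? u ×-dec ∈Sp? u ℓ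
    ... | yes (u≉0 , u∈) = ≡.trans (count-second′ ℓ u≉0 u∈) (≡.sym (ℕ.*-identityˡ frames-per-point))
    ... | no ¬both       = ∑-zero points λ v → 𝟙-no (frame? u v ℓ)
                             λ (¬dep , u∈ , _) → ¬both ((λ u≋0 → ¬dep (inj₁ u≋0)) , u∈)

  frames-per-point≢0 : frames-per-point ≢ 0
  frames-per-point≢0 = ℕ.m>n⇒m∸n≢0 (ℕ.m<m*n q q {{ℕ.>-nonZero (ℕ.<-trans (ℕ.s≤s ℕ.z≤n) 1<q)}} 1<q)

  frames-per-line≢0 : frames-per-line ≢ 0
  frames-per-line≢0 eq with ℕ.m*n≡0⇒m≡0∨n≡0 (q ℕ.* q ℕ.∸ 1) eq
  ... | inj₂ ≡0 = frames-per-point≢0 ≡0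
  ... | inj₁ ≡0 = ℕ.m>n⇒m∸n≢0 (ℕ.<-≤-trans 1<q (ℕ.m≤m*n q q {{ℕ.>-nonZero (ℕ.<-trans (ℕ.s≤s ℕ.z≤n) 1<q)}})) ≡0

  -- The cover only provides the lines through each point, which makes membership in 𝓛 decidable.
  module Cover {𝓛 : Pred Line p} (𝓛-resp : 𝓛 Respects _≈ₛ_) {m}
               (cover : (P : Point) → HasSize (Spaces 1) (𝓛 ∩ (P ⊑_)) m) where

    Joined : V → V → Set _
    Joined u v = Σ (¬ Dep u v) λ ¬dep → 𝓛 (line u v ¬dep)

    frame⇒joined : ∀ {u v ℓ} → 𝓛 ℓ → Frame u v ℓ → Joined u v
    frame⇒joined {ℓ = ℓ} ℓ∈ (¬dep , u∈ , v∈) = ¬dep ,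
      𝓛-resp (Setoid.sym (Spaces 1) {line _ _ ¬dep} {ℓ} (line≈ ¬dep ℓ u∈ v∈)) ℓ∈

    Joined-resp : ∀ {u u′ v v′} → u ≋ u′ → v ≋ v′ → Joined u v → Joined u′ v′
    Joined-resp {u} {v = v} u≋ v≋ (¬dep , ℓ∈) = frame⇒joined ℓ∈ (Frame-resp {ℓ = line u v ¬dep} u≋ v≋ (¬dep , left∈ u v , right∈ u v))

    opaque
      -- Only the lines through the point of u have to be inspected: the cover enumerates them, and
      -- a line of 𝓛 spanned by u and v equals one of them.
      joined? : ∀ u v → Dec (Joined u v)
      joined? u v with u ≋? 0ᵛ
      ... | yes u≋0 = no λ (¬dep , _) → ¬dep (inj₁ u≋0)
      ... | no u≉0  = map′
        (λ (i , fr) → frame⇒joined (proj₁ (proj₂ (from i))) fr)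
        (λ (¬dep , ℓ∈) → let ℓ = line u v ¬dep in
          to (ℓ , ℓ∈ , single⊂ ℓ (left∈ u v)) ,
          ¬dep , proj₂ (inverseʳ {ℓ , ℓ∈ , single⊂ ℓ (left∈ u v)} ≡.refl) (left∈ u v) ,
                 proj₂ (inverseʳ {ℓ , ℓ∈ , single⊂ ℓ (left∈ u v)} ≡.refl) (right∈ u v))
        (Fin.any? λ i → frame? u v (proj₁ (from i)))
        where open Inverse (cover (point u u≉0))

    lines-through : ∀ {u} (u≉0 : Nonzero u) → Frames {S = Spaces 1} (𝓛 ∩ (point u u≉0 ⊑_)) points (Joined u) _
    lines-through {u} u≉0 = record
      { R?            = joined? u
      ; Frames-of     = λ v ℓ → Frame u v ℓ
      ; frame?        = λ v ℓ → frame? u v ℓ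
      ; sound         = λ (ℓ∈ , _) fr → frame⇒joined ℓ∈ fr
      ; object        = λ {v} (¬dep , ℓ∈) → line u v ¬dep , (ℓ∈ , single⊂ (line u v ¬dep) (left∈ u v)) ,
                          ¬dep , left∈ u v , right∈ u v
      ; object-unique = λ {v} {ℓ} {ℓ′} (¬dep , u∈ , v∈) (_ , u∈′ , v∈′) → line-unique ¬dep ℓ ℓ′ u∈ v∈ u∈′ v∈′
      ; respects      = λ (⊑ , _) (¬dep , u∈ , v∈) → ¬dep , ⊑ u∈ , ⊑ v∈
      ; respectsˡ     = λ {_} {_} {ℓ} v≋ → Frame-resp {ℓ = ℓ} ≋-refl v≋
      ; count         = frames-per-point
      ; counts        = λ {ℓ} (_ , P⊑ℓ) → count-second′ ℓ u≉0 (P⊑ℓ (u∈single u))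
      ; nonempty      = frames-per-point≢0
      }

    count-joined : ∀ {u} → Nonzero u → ∑[ v ∈ points ] 𝟙 (joined? u v) ≡ m ℕ.* frames-per-point
    count-joined {u} u≉0 = count-frames (lines-through u≉0) (cover (point u u≉0))

    JoinedIn : ∀ {k} → Space k → V × V → Set _
    JoinedIn S (u , v) = Joined u v × (u ∈Sp S × v ∈Sp S)

    joinedIn? : ∀ {k} (S : Space k) z → Dec (JoinedIn S z)
    joinedIn? S (u , v) = joined? u v ×-dec (∈Sp? u S ×-dec ∈Sp? v S)

    lines-in : ∀ {k} (S : Space k) → Frames {S = Spaces 1} (𝓛 ∩ (_⊑ S)) pairs (JoinedIn S) _
    lines-in S = record
      { R?            = joinedIn? S
      ; Frames-of     = λ (u , v) ℓ → Frame u v ℓ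
      ; frame?        = λ (u , v) ℓ → frame? u v ℓ
      ; sound         = λ (ℓ∈ , ℓ⊑S) fr → frame⇒joined ℓ∈ fr , ℓ⊑S (proj₁ (proj₂ fr)) , ℓ⊑S (proj₂ (proj₂ fr))
      ; object        = λ { {u , v} ((¬dep , ℓ∈) , u∈ , v∈) → line u v ¬dep , (ℓ∈ , line⊂ (Sp-subspace S) u∈ v∈) ,
                          ¬dep , left∈ u v , right∈ u v }
      ; object-unique = λ {_} {ℓ} {ℓ′} (¬dep , u∈ , v∈) (_ , u∈′ , v∈′) → line-unique ¬dep ℓ ℓ′ u∈ v∈ u∈′ v∈′
      ; respects      = λ (⊑ , _) (¬dep , u∈ , v∈) → ¬dep , ⊑ u∈ , ⊑ v∈
      ; respectsˡ     = λ {_} {_} {ℓ} (u≋ , v≋) → Frame-resp {ℓ = ℓ} u≋ v≋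
      ; count         = frames-per-line
      ; counts        = λ {ℓ} _ → count-frames-of ℓ
      ; nonempty      = frames-per-line≢0
      }

    joined-sym : ∀ {u v} → Joined u v → Joined v u
    joined-sym {u} {v} (¬dep , ℓ∈) = frame⇒joined ℓ∈ (trivial⇒¬Dep swapped , right∈ u v , left∈ u v)
      where
      swapped : ∀ {s t} → s ⊙ v ⊕ t ⊙ u ≋ 0ᵛ → s ≈ 0# × t ≈ 0#
      swapped eq with ¬Dep⇒trivial ¬dep (λ j → trans (+-comm _ _) (eq j))
      ... | t≈0 , s≈0 = s≈0 , t≈0

    joined-shear : ∀ {u v t s} → ¬ s ≈ 0# → Joined u v → Joined u (t ⊙ u ⊕ s ⊙ v)
    joined-shear {u} {v} {t} {s} s≉0 (¬dep , ℓ∈) = frame⇒joined ℓ∈ (¬dep′ , left∈ u v , ∈pair t s ≋-refl)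
      where
      ¬dep′ : ¬ Dep u (t ⊙ u ⊕ s ⊙ v)
      ¬dep′ (inj₁ u≋0) = ¬dep (inj₁ u≋0)
      ¬dep′ (inj₂ (x , eq)) = s≉0 (proj₂ (¬Dep⇒trivial ¬dep {t - x} {s} λ j → trans
        (solve 5 (λ t x u s v → (t :- x) :* u :+ s :* v := (t :* u :+ s :* v) :- x :* u) refl t x (u j) s (v j))
        (≈⇒-≈0 (eq j))))

    joined-unshear : ∀ {u v t s} → ¬ s ≈ 0# → Joined u (t ⊙ u ⊕ s ⊙ v) → Joined u v
    joined-unshear {u} {v} {t} {s} s≉0 joined with inverse s s≉0
    ... | z , zs≈1 = Joined-resp ≋-refl v≋ (joined-shear {t = - z * t} {s = z} z≉0 joined)
      where
      z≉0 : ¬ z ≈ 0#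
      z≉0 z≈0 = 1≉0 (trans (sym zs≈1) (trans (*-congʳ z≈0) (zeroˡ s)))
      v≋ : (- z * t) ⊙ u ⊕ z ⊙ (t ⊙ u ⊕ s ⊙ v) ≋ v
      v≋ j = trans (solve 5 (λ z t u s v → (:- z :* t) :* u :+ z :* (t :* u :+ s :* v) := z :* s :* v) refl z t (u j) s (v j))
        (trans (*-congʳ zs≈1) (*-identityˡ _))

-- The extension of degree two

module QuadraticExtension
  (F : HeytingField c ℓ₁ ℓ₂) {q} (F-order : HasOrder F q) (1<q : 1 ℕ.< q)
  (K : HeytingField c′ ℓ₁′ ℓ₂′) (K-order : HasOrder K (q ^ 2)) (1<q² : 1 ℕ.< q ^ 2)
  (ι : HeytingField.Carrier F → HeytingField.Carrier K) (embedding : IsFieldEmbedding F K ι) where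

  module F = FiniteField F F-order 1<q
  open FiniteField K K-order 1<q²
  open RingMorphisms.IsRingMonomorphism embedding public
    renaming (+-homo to ι-+; *-homo to ι-*; 0#-homo to ι-0; 1#-homo to ι-1; -‿homo to ι-neg; ⟦⟧-cong to ι-cong)
    using (injective)

  private
    image-of-ι? : ∀ y → Dec (∃ λ x → y ≈ ι x)
    image-of-ι? = image? F-order K-order ι ι-cong injective

    q<q² : q ℕ.< q ^ 2
    q<q² = ≡.subst (q ℕ.<_) (≡.cong (q ℕ.*_) (≡.sym (ℕ.*-identityʳ q)))
      (ℕ.m<m*n q q {{ℕ.>-nonZero (ℕ.<-trans (ℕ.s≤s ℕ.z≤n) 1<q)}} 1<q)

  opaque
    -- The image of F has q elements, fewer than the q ^ 2 of K. The component `⊤` is the trivial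
    -- predicate standing for all of K in `⊂-extra`.
    outside : ∃ λ ω → ⊤ × ¬ (∃ λ x → ω ≈ ι x)
    outside = ⊂-extra K-order image-of-ι? (λ _ → yes tt)
      (λ y≈z (x , y≈) → x , trans (sym y≈z) y≈) (λ _ _ → tt)
      (≡.subst₂ ℕ._<_ (≡.sym (count-image F-order K-order ι ι-cong injective))
        (≡.sym (≡.trans (∑-const K-order 1) (ℕ.*-identityʳ _))) q<q²)

  ω : Carrier
  ω = proj₁ outside

  ω≉ι : ∀ t → ¬ ω ≈ ι t
  ω≉ι t ω≈ = proj₂ (proj₂ outside) (t , ω≈)

  ι≈0 : ∀ {s} → ι s ≈ 0# → s F.≈ F.0#
  ι≈0 eq = injective (trans eq (sym ι-0))

  ι-≉0 : ∀ {s} → ¬ s F.≈ F.0# → ¬ ι s ≈ 0#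
  ι-≉0 s≉0 = s≉0 ∘ ι≈0

  ι-‿- : ∀ x y → ι (x F.- y) ≈ ι x - ι y
  ι-‿- x y = trans (ι-+ x (F.- y)) (+-congˡ (ι-neg y))

  Multiple : Carrier → Carrier → Set _
  Multiple x y = ∃ λ t → y ≈ ι t * x

  multiple? : ∀ x y → Dec (Multiple x y)
  multiple? x y = search F-order (λ s≈t y≈ → trans y≈ (*-congʳ (ι-cong s≈t))) (λ t → y ≟ ι t * x)

  module Basis {x y} (x≉0 : ¬ x ≈ 0#) (y∉ : ¬ Multiple x y) where

    trivial : ∀ {s t} → ι s * x + ι t * y ≈ 0# → s F.≈ F.0# × t F.≈ F.0#
    trivial {s} {t} eq with t F.≟ F.0#
    ... | yes t≈0 = ι≈0 (*-≈0 x≉0 (trans (*-comm x (ι s)) (trans (sym (trans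
            (+-congˡ (trans (*-congʳ (trans (ι-cong t≈0) ι-0)) (zeroˡ y))) (+-identityʳ _))) eq))) , t≈0
    ... | no t≉0 = contradiction (F.- (proj₁ t⁻¹) F.* s , y≈) y∉
      where
      open SetoidReasoning setoid
      t⁻¹ = F.inverse t t≉0
      z = proj₁ t⁻¹
      y≈ : y ≈ ι (F.- z F.* s) * x
      y≈ = begin
        y                                          ≈⟨ *-identityˡ y ⟨
        1# * y                                     ≈⟨ *-congʳ (trans (sym (ι-* z t)) (trans (ι-cong (proj₂ t⁻¹)) ι-1)) ⟨
        ι z * ι t * y                              ≈⟨ solve 5 (λ z t y s x → z :* t :* y := z :* (s :* x :+ t :* y) :+ :- z :* s :* x)
                                                        refl (ι z) (ι t) y (ι s) x ⟩
        ι z * (ι s * x + ι t * y) + - ι z * ι s * x ≈⟨ +-cong (trans (*-congˡ eq) (zeroʳ _)) (*-congʳ (sym (trans (ι-* _ s) (*-congʳ (ι-neg z))))) ⟩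
        0# + ι (F.- z F.* s) * x                   ≈⟨ +-identityˡ _ ⟩
        ι (F.- z F.* s) * x                        ∎

    combine : F.Carrier × F.Carrier → Carrier
    combine (s , t) = ι s * x + ι t * y

    combine-injective : ∀ {s s′ t t′} → combine (s , t) ≈ combine (s′ , t′) → s F.≈ s′ × t F.≈ t′
    combine-injective {s} {s′} {t} {t′} eq with trivial {s F.- s′} {t F.- t′} (begin
        ι (s F.- s′) * x + ι (t F.- t′) * y
          ≈⟨ +-cong (*-congʳ (ι-‿- s s′)) (*-congʳ (ι-‿- t t′)) ⟩
        (ι s - ι s′) * x + (ι t - ι t′) * y
          ≈⟨ solve 6 (λ s s′ t t′ x y → (s :- s′) :* x :+ (t :- t′) :* y := (s :* x :+ t :* y) :- (s′ :* x :+ t′ :* y))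
               refl (ι s) (ι s′) (ι t) (ι t′) x y ⟩
        combine (s , t) - combine (s′ , t′)
          ≈⟨ ≈⇒-≈0 eq ⟩
        0# ∎)
      where open SetoidReasoning setoid
    ... | p , q = F.-≈0⇒≈ p , F.-≈0⇒≈ q

    opaque
      -- An injective map between sets of q * q elements is onto, so independence over F already
      -- makes x, y a basis of K.
      spans : ∀ z → ∃ λ st → z ≈ combine st
      spans = injective⇒surjective (×-finite F-order F-order) K-order combine
        (λ (s≈ , t≈) → +-cong (*-congʳ (ι-cong s≈)) (*-congʳ (ι-cong t≈)))
        combine-injective (≡.cong (q ℕ.*_) (≡.sym (ℕ.*-identityʳ q)))

  ω∉ : ¬ Multiple 1# ω
  ω∉ (t , ω≈) = ω≉ι t (trans ω≈ (*-identityʳ _))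

  join : F.Carrier → F.Carrier → Carrier
  join a b = ι a + ω * ι b

  private
    module 1ω = Basis 1≉0 ω∉

    join≈ : ∀ a b → 1ω.combine (a , b) ≈ join a b
    join≈ a b = +-cong (*-identityʳ _) (*-comm _ _)

  join-cong : ∀ {a a′ b b′} → a F.≈ a′ → b F.≈ b′ → join a b ≈ join a′ b′
  join-cong a≈ b≈ = +-cong (ι-cong a≈) (*-congˡ (ι-cong b≈))

  join-injective : ∀ {a a′ b b′} → join a b ≈ join a′ b′ → a F.≈ a′ × b F.≈ b′
  join-injective {a} {a′} {b} {b′} eq = 1ω.combine-injective
    (trans (join≈ a b) (trans eq (sym (join≈ a′ b′))))

  join≈0 : ∀ {a b} → join a b ≈ 0# → a F.≈ F.0# × b F.≈ F.0#
  join≈0 {a} {b} eq = 1ω.trivial (trans (join≈ a b) eq)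

  0≈join : ∀ {a b} → a F.≈ F.0# → b F.≈ F.0# → join a b ≈ 0#
  0≈join a≈0 b≈0 = trans (+-cong (trans (ι-cong a≈0) ι-0)
    (trans (*-congˡ (trans (ι-cong b≈0) ι-0)) (zeroʳ ω))) (+-identityˡ _)

  re im : Carrier → F.Carrier
  re z = proj₁ (proj₁ (1ω.spans z))
  im z = proj₂ (proj₁ (1ω.spans z))

  join-re-im : ∀ z → z ≈ join (re z) (im z)
  join-re-im z = trans (proj₂ (1ω.spans z)) (join≈ (re z) (im z))

  ω≉0 : ¬ ω ≈ 0#
  ω≉0 ω≈0 = ω≉ι F.0# (trans ω≈0 (sym ι-0))

  1+ωι≉0 : ∀ t → ¬ 1# + ω * ι t ≈ 0#
  1+ωι≉0 t eq = F.1≉0 (proj₁ (join≈0 (trans (+-congʳ ι-1) eq)))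

  -- Counts the solutions of y / x = - (ω⁻¹ + t) / s. As (t , s) varies with s ≉ 0 the right-hand
  -- side takes each value in K ∖ F once, so there is one solution if x and y are F-independent.
  ratios : Carrier → Carrier → ℕ
  ratios x y = ∑[ t ∈ F-order ] ∑[ s ∈ F-order ] 𝟙 (¬? (s F.≟ F.0#)) ℕ.* 𝟙 (x + ω * (ι t * x + ι s * y) ≟ 0#)

  private
    ratios-zero : ∀ {x y} → (∀ {s t} → ¬ s F.≈ F.0# → ¬ x + ω * (ι t * x + ι s * y) ≈ 0#) → ratios x y ≡ 0
    ratios-zero {x} {y} none = ∑-zero F-order λ t → ∑-zero F-order λ s → at s t
      where
      at : ∀ s t → 𝟙 (¬? (s F.≟ F.0#)) ℕ.* 𝟙 (x + ω * (ι t * x + ι s * y) ≟ 0#) ≡ 0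
      at s t with s F.≟ F.0#
      ... | yes _  = ≡.refl
      ... | no s≉0 = ≡.trans (ℕ.+-identityʳ _) (𝟙-no _ (none s≉0))

    multiples-zero : ∀ {x y} → ¬ Multiple x y → ∑[ t ∈ F-order ] 𝟙 (y ≟ ι t * x) ≡ 0
    multiples-zero y∉ = ∑-zero F-order λ t → 𝟙-no _ λ y≈ → y∉ (t , y≈)

    ratios-0-0 : ∀ {x y} → x ≈ 0# → y ≈ 0# → ratios x y ℕ.+ q ≡ q ℕ.* q
    ratios-0-0 {x} {y} x≈0 y≈0 = begin
      ratios x y ℕ.+ q
        ≡⟨ ≡.cong (ℕ._+ q) (∑-cong F-order λ t → ∑-cong F-order λ s →
             ≡.trans (≡.cong (𝟙 (¬? (s F.≟ F.0#)) ℕ.*_) (𝟙-yes _ (at t s))) (ℕ.*-identityʳ _)) ⟩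
      (∑[ t ∈ F-order ] ∑[ s ∈ F-order ] 𝟙 (¬? (s F.≟ F.0#))) ℕ.+ q
        ≡⟨ ≡.cong₂ ℕ._+_ (∑-const F-order _) (≡.sym (ℕ.*-identityʳ q)) ⟩
      q ℕ.* N ℕ.+ q ℕ.* 1
        ≡⟨ ℕ.*-distribˡ-+ q N 1 ⟨
      q ℕ.* (N ℕ.+ 1)
        ≡⟨ ≡.cong (q ℕ.*_) F.count-nonzero ⟩
      q ℕ.* q ∎
      where
      open ≡.≡-Reasoning
      N : ℕ
      N = ∑[ s ∈ F-order ] 𝟙 (¬? (s F.≟ F.0#))
      at : ∀ t s → x + ω * (ι t * x + ι s * y) ≈ 0#
      at t s = trans (+-cong x≈0 (trans (*-congˡ (trans (+-cong (trans (*-congˡ x≈0) (zeroʳ _))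
        (trans (*-congˡ y≈0) (zeroʳ _))) (+-identityˡ _))) (zeroʳ ω))) (+-identityˡ _)

    -- The equation reads t x + s y = - ω⁻¹ x, and the right-hand side has unique coordinates t₀, s₀
    -- in the basis x, y. Here s₀ is nonzero, for otherwise (1 + ω t₀) x = 0.
    ratios-independent : ∀ {x y} → ¬ x ≈ 0# → ¬ Multiple x y → ratios x y ≡ 1
    ratios-independent {x} {y} x≉0 y∉ = begin
      ratios x y
        ≡⟨ ∑-cong F-order (λ t → ∑-cong F-order (at t)) ⟩
      ∑[ t ∈ F-order ] ∑[ s ∈ F-order ] 𝟙 (t F.≟ t₀) ℕ.* 𝟙 (s F.≟ s₀)
        ≡⟨ ∑-cong F-order (λ t → ≡.trans (∑-*ˡ F-order (𝟙 (t F.≟ t₀)) _)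
             (≡.trans (≡.cong (𝟙 (t F.≟ t₀) ℕ.*_) (∑-≈ F-order s₀)) (ℕ.*-identityʳ _))) ⟩
      ∑[ t ∈ F-order ] 𝟙 (t F.≟ t₀)
        ≡⟨ ∑-≈ F-order t₀ ⟩
      1 ∎
      where
      open ≡.≡-Reasoning
      open Basis x≉0 y∉
      z : Carrier
      z = proj₁ (inverse ω ω≉0)
      zω≈1 : z * ω ≈ 1#
      zω≈1 = proj₂ (inverse ω ω≉0)
      t₀ s₀ : F.Carrier
      t₀ = proj₁ (proj₁ (spans (- (z * x))))
      s₀ = proj₂ (proj₁ (spans (- (z * x))))
      solution : - (z * x) ≈ ι t₀ * x + ι s₀ * y
      solution = proj₂ (spans (- (z * x)))
      solves : ∀ {t s} → t F.≈ t₀ → s F.≈ s₀ → x + ω * (ι t * x + ι s * y) ≈ 0#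
      solves {t} {s} t≈ s≈ = trans (+-congˡ (*-congˡ (trans
        (+-cong (*-congʳ (ι-cong t≈)) (*-congʳ (ι-cong s≈))) (sym solution))))
        (trans (solve 3 (λ x ω z → x :+ ω :* :- (z :* x) := x :- z :* ω :* x) refl x ω z)
          (trans (+-congˡ (-‿cong (trans (*-congʳ zω≈1) (*-identityˡ x)))) (-‿inverseʳ x)))
      unique : ∀ {t s} → x + ω * (ι t * x + ι s * y) ≈ 0# → t F.≈ t₀ × s F.≈ s₀
      unique {t} {s} eq = combine-injective (trans (sym (*-identityˡ _)) (trans (*-congʳ (sym zω≈1))
        (trans (solve 4 (λ z ω x c → z :* ω :* c := z :* (x :+ ω :* c) :- z :* x) refl z ω x _)
          (trans (+-congʳ (trans (*-congˡ eq) (zeroʳ z))) (trans (+-identityˡ _) solution)))))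
      s₀≉0 : ¬ s₀ F.≈ F.0#
      s₀≉0 s₀≈0 = 1+ωι≉0 t₀ (*-≈0 x≉0 (trans (solve 3 (λ x ω t → x :* (con (+ 1) :+ ω :* t) := x :+ ω :* (t :* x)) refl x ω (ι t₀))
        (trans (+-congˡ (*-congˡ (sym (trans (+-congˡ (trans (*-congʳ (trans (ι-cong s₀≈0) ι-0)) (zeroˡ y))) (+-identityʳ _)))))
          (solves F.refl F.refl))))
      at : ∀ t s → 𝟙 (¬? (s F.≟ F.0#)) ℕ.* 𝟙 (x + ω * (ι t * x + ι s * y) ≟ 0#) ≡ 𝟙 (t F.≟ t₀) ℕ.* 𝟙 (s F.≟ s₀)
      at t s = ≡.trans (≡.sym (𝟙-× (¬? (s F.≟ F.0#)) (x + ω * (ι t * x + ι s * y) ≟ 0#)))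
        (≡.trans (𝟙-cong _ ((t F.≟ t₀) ×-dec (s F.≟ s₀)) (λ (_ , eq) → unique eq)
          (λ (t≈ , s≈) → (λ s≈0 → s₀≉0 (F.trans (F.sym s≈) s≈0)) , solves t≈ s≈))
        (𝟙-× (t F.≟ t₀) (s F.≟ s₀)))

  -- Let x, y be the values of a form at a, b, where a, b span a real line. The q² + 1 points of the
  -- extended line are a, the q points b - t a, and the q² - q non-real points a + ω (t a + s b)
  -- with s nonzero. The three terms on the left count the points of these kinds where the form
  -- vanishes, and a form vanishes at one point of a line or at all of them.
  ratio-count : ∀ x y → ratios x y ℕ.+ 𝟙 (x ≟ 0#) ℕ.+ (∑[ t ∈ F-order ] 𝟙 (y ≟ ι t * x))
                        ≡ 1 ℕ.+ q ℕ.* q ℕ.* 𝟙 ((x ≟ 0#) ×-dec (y ≟ 0#))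
  ratio-count x y = cases (x ≟ 0#) (y ≟ 0#) (multiple? x y)
    where
    open ≡.≡-Reasoning
    both = (x ≟ 0#) ×-dec (y ≟ 0#)
    collect : ∀ {a b c d} → ratios x y ≡ a → 𝟙 (x ≟ 0#) ≡ b → ∑[ t ∈ F-order ] 𝟙 (y ≟ ι t * x) ≡ c → 𝟙 both ≡ d →
              a ℕ.+ b ℕ.+ c ≡ 1 ℕ.+ q ℕ.* q ℕ.* d →
              ratios x y ℕ.+ 𝟙 (x ≟ 0#) ℕ.+ (∑[ t ∈ F-order ] 𝟙 (y ≟ ι t * x)) ≡ 1 ℕ.+ q ℕ.* q ℕ.* 𝟙 both
    collect ≡.refl ≡.refl ≡.refl ≡.refl eq = eq
    1+q²0 : 1 ≡ 1 ℕ.+ q ℕ.* q ℕ.* 0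
    1+q²0 = ≡.cong suc (≡.sym (ℕ.*-zeroʳ (q ℕ.* q)))
    cases : Dec (x ≈ 0#) → Dec (y ≈ 0#) → Dec (Multiple x y) →
            ratios x y ℕ.+ 𝟙 (x ≟ 0#) ℕ.+ (∑[ t ∈ F-order ] 𝟙 (y ≟ ι t * x)) ≡ 1 ℕ.+ q ℕ.* q ℕ.* 𝟙 both
    cases (yes x≈0) (yes y≈0) _ = collect ≡.refl (𝟙-yes (x ≟ 0#) x≈0)
      (≡.trans (∑-cong F-order λ t → 𝟙-yes (y ≟ ι t * x) (trans y≈0 (sym (trans (*-congˡ x≈0) (zeroʳ _)))))
        (≡.trans (∑-const F-order 1) (ℕ.*-identityʳ q)))
      (𝟙-yes both (x≈0 , y≈0))
      (begin
        ratios x y ℕ.+ 1 ℕ.+ q     ≡⟨ ≡.cong (ℕ._+ q) (ℕ.+-comm (ratios x y) 1) ⟩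
        1 ℕ.+ (ratios x y ℕ.+ q)   ≡⟨ ≡.cong suc (ratios-0-0 x≈0 y≈0) ⟩
        1 ℕ.+ q ℕ.* q              ≡⟨ ≡.cong suc (ℕ.*-identityʳ (q ℕ.* q)) ⟨
        1 ℕ.+ q ℕ.* q ℕ.* 1        ∎)
    cases (yes x≈0) (no y≉0) _ = collect
      (ratios-zero λ {s} {t} s≉0 eq → *-≉0 ω≉0 (*-≉0 (ι-≉0 s≉0) y≉0) (trans (sym (trans (+-cong x≈0 (*-congˡ
        (trans (+-congʳ (trans (*-congˡ x≈0) (zeroʳ (ι t)))) (+-identityˡ _)))) (+-identityˡ _))) eq))
      (𝟙-yes (x ≟ 0#) x≈0)
      (multiples-zero λ (t , y≈) → y≉0 (trans y≈ (trans (*-congˡ x≈0) (zeroʳ _))))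
      (𝟙-no both (y≉0 ∘ proj₂)) 1+q²0
    cases (no x≉0) _ (yes (u , y≈)) = collect
      (ratios-zero λ {s} {t} _ eq → 1+ωι≉0 (t F.+ s F.* u) (*-≈0 x≉0 (trans
        (trans (*-congˡ (+-congˡ (*-congˡ (trans (ι-+ t (s F.* u)) (+-congˡ (ι-* s u))))))
          (trans (solve 5 (λ x ω t s u → x :* (con (+ 1) :+ ω :* (t :+ s :* u)) := x :+ ω :* (t :* x :+ s :* (u :* x)))
              refl x ω (ι t) (ι s) (ι u))
            (+-congˡ (*-congˡ (+-congˡ (*-congˡ (sym y≈))))))) eq)))
      (𝟙-no (x ≟ 0#) x≉0)
      (∑-unique F-order (λ t → y ≟ ι t * x) (λ s≈t eq → trans eq (*-congʳ (ι-cong s≈t))) u y≈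
        λ t eq → F.-≈0⇒≈ (ι≈0 (*-≈0 x≉0 (trans (*-congˡ (ι-‿- t u))
          (trans (solve 3 (λ x t u → x :* (t :- u) := t :* x :- u :* x) refl x (ι t) (ι u))
            (≈⇒-≈0 (trans (sym eq) y≈)))))))
      (𝟙-no both (x≉0 ∘ proj₁)) 1+q²0
    cases (no x≉0) _ (no y∉) = collect (ratios-independent x≉0 y∉) (𝟙-no (x ≟ 0#) x≉0) (multiples-zero y∉)
      (𝟙-no both (x≉0 ∘ proj₁)) 1+q²0

-- The subgeometry PG(r, F) and the cone over the extended lines

module Embedding
  (F : HeytingField c ℓ₁ ℓ₂) {q} (F-order : HasOrder F q) (1<q : 1 ℕ.< q)
  (K : HeytingField c′ ℓ₁′ ℓ₂′) (K-order : HasOrder K (q ^ 2)) (1<q² : 1 ℕ.< q ^ 2)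
  (ι : HeytingField.Carrier F → HeytingField.Carrier K) (embedding : IsFieldEmbedding F K ι) (r : ℕ) where

  open QuadraticExtension F F-order 1<q K K-order 1<q² ι embedding public hiding (module F)
  module F where
    open FiniteField F F-order 1<q public
    open PG F r public
    open Subspaces F F-order 1<q r public
    open Lines F F-order 1<q r public
  open FiniteField K K-order 1<q²
  open PG K r
  open Subspaces K K-order 1<q² r
  open Lines K K-order 1<q² r
  open Extension F K ι r

  ιᵛ : F.V → V
  ιᵛ a j = ι (a j)

  joinᵛ : F.V → F.V → V
  joinᵛ a b = ιᵛ a ⊕ ω ⊙ ιᵛ b

  joinᵛ-cong : ∀ {a a′ b b′} → a F.≋ a′ → b F.≋ b′ → joinᵛ a b ≋ joinᵛ a′ b′
  joinᵛ-cong a≋ b≋ j = join-cong (a≋ j) (b≋ j)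

  joinᵛ-injective : ∀ {a a′ b b′} → joinᵛ a b ≋ joinᵛ a′ b′ → a F.≋ a′ × b F.≋ b′
  joinᵛ-injective eq = (λ j → proj₁ (join-injective (eq j))) , (λ j → proj₂ (join-injective (eq j)))

  joinᵛ≋0 : ∀ {a b} → joinᵛ a b ≋ 0ᵛ → a F.≋ F.0ᵛ × b F.≋ F.0ᵛ
  joinᵛ≋0 eq = (λ j → proj₁ (join≈0 (eq j))) , (λ j → proj₂ (join≈0 (eq j)))

  0≋joinᵛ : ∀ {a b} → a F.≋ F.0ᵛ → b F.≋ F.0ᵛ → joinᵛ a b ≋ 0ᵛ
  0≋joinᵛ a≋0 b≋0 j = 0≈join (a≋0 j) (b≋0 j)

  reᵛ imᵛ : V → F.V
  reᵛ w j = re (w j)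
  imᵛ w j = im (w j)

  joinᵛ-re-im : ∀ w → w ≋ joinᵛ (reᵛ w) (imᵛ w)
  joinᵛ-re-im w j = join-re-im (w j)

  ∑-joinᵛ : ∀ {f : V → ℕ} → (∀ {v w} → v ≋ w → f v ≡ f w) →
            ∑[ w ∈ points ] f w ≡ (∑[ a ∈ F.points ] ∑[ b ∈ F.points ] f (joinᵛ a b))
  ∑-joinᵛ = ∑-bijection₂ F.points F.points points joinᵛ joinᵛ-cong joinᵛ-injective
    λ w → reᵛ w , imᵛ w , joinᵛ-re-im w

  ι-dot : ∀ {n} (a b : Vector F.Carrier n) → ι (F.dot a b) ≈ dot (λ j → ι (a j)) (λ j → ι (b j))
  ι-dot {zero}  a b = ι-0
  ι-dot {suc n} a b = trans (ι-+ _ _) (+-cong (ι-* (head a) (head b)) (ι-dot (tail a) (tail b)))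

  form : V → F.V → Carrier
  form φ a = dot φ (ιᵛ a)

  form-cong : ∀ φ {a b} → a F.≋ b → form φ a ≈ form φ b
  form-cong φ a≋b = dot-cong {u = φ} ≋-refl λ j → ι-cong (a≋b j)

  form-⊕ : ∀ φ a b → form φ (a F.⊕ b) ≈ form φ a + form φ b
  form-⊕ φ a b = trans (dot-cong {u = φ} ≋-refl λ j → ι-+ (a j) (b j)) (dot-⊕ʳ φ (ιᵛ a) (ιᵛ b))

  form-⊙ : ∀ φ t a → form φ (t F.⊙ a) ≈ ι t * form φ a
  form-⊙ φ t a = trans (dot-cong {u = φ} ≋-refl λ j → ι-* t (a j)) (dot-⊙ʳ φ (ι t) (ιᵛ a))

  form-0 : ∀ φ {a} → a F.≋ F.0ᵛ → form φ a ≈ 0#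
  form-0 φ a≋0 = dot-0ʳ φ λ j → trans (ι-cong (a≋0 j)) ι-0

  dot-joinᵛ : ∀ φ a b → dot φ (joinᵛ a b) ≈ form φ a + ω * form φ b
  dot-joinᵛ φ a b = trans (dot-⊕ʳ φ (ιᵛ a) (ω ⊙ ιᵛ b)) (+-congˡ (dot-⊙ʳ φ ω (ιᵛ b)))

  form-joinᵛ : ∀ α β a → form (joinᵛ α β) a ≈ join (F.dot α a) (F.dot β a)
  form-joinᵛ α β a = trans (dot-⊕ˡ (ιᵛ α) (ω ⊙ ιᵛ β) (ιᵛ a))
    (+-cong (sym (ι-dot α a)) (trans (dot-⊙ˡ ω (ιᵛ β) (ιᵛ a)) (*-congˡ (sym (ι-dot β a)))))

  -- Real and imaginary parts of a K-combination of real vectors are F-combinations of the same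
  -- vectors. Hence independence over F persists over K, and a vector of an extended line has both
  -- parts on the original line.
  ⊙ι-joinᵛ : ∀ s t u v → s ⊙ ιᵛ u ⊕ t ⊙ ιᵛ v ≋ joinᵛ (re s F.⊙ u F.⊕ re t F.⊙ v) (im s F.⊙ u F.⊕ im t F.⊙ v)
  ⊙ι-joinᵛ s t u v j = begin
    s * ι (u j) + t * ι (v j)
      ≈⟨ +-cong (*-congʳ (join-re-im s)) (*-congʳ (join-re-im t)) ⟩
    (ι (re s) + ω * ι (im s)) * ι (u j) + (ι (re t) + ω * ι (im t)) * ι (v j)
      ≈⟨ solve 7 (λ a b c d ω u v → (a :+ ω :* b) :* u :+ (c :+ ω :* d) :* v
                                    := (a :* u :+ c :* v) :+ ω :* (b :* u :+ d :* v))
           refl (ι (re s)) (ι (im s)) (ι (re t)) (ι (im t)) ω (ι (u j)) (ι (v j)) ⟩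
    (ι (re s) * ι (u j) + ι (re t) * ι (v j)) + ω * (ι (im s) * ι (u j) + ι (im t) * ι (v j))
      ≈⟨ +-cong (at (re s) (re t)) (*-congˡ (at (im s) (im t))) ⟨
    joinᵛ (re s F.⊙ u F.⊕ re t F.⊙ v) (im s F.⊙ u F.⊕ im t F.⊙ v) j ∎
    where
    open SetoidReasoning setoid
    at : ∀ x y → ι (x F.* u j F.+ y F.* v j) ≈ ι x * ι (u j) + ι y * ι (v j)
    at x y = trans (ι-+ _ _) (+-cong (ι-* x (u j)) (ι-* y (v j)))

  opaque
    ¬Dep-ι : ∀ {u v} → ¬ F.Dep u v → ¬ Dep (ιᵛ u) (ιᵛ v)
    ¬Dep-ι {u} {v} ¬dep = trivial⇒¬Dep λ {s} {t} eq →
      let reals , imags = joinᵛ≋0 (≋-trans (≋-sym (⊙ι-joinᵛ s t u v)) eq)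
          res≈0 , ret≈0 = F.¬Dep⇒trivial ¬dep reals
          ims≈0 , imt≈0 = F.¬Dep⇒trivial ¬dep imags
      in trans (join-re-im s) (0≈join res≈0 ims≈0) , trans (join-re-im t) (0≈join ret≈0 imt≈0)

  first second : F.Line → F.V
  first ℓ  = F.basis ℓ zero
  second ℓ = F.basis ℓ (suc zero)

  first∈ : ∀ ℓ → first ℓ F.∈Sp ℓ
  first∈ ℓ = F.basis∈Span (F.basis ℓ) zero

  second∈ : ∀ ℓ → second ℓ F.∈Sp ℓ
  second∈ ℓ = F.basis∈Span (F.basis ℓ) (suc zero)

  opaque
    basis-¬Dep : ∀ ℓ → ¬ F.Dep (first ℓ) (second ℓ)
    basis-¬Dep ℓ = F.trivial⇒¬Dep λ {s} {t} eq →
      let zeros = F.independent ℓ (s ∷ t ∷ []) (λ j → F.trans (F.+-congˡ (F.+-identityʳ _)) (eq j))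
      in zeros zero , zeros (suc zero)

  extension : F.Line → Line
  extension ℓ = line (ιᵛ (first ℓ)) (ιᵛ (second ℓ)) (¬Dep-ι (basis-¬Dep ℓ))

  components∈ : ∀ ℓ {a b} → Span (pair (ιᵛ (first ℓ)) (ιᵛ (second ℓ))) (joinᵛ a b) → a F.∈Sp ℓ × b F.∈Sp ℓ
  components∈ ℓ {a} {b} (x , w≋) = on-line (proj₁ parts) , on-line (proj₂ parts)
    where
    s t : Carrier
    s = x zero
    t = x (suc zero)
    parts : a F.≋ re s F.⊙ first ℓ F.⊕ re t F.⊙ second ℓ × b F.≋ im s F.⊙ first ℓ F.⊕ im t F.⊙ second ℓ
    parts = joinᵛ-injective (≋-trans w≋ (≋-trans (pair-combination x (ιᵛ (first ℓ)) (ιᵛ (second ℓ)))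
      (⊙ι-joinᵛ s t (first ℓ) (second ℓ))))
    on-line : ∀ {y s t} → y F.≋ s F.⊙ first ℓ F.⊕ t F.⊙ second ℓ → y F.∈Sp ℓ
    on-line {s = s} {t} y≋ = F.line⊂ (F.Sp-subspace ℓ) (first∈ ℓ) (second∈ ℓ) (F.∈pair s t y≋)

  ι∈extension : ∀ ℓ {a} → a F.∈Sp ℓ → ιᵛ a ∈Sp extension ℓ
  ι∈extension ℓ {a} (x , a≋) = ∈pair (ι (x zero)) (ι (x (suc zero))) λ j →
    trans (ι-cong (F.trans (a≋ j) (F.+-congˡ (F.+-identityʳ _))))
      (trans (ι-+ _ _) (+-cong (ι-* _ _) (ι-* _ _)))

  ιᵛ≋joinᵛ : ∀ a → ιᵛ a ≋ joinᵛ a F.0ᵛ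
  ιᵛ≋joinᵛ a j = sym (trans (+-congˡ (trans (*-congˡ ι-0) (zeroʳ ω))) (+-identityʳ _))

  extension-isExtended : ∀ ℓ → IsExtendedLine ℓ (extension ℓ)
  extension-isExtended ℓ P = mk⇔ {B = P F.⊑ ℓ}
    (λ ιp∈ → F.∈⇒⊑ P ℓ (proj₁ (components∈ ℓ (resp (Sp-subspace (extension ℓ)) (ιᵛ≋joinᵛ (F.representative P)) ιp∈))))
    (λ P⊑ℓ → ι∈extension ℓ (F.⊑⇒∈ P ℓ (λ {x} → P⊑ℓ {x})))

  -- `IsExtendedLine` prescribes only the real points of `ℓ̄`. They include the images of the basis
  -- of `ℓ`, which remain independent over K, so every vector of `ℓ̄` lies on `extension ℓ`.
  extended-components∈ : ∀ {ℓ ℓ̄} → IsExtendedLine ℓ ℓ̄ → ∀ {a b} → joinᵛ a b ∈Sp ℓ̄ → a F.∈Sp ℓ × b F.∈Sp ℓ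
  extended-components∈ {ℓ} {ℓ̄} ext w∈ = components∈ ℓ
    (⊂line (¬Dep-ι (basis-¬Dep ℓ)) ℓ̄ (ι∈ first≉0 (first∈ ℓ)) (ι∈ second≉0 (second∈ ℓ)) w∈)
    where
    first≉0 : F.Nonzero (first ℓ)
    first≉0 = basis-¬Dep ℓ ∘ inj₁
    second≉0 : F.Nonzero (second ℓ)
    second≉0 = F.¬Dep⇒≉0ʳ (basis-¬Dep ℓ)
    ι∈ : ∀ {u} → F.Nonzero u → u F.∈Sp ℓ → ιᵛ u ∈Sp ℓ̄
    ι∈ {u} u≉0 u∈ = Equivalence.from (ext (F.point u u≉0)) (F.∈⇒⊑ (F.point u u≉0) ℓ u∈)

  module ExtendedCover {𝓛 : Pred F.Line p} (𝓛-resp : 𝓛 Respects F._≈ₛ_) {m} (0<m : 0 ℕ.< m)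
                       (cover : (P : F.Point) → HasSize (F.Spaces 1) (𝓛 ∩ (P F.⊑_)) m) where
    open F.Cover 𝓛-resp cover public

    X : Pred Point _
    X = extendedPoints 𝓛

    InX : V → Set _
    InX w = Σ (Nonzero w) λ w≉0 → X (point w w≉0)

    point∈X : ∀ {Q w} → X Q → Nonzero w → w ∈Sp Q → InX w
    point∈X {Q} {w} (ℓ , ℓ̄ , ℓ∈ , ext , Q⊑ℓ̄) w≉0 w∈Q = w≉0 , ℓ , ℓ̄ , ℓ∈ , ext , single⊂ ℓ̄ (Q⊑ℓ̄ w∈Q)

    InX-multiple : ∀ {w w′} → InX w → Nonzero w′ → (∃ λ t → w′ ≋ t ⊙ w) → InX w′
    InX-multiple {w} {w′} (w≉0 , w∈X) w′≉0 (t , w′≋) = point∈X {point w w≉0} {w′} w∈X w′≉0 (∈single t w′≋)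

    InX-resp : ∀ {w w′} → w ≋ w′ → InX w → InX w′
    InX-resp {w} w≋w′ w∈ = InX-multiple w∈ (Nonzero-resp w≋w′ (proj₁ w∈)) (1# , λ j → trans (sym (w≋w′ j)) (sym (*-identityˡ _)))

    InX⇒ : ∀ {a b} → InX (joinᵛ a b) → F.Dep a b ⊎ Joined a b
    InX⇒ {a} {b} (w≉0 , ℓ , ℓ̄ , ℓ∈ , ext , ⊑ℓ̄) with F.dep? a b
    ... | yes dep = inj₁ dep
    ... | no ¬dep = inj₂ (frame⇒joined ℓ∈ (¬dep , extended-components∈ {ℓ} {ℓ̄} ext (⊑ℓ̄ (u∈single (joinᵛ a b)))))

    Joined⇒InX : ∀ {a b} → Joined a b → InX (joinᵛ a b)
    Joined⇒InX {a} {b} (¬dep , ℓ∈) = (λ w≋0 → ¬dep (inj₁ (proj₁ (joinᵛ≋0 w≋0)))) ,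
      ℓ , extension ℓ , ℓ∈ , extension-isExtended ℓ ,
      single⊂ (extension ℓ) (∈pair 1# ω λ j → +-congʳ (sym (*-identityˡ _)))
      where
      ℓ : F.Line
      ℓ = F.line a b ¬dep

    -- A real point lies on m > 0 lines of 𝓛; the line with index 0 in the enumeration given by the
    -- cover is taken.
    real∈X : ∀ {u w} → F.Nonzero u → Nonzero w → (∃ λ t → w ≋ t ⊙ ιᵛ u) → InX w
    real∈X {u} {w} u≉0 w≉0 (t , w≋) = w≉0 , ℓ , extension ℓ , proj₁ (proj₂ member) , extension-isExtended ℓ ,
      single⊂ (extension ℓ) (resp (Sp-subspace (extension ℓ)) (≋-sym w≋)
        (⊙∈ (Sp-subspace (extension ℓ)) {t} {ιᵛ u} (ι∈extension ℓ (F.⊑⇒∈ (F.point u u≉0) ℓ (proj₂ (proj₂ member))))))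
      where
      member : Σ F.Line (𝓛 ∩ (F.point u u≉0 F.⊑_))
      member = Inverse.from (cover (F.point u u≉0)) (fromℕ< 0<m)
      ℓ : F.Line
      ℓ = proj₁ member

    -- For dependent a and b the vector a + ω b is a K-multiple of a real one: ω b if a = 0, and (1
    -- + ω t) a if b = t a.
    Dep⇒InX : ∀ {a b} → Nonzero (joinᵛ a b) → F.Dep a b → InX (joinᵛ a b)
    Dep⇒InX {a} {b} w≉0 (inj₁ a≋0) = real∈X {b} (λ b≋0 → w≉0 (0≋joinᵛ a≋0 b≋0)) w≉0
      (ω , λ j → trans (+-congʳ (trans (ι-cong (a≋0 j)) ι-0)) (+-identityˡ _))
    Dep⇒InX {a} {b} w≉0 (inj₂ (t , b≋)) = real∈X {a}
      (λ a≋0 → w≉0 (0≋joinᵛ a≋0 λ j → F.trans (b≋ j) (F.trans (F.*-congˡ (a≋0 j)) (F.zeroʳ t)))) w≉0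
      (1# + ω * ι t , λ j → trans (+-congˡ (*-congˡ (trans (ι-cong (b≋ j)) (ι-* t (a j)))))
        (solve 3 (λ a ω t → a :+ ω :* (t :* a) := (con (+ 1) :+ ω :* t) :* a) refl (ι (a j)) ω (ι t)))

    opaque
      inX? : ∀ w → Dec (InX w)
      inX? w = map′ (λ (w≉0 , d) → InX-resp (≋-sym (joinᵛ-re-im w)) (from-parts w≉0 d))
        (λ w∈ → let w∈′ = InX-resp (joinᵛ-re-im w) w∈ in proj₁ w∈′ , InX⇒ w∈′)
        (nonzero? (joinᵛ (reᵛ w) (imᵛ w)) ×-dec (F.dep? (reᵛ w) (imᵛ w) ⊎-dec joined? (reᵛ w) (imᵛ w)))
        where
        from-parts : ∀ {a b} → Nonzero (joinᵛ a b) → F.Dep a b ⊎ Joined a b → InX (joinᵛ a b)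
        from-parts w≉0 (inj₁ dep) = Dep⇒InX w≉0 dep
        from-parts w≉0 (inj₂ jnd) = Joined⇒InX jnd

    scalars : ℕ
    scalars = q ℕ.* q ℕ.∸ 1

    X-in : ∀ {k} (H : Space k) → Frames {S = Spaces 0} (X ∩ (_⊑ H)) points (λ w → InX w × w ∈Sp H) _
    X-in H = record
      { R?            = λ w → inX? w ×-dec ∈Sp? w H
      ; Frames-of     = λ w Q → Nonzero w × w ∈Sp Q
      ; frame?        = λ w Q → nonzero? w ×-dec ∈Sp? w Q
      ; sound         = λ {w} {Q} (Q∈X , Q⊑H) (w≉0 , w∈Q) → point∈X {Q} Q∈X w≉0 w∈Q , Q⊑H w∈Q
      ; object        = λ {w} ((w≉0 , w∈X) , w∈H) → point w w≉0 , (w∈X , single⊂ H w∈H) , w≉0 , u∈single w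
      ; object-unique = λ {w} {Q} {Q′} (w≉0 , w∈Q) (_ , w∈Q′) →
          (λ x∈ → single⊂ Q′ w∈Q′ (⊂single w≉0 Q w∈Q x∈)) , (λ x∈ → single⊂ Q w∈Q (⊂single w≉0 Q′ w∈Q′ x∈))
      ; respects      = λ (⊑ , _) (w≉0 , w∈Q) → w≉0 , ⊑ w∈Q
      ; respectsˡ     = λ {_} {_} {Q} w≋ (w≉0 , w∈Q) → Nonzero-resp w≋ w≉0 , resp (Sp-subspace Q) w≋ w∈Q
      ; count         = scalars
      ; counts        = λ {Q} _ → ≡.trans (≡.sym (ℕ.m+n∸n≡m (∑[ w ∈ points ] 𝟙 (nonzero? w ×-dec ∈Sp? w Q)) 1))
          (≡.cong (ℕ._∸ 1) (≡.trans (count-nonzero-in Q) (≡.trans (ℕ.*-identityʳ _) (≡.cong (q ℕ.*_) (ℕ.*-identityʳ q)))))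
      ; nonempty      = ℕ.m>n⇒m∸n≢0 (≡.subst (1 ℕ.<_) (≡.cong (q ℕ.*_) (ℕ.*-identityʳ q)) 1<q²)
      }
      where
      ⊂single : ∀ {w} → Nonzero w → (Q : Point) → w ∈Sp Q → ∀ {x} → x ∈Sp Q → Span (single w) x
      ⊂single {w} w≉0 Q w∈Q = span-full {b = basis Q} {single w} (independent Q) (independent (point w w≉0)) λ { zero → w∈Q }

-- Sizes of the kernels of linear forms

module Counts
  (F : HeytingField c ℓ₁ ℓ₂) {q} (F-order : HasOrder F q) (1<q : 1 ℕ.< q)
  (K : HeytingField c′ ℓ₁′ ℓ₂′) (K-order : HasOrder K (q ^ 2)) (1<q² : 1 ℕ.< q ^ 2)
  (ι : HeytingField.Carrier F → HeytingField.Carrier K) (embedding : IsFieldEmbedding F K ι) (r : ℕ)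
  {𝓛 : Pred (PG.Line F r) p} (𝓛-resp : 𝓛 Respects (PG._≈ₛ_ F r)) {m} (0<m : 0 ℕ.< m)
  (cover : (P : PG.Point F r) → HasSize (PG.Spaces F r 1) (𝓛 ∩ (PG._⊑_ F r P)) m) where

  open import Data.Nat using (_+_; _*_)
  open Embedding F F-order 1<q K K-order 1<q² ι embedding r public
  open ExtendedCover 𝓛-resp 0<m cover public
  open FiniteField K K-order 1<q² renaming (_+_ to _+ᵏ_; _*_ to _*ᵏ_)
  open PG K r using (V)
  open Subspaces K K-order 1<q² r using (points; count-ker; count-ker₂)
  open Lines K K-order 1<q² r

  private
    Q : ℕ
    Q = q ^ 2

  J : F.V → F.V → ℕ
  J a b = 𝟙 (joined? a b)

  J-cong : ∀ {a a′ b b′} → a F.≋ a′ → b F.≋ b′ → J a b ≡ J a′ b′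
  J-cong a≋ b≋ = 𝟙-cong (joined? _ _) (joined? _ _) (Joined-resp a≋ b≋) (Joined-resp (F.≋-sym a≋) (F.≋-sym b≋))

  -- The sum of G over the ordered bases of the lines of 𝓛.
  E : (F.V → F.V → ℕ) → ℕ
  E = ∑∑ F.points F.points J

  E-cong : ∀ {G H} → (∀ a b → G a b ≡ H a b) → E G ≡ E H
  E-cong G≗H = ∑-cong F.points λ a → ∑-cong F.points λ b → ≡.cong (J a b *_) (G≗H a b)

  E-+ : ∀ G H → E (λ a b → G a b + H a b) ≡ E G + E H
  E-+ = ∑∑-+ F.points F.points J

  E-*ˡ : ∀ k G → E (λ a b → k * G a b) ≡ k * E G
  E-*ˡ = ∑∑-*ˡ F.points F.points J

  E-∑ : ∀ (G : F.Carrier → F.V → F.V → ℕ) → ∑[ t ∈ F-order ] E (G t) ≡ E (λ a b → ∑[ t ∈ F-order ] G t a b)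
  E-∑ G = ≡.trans (∑-swap F-order F.points (λ t a → ∑[ b ∈ F.points ] J a b * G t a b))
    (∑-cong F.points λ a → ≡.trans (∑-swap F-order F.points (λ t b → J a b * G t a b))
      (∑-cong F.points λ b → ∑-*ˡ F-order (J a b) (λ t → G t a b)))

  E-sym : ∀ G → E (λ a b → G b a) ≡ E G
  E-sym G = ≡.trans (∑-swap F.points F.points (λ a b → J a b * G b a))
    (∑-cong F.points λ b → ∑-cong F.points λ a → ≡.cong (_* G b a)
      (𝟙-cong (joined? a b) (joined? b a) joined-sym joined-sym))

  -- With a kept fixed, b ↦ t a + s b permutes the ordered bases of each line of 𝓛 that start with
  -- a.
  E-shear : ∀ t {s} → ¬ s F.≈ F.0# → ∀ {G} → (∀ a {b b′} → b F.≋ b′ → G a b ≡ G a b′) →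
            E (λ a b → G a (t F.⊙ a F.⊕ s F.⊙ b)) ≡ E G
  E-shear t {s} s≉0 {G} G-resp = ∑-cong F.points λ a → ≡.trans
    (∑-cong F.points λ b → ≡.cong (_* G a (t F.⊙ a F.⊕ s F.⊙ b))
      (𝟙-cong (joined? a b) (joined? a (t F.⊙ a F.⊕ s F.⊙ b)) (joined-shear s≉0) (joined-unshear s≉0)))
    (F.∑-shear (t F.⊙ a) s≉0 {λ b → J a b * G a b} λ b≋ → ≡.cong₂ _*_ (J-cong F.≋-refl b≋) (G-resp a b≋))

  -- The number of vectors that complete a given nonzero vector to an ordered basis of a line of 𝓛,
  -- equal to m (q² - q).
  row : ℕ
  row = m * F.frames-per-point

  J-row : ∀ a → (∑[ b ∈ F.points ] J a b) + row * 𝟙 (a F.≋? F.0ᵛ) ≡ row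
  J-row a with a F.≋? F.0ᵛ
  ... | yes a≋0 = ≡.trans (≡.cong (_+ row * 1) (∑-zero F.points λ b → 𝟙-no (joined? a b) λ (¬dep , _) → ¬dep (inj₁ a≋0)))
                    (ℕ.*-identityʳ row)
  ... | no a≉0  = ≡.trans (≡.cong₂ _+_ (count-joined a≉0) (ℕ.*-zeroʳ row)) (ℕ.+-identityʳ row)

  -- The term added on the left accounts for a = 0, where J vanishes.
  E-first : ∀ {G : F.V → ℕ} → (∀ {a a′} → a F.≋ a′ → G a ≡ G a′) →
            E (λ a _ → G a) + row * G F.0ᵛ ≡ row * (∑[ a ∈ F.points ] G a)
  E-first {G} resp = begin
    E (λ a _ → G a) + row * G F.0ᵛ
      ≡⟨ ≡.cong₂ _+_ (∑-cong F.points λ a → ∑-*ʳ F.points (G a) (J a))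
           (≡.cong (row *_) (≡.sym (∑-≈-* F.points resp F.0ᵛ))) ⟩
    EG + row * (∑[ a ∈ F.points ] 𝟙 (a F.≋? F.0ᵛ) * G a)
      ≡⟨ ≡.cong (EG ℕ.+_)
           (∑-*ˡ F.points row (λ a → 𝟙 (a F.≋? F.0ᵛ) * G a)) ⟨
    EG + (∑[ a ∈ F.points ] row * (𝟙 (a F.≋? F.0ᵛ) * G a))
      ≡⟨ ∑-+ F.points (λ a → (∑[ b ∈ F.points ] J a b) * G a) (λ a → row * (𝟙 (a F.≋? F.0ᵛ) * G a)) ⟨
    ∑[ a ∈ F.points ] (∑[ b ∈ F.points ] J a b) * G a + row * (𝟙 (a F.≋? F.0ᵛ) * G a)
      ≡⟨ ∑-cong F.points (λ a → ≡.trans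
           (ℕsolve 4 (λ s r z g → s ℕ:* g ℕ:+ r ℕ:* (z ℕ:* g) ℕ:= (s ℕ:+ r ℕ:* z) ℕ:* g) ≡.refl
             (∑[ b ∈ F.points ] J a b) row (𝟙 (a F.≋? F.0ᵛ)) (G a))
           (≡.cong (_* G a) (J-row a))) ⟩
    ∑[ a ∈ F.points ] row * G a
      ≡⟨ ∑-*ˡ F.points row G ⟩
    row * (∑[ a ∈ F.points ] G a) ∎
    where
    open ≡.≡-Reasoning
    EG : ℕ
    EG = ∑[ a ∈ F.points ] (∑[ b ∈ F.points ] J a b) * G a

  -- Sizes are numbers of vectors in the cone, so `∣X∣` and `hits` are `scalars` = q² - 1 times
  -- numbers of points. The factor is removed only at the end, by `scalars-cancel`.
  ∣X∣ : ℕ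
  ∣X∣ = ∑[ w ∈ points ] 𝟙 (inX? w)

  hits : V → ℕ
  hits φ = ∑[ w ∈ points ] 𝟙 (inX? w) * 𝟙 (dot φ w ≟ 0#)

  joinedIn : V → ℕ
  joinedIn φ = E (λ a b → 𝟙 ((form φ a ≟ 0#) ×-dec (form φ b ≟ 0#)))

  zeros : V → ℕ
  zeros φ = ∑[ a ∈ F.points ] 𝟙 (form φ a ≟ 0#)

  T : ℕ
  T = E (λ _ _ → 1)

  T-value : T + row ≡ row * q ^ suc r
  T-value = ≡.trans (≡.cong (T ℕ.+_) (≡.sym (ℕ.*-identityʳ row)))
    (≡.trans (E-first {λ _ → 1} (λ _ → ≡.refl)) (≡.cong (row *_) (≡.trans (∑-const F.points 1) (ℕ.*-identityʳ _))))

  units : ℕ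
  units = ∑[ s ∈ F-order ] 𝟙 (¬? (s F.≟ F.0#))

  module _ (φ : V) where

    private
      f : F.V → Carrier
      f = form φ

      zero? : ∀ a → Dec (f a ≈ 0#)
      zero? a = f a ≟ 0#

      -- The ordered bases (a , b) whose non-real point a + ω b lies in the kernel of φ.
      imaginary : ℕ
      imaginary = E (λ a b → 𝟙 (f a +ᵏ ω *ᵏ f b ≟ 0#))

      T₀ : ℕ
      T₀ = E (λ a _ → 𝟙 (zero? a))

    zero?-cong : ∀ {a a′} → a F.≋ a′ → 𝟙 (zero? a) ≡ 𝟙 (zero? a′)
    zero?-cong a≋ = 𝟙-≟ 0# (form-cong φ a≋)

    T₀-value : T₀ + row ≡ row * zeros φ
    T₀-value = ≡.trans (≡.cong (T₀ ℕ.+_) (≡.trans (≡.sym (ℕ.*-identityʳ row))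
        (≡.cong (row *_) (≡.sym (𝟙-yes (zero? F.0ᵛ) (form-0 φ λ _ → F.refl))))))
      (E-first zero?-cong)

    f-shear : ∀ t s a b → f (t F.⊙ a F.⊕ s F.⊙ b) ≈ ι t *ᵏ f a +ᵏ ι s *ᵏ f b
    f-shear t s a b = trans (form-⊕ φ (t F.⊙ a) (s F.⊙ b)) (+-cong (form-⊙ φ t a) (form-⊙ φ s b))

    -- Each shear with s nonzero leaves `imaginary` unchanged. Summing over all q (q - 1) of them
    -- turns the condition on a single vector a + ω b into the number of non-real points of the
    -- extended line at which f vanishes.
    E-ratios : q * (units * imaginary) ≡ E (λ a b → ratios (f a) (f b))
    E-ratios = begin
      q * (units * imaginary)
        ≡⟨ ∑-const F-order _ ⟨
      ∑[ t ∈ F-order ] units * imaginary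
        ≡⟨ ∑-cong F-order (λ t → ∑-*ʳ F-order imaginary (λ s → 𝟙 (¬? (s F.≟ F.0#)))) ⟨
      ∑[ t ∈ F-order ] ∑[ s ∈ F-order ] 𝟙 (¬? (s F.≟ F.0#)) * imaginary
        ≡⟨ ∑-cong F-order (λ t → ∑-cong F-order (sheared t)) ⟩
      ∑[ t ∈ F-order ] ∑[ s ∈ F-order ] E (G t s)
        ≡⟨ ∑-cong F-order (λ t → E-∑ (G t)) ⟩
      ∑[ t ∈ F-order ] E (λ a b → ∑[ s ∈ F-order ] G t s a b)
        ≡⟨ E-∑ (λ t a b → ∑[ s ∈ F-order ] G t s a b) ⟩
      E (λ a b → ratios (f a) (f b)) ∎
      where
      open ≡.≡-Reasoning
      G : F.Carrier → F.Carrier → F.V → F.V → ℕ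
      G t s a b = 𝟙 (¬? (s F.≟ F.0#)) * 𝟙 (f a +ᵏ ω *ᵏ (ι t *ᵏ f a +ᵏ ι s *ᵏ f b) ≟ 0#)
      cond-cong : ∀ a {y y′} → y ≈ y′ → 𝟙 (f a +ᵏ ω *ᵏ y ≟ 0#) ≡ 𝟙 (f a +ᵏ ω *ᵏ y′ ≟ 0#)
      cond-cong a y≈ = 𝟙-≟ 0# (+-congˡ (*-congˡ y≈))
      sheared : ∀ t s → 𝟙 (¬? (s F.≟ F.0#)) * imaginary ≡ E (G t s)
      sheared t s = ≡.trans (by-case (s F.≟ F.0#)) (≡.sym (E-*ˡ (𝟙 (¬? (s F.≟ F.0#)))
          (λ a b → 𝟙 (f a +ᵏ ω *ᵏ (ι t *ᵏ f a +ᵏ ι s *ᵏ f b) ≟ 0#))))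
        where
        by-case : (d : Dec (s F.≈ F.0#)) → 𝟙 (¬? d) * imaginary
                  ≡ 𝟙 (¬? d) * E (λ a b → 𝟙 (f a +ᵏ ω *ᵏ (ι t *ᵏ f a +ᵏ ι s *ᵏ f b) ≟ 0#))
        by-case (yes _)  = ≡.refl
        by-case (no s≉0) = ≡.cong (1 *_) (≡.trans
          (≡.sym (E-shear t s≉0 {λ a b → 𝟙 (f a +ᵏ ω *ᵏ f b ≟ 0#)} λ a b≋ → cond-cong a (form-cong φ b≋)))
          (E-cong λ a b → cond-cong a (f-shear t s a b)))

    -- The condition f b = t f a says that f vanishes at b - t a. The shear b ↦ t a + b turns it
    -- into f b = 0 for every t, and a swap of the basis vectors gives `T₀`.
    E-multiples : E (λ a b → ∑[ t ∈ F-order ] 𝟙 (f b ≟ ι t *ᵏ f a)) ≡ q * T₀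
    E-multiples = begin
      E (λ a b → ∑[ t ∈ F-order ] 𝟙 (f b ≟ ι t *ᵏ f a))
        ≡⟨ E-∑ (λ t a b → 𝟙 (f b ≟ ι t *ᵏ f a)) ⟨
      ∑[ t ∈ F-order ] E (λ a b → 𝟙 (f b ≟ ι t *ᵏ f a))
        ≡⟨ ∑-cong F-order sheared ⟩
      ∑[ t ∈ F-order ] E (λ a b → 𝟙 (zero? b))
        ≡⟨ ∑-const F-order _ ⟩
      q * E (λ a b → 𝟙 (zero? b))
        ≡⟨ ≡.cong (q *_) (E-sym (λ a b → 𝟙 (zero? a))) ⟩
      q * T₀ ∎
      where
      open ≡.≡-Reasoning
      shifted : ∀ t a b → f (t F.⊙ a F.⊕ F.1# F.⊙ b) - ι t *ᵏ f a ≈ f b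
      shifted t a b = trans (+-congʳ (trans (f-shear t F.1# a b) (+-congˡ (trans (*-congʳ ι-1) (*-identityˡ _)))))
        (solve 2 (λ x y → (x :+ y) :- x := y) refl (ι t *ᵏ f a) (f b))
      sheared : ∀ t → E (λ a b → 𝟙 (f b ≟ ι t *ᵏ f a)) ≡ E (λ a b → 𝟙 (zero? b))
      sheared t = ≡.trans
        (≡.sym (E-shear t F.1≉0 {λ a b → 𝟙 (f b ≟ ι t *ᵏ f a)} λ a b≋ → 𝟙-≟ (ι t *ᵏ f a) (form-cong φ b≋)))
        (E-cong λ a b → 𝟙-cong (f (t F.⊙ a F.⊕ F.1# F.⊙ b) ≟ ι t *ᵏ f a) (zero? b)
          (λ eq → trans (sym (shifted t a b)) (≈⇒-≈0 eq))
          (λ fb≈0 → -≈0⇒≈ (trans (shifted t a b) fb≈0)))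

    -- `ratio-count` at x = f a and y = f b, summed over the ordered bases of the lines of 𝓛.
    imaginary-count : q * (units * imaginary) + T₀ + q * T₀ ≡ T + q * q * joinedIn φ
    imaginary-count = begin
      q * (units * imaginary) + T₀ + q * T₀
        ≡⟨ ≡.cong₂ (λ x y → x + T₀ + y) E-ratios (≡.sym E-multiples) ⟩
      E R + T₀ + E M
        ≡⟨ ≡.cong (_+ E M) (E-+ R (λ a _ → 𝟙 (zero? a))) ⟨
      E (λ a b → R a b + 𝟙 (zero? a)) + E M
        ≡⟨ E-+ (λ a b → R a b + 𝟙 (zero? a)) M ⟨
      E (λ a b → R a b + 𝟙 (zero? a) + M a b)
        ≡⟨ E-cong (λ a b → ratio-count (f a) (f b)) ⟩
      E (λ a b → 1 + q * q * B a b)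
        ≡⟨ E-+ (λ _ _ → 1) (λ a b → q * q * B a b) ⟩
      T + E (λ a b → q * q * B a b)
        ≡⟨ ≡.cong (T ℕ.+_) (E-*ˡ (q * q) B) ⟩
      T + q * q * joinedIn φ ∎
      where
      open ≡.≡-Reasoning
      R M B : F.V → F.V → ℕ
      R a b = ratios (f a) (f b)
      M a b = ∑[ t ∈ F-order ] 𝟙 (f b ≟ ι t *ᵏ f a)
      B a b = 𝟙 (zero? a ×-dec zero? b)

    -- f takes its values in ν F, hence f b is a multiple of f a as soon as f a ≉ 0.
    real-count : ∀ {ν} → ¬ ν ≈ 0# → (g : F.V → F.Carrier) → (∀ a → f a ≈ ν *ᵏ ι (g a)) →
                 T₀ + q * T₀ ≡ T + q * joinedIn φ
    real-count {ν} ν≉0 g f≈ = begin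
      T₀ + q * T₀                                                   ≡⟨ ≡.cong (T₀ ℕ.+_) E-multiples ⟨
      T₀ + E M                                                        ≡⟨ E-+ (λ a _ → 𝟙 (zero? a)) M ⟨
      E (λ a b → 𝟙 (zero? a) + M a b)                                 ≡⟨ E-cong (λ a b → pointwise a b (zero? a) (zero? b)) ⟩
      E (λ a b → 1 + q * B a b)                                     ≡⟨ E-+ (λ _ _ → 1) (λ a b → q * B a b) ⟩
      T + E (λ a b → q * B a b)                                     ≡⟨ ≡.cong (T ℕ.+_) (E-*ˡ q B) ⟩
      T + q * joinedIn φ                                            ∎
      where
      open ≡.≡-Reasoning
      M B : F.V → F.V → ℕ
      M a b = ∑[ t ∈ F-order ] 𝟙 (f b ≟ ι t *ᵏ f a)
      B a b = 𝟙 (zero? a ×-dec zero? b)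
      collect : ∀ a b {x y z} → 𝟙 (zero? a) ≡ x → M a b ≡ y → B a b ≡ z → x + y ≡ 1 + q * z →
                𝟙 (zero? a) + M a b ≡ 1 + q * B a b
      collect a b ≡.refl ≡.refl ≡.refl eq = eq
      pointwise : ∀ a b → Dec (f a ≈ 0#) → Dec (f b ≈ 0#) → 𝟙 (zero? a) + M a b ≡ 1 + q * B a b
      pointwise a b (yes fa≈0) (yes fb≈0) = collect a b (𝟙-yes (zero? a) fa≈0)
        (≡.trans (∑-cong F-order λ t → 𝟙-yes (f b ≟ ι t *ᵏ f a) (trans fb≈0 (sym (trans (*-congˡ fa≈0) (zeroʳ _)))))
          (≡.trans (∑-const F-order 1) (ℕ.*-identityʳ q)))
        (𝟙-yes (zero? a ×-dec zero? b) (fa≈0 , fb≈0)) (≡.cong suc (≡.sym (ℕ.*-identityʳ q)))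
      pointwise a b (yes fa≈0) (no fb≉0) = collect a b (𝟙-yes (zero? a) fa≈0)
        (∑-zero F-order λ t → 𝟙-no (f b ≟ ι t *ᵏ f a) λ eq → fb≉0 (trans eq (trans (*-congˡ fa≈0) (zeroʳ _))))
        (𝟙-no (zero? a ×-dec zero? b) (fb≉0 ∘ proj₂)) (≡.cong suc (≡.sym (ℕ.*-zeroʳ q)))
      pointwise a b (no fa≉0) _ = collect a b (𝟙-no (zero? a) fa≉0)
        (∑-unique F-order (λ t → f b ≟ ι t *ᵏ f a) (λ s≈t eq → trans eq (*-congʳ (ι-cong s≈t)))
          (z F.* g b) fb≈ λ t eq → F.-≈0⇒≈ (ι≈0 (*-≈0 fa≉0 (trans (*-congˡ (ι-‿- t (z F.* g b)))
            (trans (solve 3 (λ x t u → x :* (t :- u) := t :* x :- u :* x) refl (f a) (ι t) (ι (z F.* g b)))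
              (≈⇒-≈0 (trans (sym eq) fb≈)))))))
        (𝟙-no (zero? a ×-dec zero? b) (fa≉0 ∘ proj₁)) (≡.cong suc (≡.sym (ℕ.*-zeroʳ q)))
        where
        ga≉0 : ¬ g a F.≈ F.0#
        ga≉0 ga≈0 = fa≉0 (trans (f≈ a) (trans (*-congˡ (trans (ι-cong ga≈0) ι-0)) (zeroʳ ν)))
        z : F.Carrier
        z = proj₁ (F.inverse (g a) ga≉0)
        fb≈ : f b ≈ ι (z F.* g b) *ᵏ f a
        fb≈ = trans (f≈ b) (trans (sym (*-identityˡ _)) (trans
          (*-congʳ (sym (trans (sym (ι-* z (g a))) (trans (ι-cong (proj₂ (F.inverse (g a) ga≉0))) ι-1))))
          (trans (solve 4 (λ z ga ν gb → z :* ga :* (ν :* gb) := z :* gb :* (ν :* ga)) refl (ι z) (ι (g a)) ν (ι (g b)))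
            (*-cong (sym (ι-* z (g b))) (sym (f≈ a))))))

    -- A nonzero a + ω b is in the cone when a, b span a line of 𝓛, when b = t a for some t, or when
    -- a = 0, and these cases exclude each other. At a = b = 0 all q values of t and the case a = 0
    -- are counted on the right although the zero vector is excluded from the cone; the term with
    -- `suc q` compensates.
    inX-decomposition : ∀ a b → 𝟙 (inX? (joinᵛ a b)) + suc q * 𝟙 ((a F.≋? F.0ᵛ) ×-dec (b F.≋? F.0ᵛ))
                        ≡ J a b + (∑[ t ∈ F-order ] 𝟙 (b F.≋? (t F.⊙ a))) + 𝟙 (a F.≋? F.0ᵛ)
    inX-decomposition a b = cases (a F.≋? F.0ᵛ) (b F.≋? F.0ᵛ) (F.dep? a b)
      where
      M : ℕ
      M = ∑[ t ∈ F-order ] 𝟙 (b F.≋? (t F.⊙ a))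
      both? = (a F.≋? F.0ᵛ) ×-dec (b F.≋? F.0ᵛ)
      collect : ∀ {x y z u v} → 𝟙 (inX? (joinᵛ a b)) ≡ x → 𝟙 both? ≡ y → J a b ≡ z → M ≡ u → 𝟙 (a F.≋? F.0ᵛ) ≡ v →
                x + suc q * y ≡ z + u + v →
                𝟙 (inX? (joinᵛ a b)) + suc q * 𝟙 both? ≡ J a b + M + 𝟙 (a F.≋? F.0ᵛ)
      collect ≡.refl ≡.refl ≡.refl ≡.refl ≡.refl eq = eq
      dep⇒J≡0 : F.Dep a b → J a b ≡ 0
      dep⇒J≡0 dep = 𝟙-no (joined? a b) λ (¬dep , _) → ¬dep dep
      cases : Dec (a F.≋ F.0ᵛ) → Dec (b F.≋ F.0ᵛ) → Dec (F.Dep a b) →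
              𝟙 (inX? (joinᵛ a b)) + suc q * 𝟙 both? ≡ J a b + M + 𝟙 (a F.≋? F.0ᵛ)
      cases (yes a≋0) (yes b≋0) _ = collect
        (𝟙-no (inX? _) λ (w≉0 , _) → w≉0 (0≋joinᵛ a≋0 b≋0)) (𝟙-yes both? (a≋0 , b≋0)) (dep⇒J≡0 (inj₁ a≋0))
        (≡.trans (∑-cong F-order λ t → 𝟙-yes (b F.≋? (t F.⊙ a))
            λ j → F.trans (b≋0 j) (F.sym (F.trans (F.*-congˡ (a≋0 j)) (F.zeroʳ t))))
          (≡.trans (∑-const F-order 1) (ℕ.*-identityʳ q)))
        (𝟙-yes (a F.≋? F.0ᵛ) a≋0) (≡.trans (ℕ.*-identityʳ (suc q)) (ℕ.+-comm 1 q))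
      cases (yes a≋0) (no b≉0) _ = collect
        (𝟙-yes (inX? _) (Dep⇒InX (λ w≋0 → b≉0 (proj₂ (joinᵛ≋0 w≋0))) (inj₁ a≋0)))
        (𝟙-no both? (b≉0 ∘ proj₂)) (dep⇒J≡0 (inj₁ a≋0))
        (∑-zero F-order λ t → 𝟙-no (b F.≋? (t F.⊙ a)) λ b≋ → b≉0 λ j →
          F.trans (b≋ j) (F.trans (F.*-congˡ (a≋0 j)) (F.zeroʳ t)))
        (𝟙-yes (a F.≋? F.0ᵛ) a≋0) (≡.cong suc (ℕ.*-zeroʳ (suc q)))
      cases (no a≉0) _ (yes (inj₁ a≋0)) = contradiction a≋0 a≉0
      cases (no a≉0) _ (yes (inj₂ (u , b≋))) = collect
        (𝟙-yes (inX? _) (Dep⇒InX (λ w≋0 → a≉0 (proj₁ (joinᵛ≋0 w≋0))) (inj₂ (u , b≋))))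
        (𝟙-no both? (a≉0 ∘ proj₁)) (dep⇒J≡0 (inj₂ (u , b≋)))
        (∑-unique F-order (λ t → b F.≋? (t F.⊙ a)) (λ s≈t eq j → F.trans (eq j) (F.*-congʳ s≈t)) u b≋
          λ t eq → let i , ai≉0 = F.pivot {v = a} a≉0 in F.-≈0⇒≈ (F.*-≈0 ai≉0 (F.trans
            (F.solve 3 (λ x t u → x F.:* (t F.:- u) F.:= t F.:* x F.:- u F.:* x) F.refl (a i) t u)
            (F.≈⇒-≈0 (F.trans (F.sym (eq i)) (b≋ i))))))
        (𝟙-no (a F.≋? F.0ᵛ) a≉0) (≡.cong suc (ℕ.*-zeroʳ (suc q)))
      cases (no a≉0) _ (no ¬dep) = collect
        (𝟙-cong (inX? (joinᵛ a b)) (joined? a b) (λ w∈ → joined (InX⇒ w∈)) Joined⇒InX)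
        (𝟙-no both? (a≉0 ∘ proj₁)) ≡.refl
        (∑-zero F-order λ t → 𝟙-no (b F.≋? (t F.⊙ a)) λ b≋ → ¬dep (inj₂ (t , b≋)))
        (𝟙-no (a F.≋? F.0ᵛ) a≉0)
        (≡.trans (≡.cong (J a b ℕ.+_) (ℕ.*-zeroʳ (suc q))) (≡.sym (ℕ.+-identityʳ (J a b + 0))))
        where
        joined : F.Dep a b ⊎ Joined a b → Joined a b
        joined (inj₁ dep) = contradiction dep ¬dep
        joined (inj₂ jnd) = jnd

    -- `inX-decomposition` summed over the kernel of φ. For b = t a the form takes the value (1 + ω
    -- t) f a, and for a = 0 the value ω f b. Both vanish only at zeros of f, which gives q + 1
    -- copies of `zeros φ`.
    hits-count : hits φ + suc q ≡ imaginary + q * zeros φ + zeros φ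
    hits-count = begin
      hits φ + suc q
        ≡⟨ ≡.cong₂ _+_ hits-split (≡.trans (≡.sym (ℕ.*-identityʳ (suc q))) (≡.cong (suc q *_) (≡.sym both-split))) ⟩
      S (λ a b → 𝟙 (inX? (joinᵛ a b))) + suc q * S (λ a b → 𝟙 (both? a b))
        ≡⟨ ≡.cong (S (λ a b → 𝟙 (inX? (joinᵛ a b))) ℕ.+_) (S-*ˡ (suc q) (λ a b → 𝟙 (both? a b))) ⟨
      S (λ a b → 𝟙 (inX? (joinᵛ a b))) + S (λ a b → suc q * 𝟙 (both? a b))
        ≡⟨ S-+ (λ a b → 𝟙 (inX? (joinᵛ a b))) (λ a b → suc q * 𝟙 (both? a b)) ⟨
      S (λ a b → 𝟙 (inX? (joinᵛ a b)) + suc q * 𝟙 (both? a b))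
        ≡⟨ ∑-cong F.points (λ a → ∑-cong F.points λ b → ≡.cong (_* C a b) (inX-decomposition a b)) ⟩
      S (λ a b → J a b + M a b + 𝟙 (a F.≋? F.0ᵛ))
        ≡⟨ S-+ (λ a b → J a b + M a b) (λ a b → 𝟙 (a F.≋? F.0ᵛ)) ⟩
      S (λ a b → J a b + M a b) + S (λ a b → 𝟙 (a F.≋? F.0ᵛ))
        ≡⟨ ≡.cong₂ _+_ (S-+ J M) first-split ⟩
      imaginary + S M + zeros φ
        ≡⟨ ≡.cong (λ x → imaginary + x + zeros φ) multiples-split ⟩
      imaginary + q * zeros φ + zeros φ ∎
      where
      open ≡.≡-Reasoning
      c? : ∀ a b → Dec (f a +ᵏ ω *ᵏ f b ≈ 0#)
      c? a b = f a +ᵏ ω *ᵏ f b ≟ 0#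
      C M : F.V → F.V → ℕ
      C a b = 𝟙 (c? a b)
      M a b = ∑[ t ∈ F-order ] 𝟙 (b F.≋? (t F.⊙ a))
      both? : ∀ a b → Dec (a F.≋ F.0ᵛ × b F.≋ F.0ᵛ)
      both? a b = (a F.≋? F.0ᵛ) ×-dec (b F.≋? F.0ᵛ)
      S : (F.V → F.V → ℕ) → ℕ
      S G = ∑[ a ∈ F.points ] ∑[ b ∈ F.points ] G a b * C a b
      S-+ : ∀ G H → S (λ a b → G a b + H a b) ≡ S G + S H
      S-+ G H = ≡.trans (∑-cong F.points λ a → ≡.trans
          (∑-cong F.points λ b → ℕ.*-distribʳ-+ (C a b) (G a b) (H a b))
          (∑-+ F.points (λ b → G a b * C a b) (λ b → H a b * C a b)))
        (∑-+ F.points (λ a → ∑[ b ∈ F.points ] G a b * C a b) (λ a → ∑[ b ∈ F.points ] H a b * C a b))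
      S-*ˡ : ∀ k G → S (λ a b → k * G a b) ≡ k * S G
      S-*ˡ k G = ≡.trans (∑-cong F.points λ a → ≡.trans
          (∑-cong F.points λ b → ℕ.*-assoc k (G a b) (C a b))
          (∑-*ˡ F.points k (λ b → G a b * C a b)))
        (∑-*ˡ F.points k (λ a → ∑[ b ∈ F.points ] G a b * C a b))
      C-cong : ∀ {a a′ b b′} → a F.≋ a′ → b F.≋ b′ → C a b ≡ C a′ b′
      C-cong a≋ b≋ = 𝟙-≟ 0# (+-cong (form-cong φ a≋) (*-congˡ (form-cong φ b≋)))
      hits-split : hits φ ≡ S (λ a b → 𝟙 (inX? (joinᵛ a b)))
      hits-split = ≡.trans (∑-joinᵛ {λ w → 𝟙 (inX? w) * 𝟙 (dot φ w ≟ 0#)} (λ {v} {w} v≋w → ≡.cong₂ _*_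
          (𝟙-cong (inX? v) (inX? w) (InX-resp v≋w) (InX-resp (≋-sym v≋w)))
          (𝟙-≟ 0# (dot-cong {u = φ} ≋-refl v≋w))))
        (∑-cong F.points λ a → ∑-cong F.points λ b → ≡.cong (𝟙 (inX? (joinᵛ a b)) *_)
          (𝟙-≟ 0# (dot-joinᵛ φ a b)))
      both-split : S (λ a b → 𝟙 (both? a b)) ≡ 1
      both-split = begin
        S (λ a b → 𝟙 (both? a b))
          ≡⟨ ∑-cong F.points (λ a → ∑-cong F.points λ b → ≡.trans (≡.cong (_* C a b) (𝟙-× (a F.≋? F.0ᵛ) (b F.≋? F.0ᵛ)))
               (ℕ.*-assoc (𝟙 (a F.≋? F.0ᵛ)) (𝟙 (b F.≋? F.0ᵛ)) (C a b))) ⟩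
        ∑[ a ∈ F.points ] ∑[ b ∈ F.points ] 𝟙 (a F.≋? F.0ᵛ) * (𝟙 (b F.≋? F.0ᵛ) * C a b)
          ≡⟨ ∑-cong F.points (λ a → ≡.trans (∑-*ˡ F.points (𝟙 (a F.≋? F.0ᵛ)) (λ b → 𝟙 (b F.≋? F.0ᵛ) * C a b))
               (≡.cong (𝟙 (a F.≋? F.0ᵛ) *_) (∑-≈-* F.points (λ b≋ → C-cong {a} {a} F.≋-refl b≋) F.0ᵛ))) ⟩
        ∑[ a ∈ F.points ] 𝟙 (a F.≋? F.0ᵛ) * C a F.0ᵛ
          ≡⟨ ∑-≈-* F.points (λ a≋ → C-cong {b = F.0ᵛ} {F.0ᵛ} a≋ F.≋-refl) F.0ᵛ ⟩
        C F.0ᵛ F.0ᵛ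
          ≡⟨ 𝟙-yes (c? F.0ᵛ F.0ᵛ) (trans (+-cong f0≈0 (trans (*-congˡ f0≈0) (zeroʳ ω))) (+-identityˡ _)) ⟩
        1 ∎
        where
        f0≈0 : f F.0ᵛ ≈ 0#
        f0≈0 = form-0 φ λ _ → F.refl
      first-split : S (λ a b → 𝟙 (a F.≋? F.0ᵛ)) ≡ zeros φ
      first-split = begin
        S (λ a b → 𝟙 (a F.≋? F.0ᵛ))
          ≡⟨ ∑-swap F.points F.points (λ a b → 𝟙 (a F.≋? F.0ᵛ) * C a b) ⟩
        ∑[ b ∈ F.points ] ∑[ a ∈ F.points ] 𝟙 (a F.≋? F.0ᵛ) * C a b
          ≡⟨ ∑-cong F.points (λ b → ∑-≈-* F.points (λ a≋ → C-cong {b = b} {b} a≋ F.≋-refl) F.0ᵛ) ⟩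
        ∑[ b ∈ F.points ] C F.0ᵛ b
          ≡⟨ ∑-cong F.points (λ b → 𝟙-cong (c? F.0ᵛ b) (zero? b)
               (λ eq → *-≈0 ω≉0 (trans (sym (trans (+-congʳ (form-0 φ λ _ → F.refl)) (+-identityˡ _))) eq))
               (λ fb≈0 → trans (+-cong (form-0 φ λ _ → F.refl) (trans (*-congˡ fb≈0) (zeroʳ ω))) (+-identityˡ _))) ⟩
        zeros φ ∎
      multiples-split : S M ≡ q * zeros φ
      multiples-split = begin
        S M
          ≡⟨ ∑-cong F.points (λ a → ∑-cong F.points λ b → ∑-*ʳ F-order (C a b) (λ t → 𝟙 (b F.≋? (t F.⊙ a)))) ⟨
        ∑[ a ∈ F.points ] ∑[ b ∈ F.points ] ∑[ t ∈ F-order ] 𝟙 (b F.≋? (t F.⊙ a)) * C a b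
          ≡⟨ ∑-cong F.points (λ a → ∑-swap F.points F-order (λ b t → 𝟙 (b F.≋? (t F.⊙ a)) * C a b)) ⟩
        ∑[ a ∈ F.points ] ∑[ t ∈ F-order ] ∑[ b ∈ F.points ] 𝟙 (b F.≋? (t F.⊙ a)) * C a b
          ≡⟨ ∑-cong F.points (λ a → ∑-cong F-order λ t → ≡.trans
               (∑-≈-* F.points (λ b≋ → C-cong {a} {a} F.≋-refl b≋) (t F.⊙ a)) (on-multiple a t)) ⟩
        ∑[ a ∈ F.points ] ∑[ t ∈ F-order ] 𝟙 (zero? a)
          ≡⟨ ∑-cong F.points (λ a → ∑-const F-order (𝟙 (zero? a))) ⟩
        ∑[ a ∈ F.points ] q * 𝟙 (zero? a)
          ≡⟨ ∑-*ˡ F.points q (λ a → 𝟙 (zero? a)) ⟩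
        q * zeros φ ∎
        where
        factor : ∀ a t → f a +ᵏ ω *ᵏ f (t F.⊙ a) ≈ (1# +ᵏ ω *ᵏ ι t) *ᵏ f a
        factor a t = trans (+-congˡ (*-congˡ (form-⊙ φ t a)))
          (solve 3 (λ x ω t → x :+ ω :* (t :* x) := (con (+ 1) :+ ω :* t) :* x) refl (f a) ω (ι t))
        on-multiple : ∀ a t → C a (t F.⊙ a) ≡ 𝟙 (zero? a)
        on-multiple a t = 𝟙-cong (c? a (t F.⊙ a)) (zero? a)
          (λ eq → *-≈0 (1+ωι≉0 t) (trans (sym (factor a t)) eq))
          (λ fa≈0 → trans (factor a t) (trans (*-congˡ fa≈0) (zeroʳ _)))

    -- Eliminates imaginary and T₀ from hits-count, imaginary-count and T₀-value. All subtractions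
    -- are moved to the other side.
    hits-formula : q * (units * hits φ) + q * (units * suc q) + suc q * (row * zeros φ)
                   ≡ T + q * q * joinedIn φ + q * (units * (suc q * zeros φ)) + suc q * row
    hits-formula = begin
      q * (units * hits φ) + q * (units * suc q) + suc q * (row * zeros φ)
        ≡⟨ ≡.cong (λ x → q * (units * hits φ) + q * (units * suc q) + suc q * x) T₀-value ⟨
      q * (units * hits φ) + q * (units * suc q) + suc q * (T₀ + row)
        ≡⟨ ℕsolve 5 (λ q u h t r → q ℕ:* (u ℕ:* h) ℕ:+ q ℕ:* (u ℕ:* (ℕcon 1 ℕ:+ q)) ℕ:+ (ℕcon 1 ℕ:+ q) ℕ:* (t ℕ:+ r)
             ℕ:= q ℕ:* (u ℕ:* (h ℕ:+ (ℕcon 1 ℕ:+ q))) ℕ:+ (t ℕ:+ q ℕ:* t) ℕ:+ (ℕcon 1 ℕ:+ q) ℕ:* r)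
             ≡.refl q units (hits φ) T₀ row ⟩
      q * (units * (hits φ + suc q)) + (T₀ + q * T₀) + suc q * row
        ≡⟨ ≡.cong (λ x → q * (units * x) + (T₀ + q * T₀) + suc q * row) hits-count ⟩
      q * (units * (imaginary + q * zeros φ + zeros φ)) + (T₀ + q * T₀) + suc q * row
        ≡⟨ ℕsolve 6 (λ q u i z t r → q ℕ:* (u ℕ:* (i ℕ:+ q ℕ:* z ℕ:+ z)) ℕ:+ (t ℕ:+ q ℕ:* t) ℕ:+ (ℕcon 1 ℕ:+ q) ℕ:* r
             ℕ:= (q ℕ:* (u ℕ:* i) ℕ:+ t ℕ:+ q ℕ:* t) ℕ:+ q ℕ:* (u ℕ:* ((ℕcon 1 ℕ:+ q) ℕ:* z)) ℕ:+ (ℕcon 1 ℕ:+ q) ℕ:* r)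
             ≡.refl q units imaginary (zeros φ) T₀ row ⟩
      (q * (units * imaginary) + T₀ + q * T₀) + q * (units * (suc q * zeros φ)) + suc q * row
        ≡⟨ ≡.cong (λ x → x + q * (units * (suc q * zeros φ)) + suc q * row) imaginary-count ⟩
      T + q * q * joinedIn φ + q * (units * (suc q * zeros φ)) + suc q * row ∎
      where open ≡.≡-Reasoning

    real-formula : ∀ {ν} → ¬ ν ≈ 0# → (g : F.V → F.Carrier) → (∀ a → f a ≈ ν *ᵏ ι (g a)) →
                   suc q * (row * zeros φ) ≡ T + q * joinedIn φ + suc q * row
    real-formula ν≉0 g f≈ = begin
      suc q * (row * zeros φ)                     ≡⟨ ≡.cong (suc q *_) T₀-value ⟨
      suc q * (T₀ + row)                          ≡⟨ ℕsolve 3 (λ q t r → (ℕcon 1 ℕ:+ q) ℕ:* (t ℕ:+ r)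
                                                           ℕ:= (t ℕ:+ q ℕ:* t) ℕ:+ (ℕcon 1 ℕ:+ q) ℕ:* r) ≡.refl q T₀ row ⟩
      (T₀ + q * T₀) + suc q * row             ≡⟨ ≡.cong (_+ suc q * row) (real-count ν≉0 g f≈) ⟩
      T + q * joinedIn φ + suc q * row        ∎
      where open ≡.≡-Reasoning

  -- Sums of the sizes and of their squares over all forms

  hits-0 : ∀ {φ} → φ ≋ 0ᵛ → hits φ ≡ ∣X∣
  hits-0 {φ} φ≋0 = ∑-cong points λ w → ≡.trans
    (≡.cong (𝟙 (inX? w) *_) (𝟙-yes (dot φ w ≟ 0#) (dot-0ˡ w φ≋0))) (ℕ.*-identityʳ _)

  -- Double counting: a nonzero vector is killed by Q ^ r forms, and the cone omits the zero vector.
  first-moment : ∑[ φ ∈ points ] hits φ ≡ ∣X∣ * Q ^ r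
  first-moment = begin
    ∑[ φ ∈ points ] hits φ
      ≡⟨ ∑-swap points points (λ φ w → 𝟙 (inX? w) * 𝟙 (dot φ w ≟ 0#)) ⟩
    ∑[ w ∈ points ] ∑[ φ ∈ points ] 𝟙 (inX? w) * 𝟙 (dot φ w ≟ 0#)
      ≡⟨ ∑-cong points (λ w → ≡.trans (∑-*ˡ points (𝟙 (inX? w)) (λ φ → 𝟙 (dot φ w ≟ 0#))) (through w (inX? w))) ⟩
    ∑[ w ∈ points ] 𝟙 (inX? w) * Q ^ r
      ≡⟨ ∑-*ʳ points (Q ^ r) (λ w → 𝟙 (inX? w)) ⟩
    ∣X∣ * Q ^ r ∎
    where
    open ≡.≡-Reasoning
    through : ∀ w (d : Dec (InX w)) → 𝟙 d * (∑[ φ ∈ points ] 𝟙 (dot φ w ≟ 0#)) ≡ 𝟙 d * Q ^ r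
    through w (no _) = ≡.refl
    through w (yes (w≉0 , _)) = ≡.cong (1 *_) (≡.trans
      (∑-cong points λ φ → 𝟙-≟ 0# (dot-comm φ w))
      (count-ker w≉0))

  common : V → V → ℕ
  common v w = ∑[ φ ∈ points ] 𝟙 (dot φ v ≟ 0#) * 𝟙 (dot φ w ≟ 0#)

  -- Two independent vectors are killed together by Q ^ (r - 1) forms, two dependent nonzero ones by
  -- Q ^ r. The factor Q avoids the exponent r - 1, and the indicator terms join the two cases
  -- without subtraction.
  common-count : ∀ {v w} → Nonzero v → Nonzero w →
                 Q * common v w + Q ^ r * 𝟙 (dep? v w) ≡ Q ^ r + Q * Q ^ r * 𝟙 (dep? v w)
  common-count {v} {w} v≉0 w≉0 = cases (dep? v w)
    where
    flip : common v w ≡ ∑[ φ ∈ points ] 𝟙 (dot v φ ≟ 0#) * 𝟙 (dot w φ ≟ 0#)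
    flip = ∑-cong points λ φ → ≡.cong₂ _*_
      (𝟙-≟ 0# (dot-comm φ v))
      (𝟙-≟ 0# (dot-comm φ w))
    dependent : Dep v w → common v w ≡ Q ^ r
    dependent dep = ≡.trans flip (≡.trans (∑-cong points λ φ → absorb φ (dot v φ ≟ 0#)) (count-ker v≉0))
      where
      w-vanishes : Dep v w → ∀ φ → dot v φ ≈ 0# → dot w φ ≈ 0#
      w-vanishes (inj₁ v≋0)      φ vφ≈0 = contradiction v≋0 v≉0
      w-vanishes (inj₂ (t , w≋)) φ vφ≈0 = trans (dot-cong {u = w} {t ⊙ v} {φ} {φ} w≋ ≋-refl)
        (trans (dot-⊙ˡ t v φ) (trans (*-congˡ vφ≈0) (zeroʳ t)))
      absorb : ∀ φ (d : Dec (dot v φ ≈ 0#)) → 𝟙 d * 𝟙 (dot w φ ≟ 0#) ≡ 𝟙 d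
      absorb φ (no _)     = ≡.refl
      absorb φ (yes vφ≈0) = ≡.trans (ℕ.*-identityˡ _) (𝟙-yes (dot w φ ≟ 0#) (w-vanishes dep φ vφ≈0))
    cases : (d : Dec (Dep v w)) →
            Q * common v w + Q ^ r * 𝟙 d ≡ Q ^ r + Q * Q ^ r * 𝟙 d
    cases (yes dep) = ≡.trans (≡.cong (λ x → Q * x + Q ^ r * 1) (dependent dep))
      (ℕsolve 2 (λ x y → x ℕ:* y ℕ:+ y ℕ:* ℕcon 1 ℕ:= y ℕ:+ x ℕ:* y ℕ:* ℕcon 1) ≡.refl Q (Q ^ r))
    cases (no ¬dep) = ≡.trans (≡.cong₂ _+_ (≡.trans (≡.cong (Q *_) flip) (count-ker₂ ¬dep)) (ℕ.*-zeroʳ (Q ^ r)))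
      (≡.cong (Q ^ r ℕ.+_) (≡.sym (ℕ.*-zeroʳ (Q * Q ^ r))))

  count-multiples : ∀ {w} → InX w → ∑[ x ∈ points ] 𝟙 (inX? x) * 𝟙 (dep? w x) ≡ scalars
  count-multiples {w} w∈@(w≉0 , _) = ≡.trans
    (∑-cong points λ x → ≡.trans (≡.sym (𝟙-× (inX? x) (dep? w x)))
      (𝟙-cong (inX? x ×-dec dep? w x) (nonzero? x ×-dec ∈Sp? x P) (λ (x∈ , dep) → proj₁ x∈ , to-span dep)
        (λ (x≉0 , x∈P) → InX-multiple w∈ x≉0 (single∈ x∈P) , inj₂ (single∈ x∈P))))
    (Frames.counts (X-in P) {P} (proj₂ w∈ , λ x∈ → x∈))
    where
    P : PG.Point K r
    P = point w w≉0
    to-span : ∀ {x} → Dep w x → x ∈Sp P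
    to-span (inj₁ w≋0)      = contradiction w≋0 w≉0
    to-span (inj₂ (t , x≋)) = ∈single t x≋

  -- The square of `hits φ` counts pairs of cone vectors killed by φ. Exchanging sums leaves
  -- `common v w` over all ∣X∣² pairs, of which `scalars` * ∣X∣ are dependent.
  second-moment : Q * (∑[ φ ∈ points ] hits φ * hits φ) + Q ^ r * (scalars * ∣X∣)
                  ≡ Q ^ r * (∣X∣ * ∣X∣) + Q * Q ^ r * (scalars * ∣X∣)
  second-moment = begin
    Q * (∑[ φ ∈ points ] hits φ * hits φ) + q^ * (k * ∣X∣)
      ≡⟨ ≡.cong₂ (λ x y → Q * x + q^ * y) expand (≡.sym (dependent-pairs)) ⟩
    Q * D common + q^ * D (λ v w → 𝟙 (dep? v w))
      ≡⟨ ≡.cong₂ _+_ (D-*ˡ Q common) (D-*ˡ q^ (λ v w → 𝟙 (dep? v w))) ⟨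
    D (λ v w → Q * common v w) + D (λ v w → q^ * 𝟙 (dep? v w))
      ≡⟨ D-+ (λ v w → Q * common v w) (λ v w → q^ * 𝟙 (dep? v w)) ⟨
    D (λ v w → Q * common v w + q^ * 𝟙 (dep? v w))
      ≡⟨ ∑-cong points (λ v → ∑-cong points λ w → on-X v w (inX? v) (inX? w)) ⟩
    D (λ v w → q^ + Q * q^ * 𝟙 (dep? v w))
      ≡⟨ D-+ (λ _ _ → q^) (λ v w → Q * q^ * 𝟙 (dep? v w)) ⟩
    D (λ _ _ → q^) + D (λ v w → Q * q^ * 𝟙 (dep? v w))
      ≡⟨ ≡.cong₂ _+_ all-pairs (≡.trans (D-*ˡ (Q * q^) (λ v w → 𝟙 (dep? v w))) (≡.cong (Q * q^ *_) dependent-pairs)) ⟩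
    q^ * (∣X∣ * ∣X∣) + Q * q^ * (k * ∣X∣) ∎
    where
    open ≡.≡-Reasoning
    q^ k : ℕ
    q^ = Q ^ r
    k = scalars
    x : V → ℕ
    x w = 𝟙 (inX? w)
    W : V → V → ℕ
    W v w = x v * x w
    D : (V → V → ℕ) → ℕ
    D = ∑∑ points points W
    D-+ : ∀ G H → D (λ v w → G v w + H v w) ≡ D G + D H
    D-+ = ∑∑-+ points points W
    D-*ˡ : ∀ k G → D (λ v w → k * G v w) ≡ k * D G
    D-*ˡ = ∑∑-*ˡ points points W
    on-X : ∀ v w (d : Dec (InX v)) (d′ : Dec (InX w)) →
           𝟙 d * 𝟙 d′ * (Q * common v w + q^ * 𝟙 (dep? v w))
           ≡ 𝟙 d * 𝟙 d′ * (q^ + Q * q^ * 𝟙 (dep? v w))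
    on-X v w (no _)          _               = ≡.refl
    on-X v w (yes _)         (no _)          = ≡.refl
    on-X v w (yes (v≉0 , _)) (yes (w≉0 , _)) = ≡.cong (1 *_) (common-count v≉0 w≉0)
    all-pairs : D (λ _ _ → q^) ≡ q^ * (∣X∣ * ∣X∣)
    all-pairs = begin
      D (λ _ _ → q^)
        ≡⟨ ∑-cong points (λ v → ≡.trans (∑-*ʳ points q^ (λ w → x v * x w)) (≡.cong (_* q^) (∑-*ˡ points (x v) x))) ⟩
      ∑[ v ∈ points ] x v * ∣X∣ * q^
        ≡⟨ ≡.trans (∑-*ʳ points q^ (λ v → x v * ∣X∣)) (≡.cong (_* q^) (∑-*ʳ points ∣X∣ x)) ⟩
      ∣X∣ * ∣X∣ * q^
        ≡⟨ ℕ.*-comm (∣X∣ * ∣X∣) q^ ⟩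
      q^ * (∣X∣ * ∣X∣) ∎
    dependent-pairs : D (λ v w → 𝟙 (dep? v w)) ≡ k * ∣X∣
    dependent-pairs = begin
      D (λ v w → 𝟙 (dep? v w))
        ≡⟨ ∑-cong points (λ v → ≡.trans (∑-cong points λ w → ℕ.*-assoc (x v) (x w) (𝟙 (dep? v w)))
             (≡.trans (∑-*ˡ points (x v) (λ w → x w * 𝟙 (dep? v w))) (at v (inX? v)))) ⟩
      ∑[ v ∈ points ] x v * k
        ≡⟨ ≡.trans (∑-*ʳ points k x) (ℕ.*-comm ∣X∣ k) ⟩
      k * ∣X∣ ∎
      where
      at : ∀ v (d : Dec (InX v)) → 𝟙 d * (∑[ w ∈ points ] x w * 𝟙 (dep? v w)) ≡ 𝟙 d * k
      at v (no _)   = ≡.refl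
      at v (yes v∈) = ≡.cong (1 *_) (count-multiples v∈)
    expand : ∑[ φ ∈ points ] hits φ * hits φ ≡ D common
    expand = begin
      ∑[ φ ∈ points ] hits φ * hits φ
        ≡⟨ ∑-cong points (λ φ → ≡.trans (≡.sym (∑-*ʳ points (hits φ) (λ v → x v * o φ v)))
             (∑-cong points λ v → ≡.sym (∑-*ˡ points (x v * o φ v) (λ w → x w * o φ w)))) ⟩
      ∑[ φ ∈ points ] ∑[ v ∈ points ] ∑[ w ∈ points ] x v * o φ v * (x w * o φ w)
        ≡⟨ ∑-swap points points (λ φ v → ∑[ w ∈ points ] x v * o φ v * (x w * o φ w)) ⟩
      ∑[ v ∈ points ] ∑[ φ ∈ points ] ∑[ w ∈ points ] x v * o φ v * (x w * o φ w)
        ≡⟨ ∑-cong points (λ v → ∑-swap points points (λ φ w → x v * o φ v * (x w * o φ w))) ⟩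
      ∑[ v ∈ points ] ∑[ w ∈ points ] ∑[ φ ∈ points ] x v * o φ v * (x w * o φ w)
        ≡⟨ ∑-cong points (λ v → ∑-cong points λ w → ≡.trans
             (∑-cong points λ φ → ℕsolve 4 (λ a b c d → a ℕ:* b ℕ:* (c ℕ:* d) ℕ:= a ℕ:* c ℕ:* (b ℕ:* d)) ≡.refl (x v) (o φ v) (x w) (o φ w))
             (∑-*ˡ points (x v * x w) (λ φ → o φ v * o φ w))) ⟩
      D common ∎
      where
      o : V → V → ℕ
      o φ w = 𝟙 (dot φ w ≟ 0#)

-- Arithmetic of the sizes

module Arithmetic where
  open import Data.Integer using (_+_; _*_; _-_; -_; 0ℤ; 1ℤ)
  open ℤSolver.+-*-Solver using (solve; _:+_; _:*_; _:-_; :-_; _:=_; con)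

  -- Reified polynomials: an equation between natural numbers can then be read in ℤ.
  data Expression : Set where
    ⟨_⟩     : ℕ → Expression
    _⊞_ _⊠_ : Expression → Expression → Expression

  infixl 6 _⊞_
  infixl 7 _⊠_

  evalℕ : Expression → ℕ
  evalℕ ⟨ n ⟩   = n
  evalℕ (e ⊞ f) = evalℕ e ℕ.+ evalℕ f
  evalℕ (e ⊠ f) = evalℕ e ℕ.* evalℕ f

  evalℤ : Expression → ℤ
  evalℤ ⟨ n ⟩   = + n
  evalℤ (e ⊞ f) = evalℤ e ℤ.+ evalℤ f
  evalℤ (e ⊠ f) = evalℤ e ℤ.* evalℤ f

  evalℤ≡ : ∀ e → + evalℕ e ≡ evalℤ e
  evalℤ≡ ⟨ n ⟩   = ≡.refl
  evalℤ≡ (e ⊞ f) = ≡.trans (ℤ.pos-+ (evalℕ e) (evalℕ f)) (≡.cong₂ ℤ._+_ (evalℤ≡ e) (evalℤ≡ f))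
  evalℤ≡ (e ⊠ f) = ≡.trans (ℤ.pos-* (evalℕ e) (evalℕ f)) (≡.cong₂ ℤ._*_ (evalℤ≡ e) (evalℤ≡ f))

  toℤ : ∀ e f → evalℕ e ≡ evalℕ f → evalℤ e ≡ evalℤ f
  toℤ e f eq = ≡.trans (≡.sym (evalℤ≡ e)) (≡.trans (≡.cong +_ eq) (evalℤ≡ f))

  -≡0 : ∀ {x y} → x ≡ y → x - y ≡ 0ℤ
  -≡0 = ℤ.i≡j⇒i-j≡0

  ≡-from : ∀ {x y} → x - y ≡ 0ℤ → x ≡ y
  ≡-from {x} {y} = ℤ.i-j≡0⇒i≡j x y

  *-cancel-0 : ∀ {x y} → x ≢ 0ℤ → x * y ≡ 0ℤ → y ≡ 0ℤ
  *-cancel-0 {x} x≢0 eq with ℤ.i*j≡0⇒i≡0∨j≡0 x eq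
  ... | inj₁ x≡0 = contradiction x≡0 x≢0
  ... | inj₂ y≡0 = y≡0

  combination₃ : ∀ {x y z} a b c → x ≡ 0ℤ → y ≡ 0ℤ → z ≡ 0ℤ → a * x + b * y + c * z ≡ 0ℤ
  combination₃ a b c ≡.refl ≡.refl ≡.refl =
    solve 3 (λ a b c → a :* con 0ℤ :+ b :* con 0ℤ :+ c :* con 0ℤ := con 0ℤ) ≡.refl a b c

  -- With c = q ^ (r - 1) and w = m (q² - q), the size at a real form: (q + 1)(q ^ r - 1) nonzero
  -- K-multiples of real vectors, and w (c - 1) other vectors, one for each ordered basis of a line
  -- of 𝓛 in the hyperplane.
  realSize : ℤ → ℤ → ℤ → ℤ
  realSize q c w = w * (c - 1ℤ) + (q + 1ℤ) * (q * c - 1ℤ)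

  -- The same count for the whole space: (q + 1)(q ^ (r + 1) - 1) multiples of real vectors and w (q
  -- ^ (r + 1) - 1) others.
  coverSize : ℤ → ℤ → ℤ → ℤ
  coverSize q c w = (q * q * c - 1ℤ) * (q + 1ℤ + w)

  pos≢0 : ∀ {n} → n ≢ 0 → + n ≢ 0ℤ
  pos≢0 n≢0 eq = n≢0 (ℤ.+-injective eq)

  *-≢0 : ∀ {x y} → x ≢ 0ℤ → y ≢ 0ℤ → x * y ≢ 0ℤ
  *-≢0 x≢0 y≢0 eq = y≢0 (*-cancel-0 x≢0 eq)

  module _ {k : ℕ} (k≢0 : k ≢ 0) where
    private
      q : ℕ
      q = suc k

      qk≢0 : + q * + k ≢ 0ℤ
      qk≢0 = *-≢0 {+ q} {+ k} (λ ()) (pos≢0 k≢0)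

    HitsFormula : (row T h Z p : ℕ) → Set
    HitsFormula row T h Z p =
      q ℕ.* (k ℕ.* h) ℕ.+ q ℕ.* (k ℕ.* suc q) ℕ.+ suc q ℕ.* (row ℕ.* Z)
      ≡ T ℕ.+ q ℕ.* q ℕ.* p ℕ.+ q ℕ.* (k ℕ.* (suc q ℕ.* Z)) ℕ.+ suc q ℕ.* row

    hitsDifference : ℤ → ℤ → ℤ → ℤ → ℤ → ℤ
    hitsDifference w T h Z p = (+ q * (+ k * h) + + q * (+ k * + suc q) + + suc q * (w * Z))
      - (T + + q * + q * p + + q * (+ k * (+ suc q * Z)) + + suc q * w)

    hitsℤ : ∀ {row T h Z p} → HitsFormula row T h Z p →
      hitsDifference (+ row) (+ T) (+ h) (+ Z) (+ p) ≡ 0ℤ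
    hitsℤ {row} {T} {h} {Z} {p} eq = -≡0 (toℤ
      (⟨ q ⟩ ⊠ (⟨ k ⟩ ⊠ ⟨ h ⟩) ⊞ ⟨ q ⟩ ⊠ (⟨ k ⟩ ⊠ ⟨ suc q ⟩) ⊞ ⟨ suc q ⟩ ⊠ (⟨ row ⟩ ⊠ ⟨ Z ⟩))
      (⟨ T ⟩ ⊞ ⟨ q ⟩ ⊠ ⟨ q ⟩ ⊠ ⟨ p ⟩ ⊞ ⟨ q ⟩ ⊠ (⟨ k ⟩ ⊠ (⟨ suc q ⟩ ⊠ ⟨ Z ⟩)) ⊞ ⟨ suc q ⟩ ⊠ ⟨ row ⟩) eq)

    Tℤ : ∀ {row T c} → T ℕ.+ row ≡ row ℕ.* (q ℕ.* (q ℕ.* c)) →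
         (+ T + + row) - + row * (+ q * (+ q * + c)) ≡ 0ℤ
    Tℤ {row} {T} {c} eq = -≡0 (toℤ (⟨ T ⟩ ⊞ ⟨ row ⟩) (⟨ row ⟩ ⊠ (⟨ q ⟩ ⊠ (⟨ q ⟩ ⊠ ⟨ c ⟩))) eq)

    -- Elimination: - q times the equation for real forms cancels p, then - k times the equation for
    -- T cancels T. What remains is divisible by q k.
    real-size : ∀ {row T h p c} → T ℕ.+ row ≡ row ℕ.* (q ℕ.* (q ℕ.* c)) → HitsFormula row T h (q ℕ.* c) p →
      suc q ℕ.* (row ℕ.* (q ℕ.* c)) ≡ T ℕ.+ q ℕ.* p ℕ.+ suc q ℕ.* row → + h ≡ realSize (+ q) (+ c) (+ row)
    real-size {row} {T} {h} {p} {c} T-eq hits-eq real-eq = ≡-from (*-cancel-0 qk≢0 (≡.trans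
      (solve 6 (λ k h T p c w →
          let q = con 1ℤ :+ k ; q+1 = con 1ℤ :+ q ; Z = q :* c in
          q :* k :* (h :- (w :* (c :- con 1ℤ) :+ (q :+ con 1ℤ) :* (q :* c :- con 1ℤ))) :=
          con 1ℤ :* ((q :* (k :* h) :+ q :* (k :* q+1) :+ q+1 :* (w :* Z))
                     :- (T :+ q :* q :* p :+ q :* (k :* (q+1 :* Z)) :+ q+1 :* w))
          :+ (:- q) :* (q+1 :* (w :* Z) :- (T :+ q :* p :+ q+1 :* w))
          :+ (:- k) :* ((T :+ w) :- w :* (q :* (q :* c)))) ≡.refl (+ k) (+ h) (+ T) (+ p) (+ c) (+ row))
      (combination₃ 1ℤ (- + q) (- + k)
        (≡.subst (λ z → hitsDifference (+ row) (+ T) (+ h) z (+ p) ≡ 0ℤ) (ℤ.pos-* q c)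
          (hitsℤ {row} {T} {h} {q ℕ.* c} {p} hits-eq))
        (-≡0 (toℤ (⟨ suc q ⟩ ⊠ (⟨ row ⟩ ⊠ (⟨ q ⟩ ⊠ ⟨ c ⟩))) (⟨ T ⟩ ⊞ ⟨ q ⟩ ⊠ ⟨ p ⟩ ⊞ ⟨ suc q ⟩ ⊠ ⟨ row ⟩) real-eq))
        (Tℤ {row} {T} {c} T-eq))))

    -- This is the formula for the zero form, whose zeros are all real vectors and whose kernel
    -- contains every ordered basis; hence q² c in place of Z and T in place of p.
    cover-size : ∀ {row T A c} → T ℕ.+ row ≡ row ℕ.* (q ℕ.* (q ℕ.* c)) → HitsFormula row T A (q ℕ.* (q ℕ.* c)) T →
      + A ≡ coverSize (+ q) (+ c) (+ row)
    cover-size {row} {T} {A} {c} T-eq hits-eq = ≡-from (*-cancel-0 qk≢0 (≡.trans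
      (solve 5 (λ k A T c w →
          let q = con 1ℤ :+ k ; q+1 = con 1ℤ :+ q ; Z = q :* (q :* c) in
          q :* k :* (A :- (q :* q :* c :- con 1ℤ) :* (q :+ con 1ℤ :+ w)) :=
          con 1ℤ :* ((q :* (k :* A) :+ q :* (k :* q+1) :+ q+1 :* (w :* Z))
                     :- (T :+ q :* q :* T :+ q :* (k :* (q+1 :* Z)) :+ q+1 :* w))
          :+ (con 1ℤ :+ q :* q) :* ((T :+ w) :- w :* (q :* (q :* c)))
          :+ con 0ℤ :* con 0ℤ) ≡.refl (+ k) (+ A) (+ T) (+ c) (+ row))
      (combination₃ 1ℤ (1ℤ + + q * + q) 0ℤ
        (≡.subst (λ z → hitsDifference (+ row) (+ T) (+ A) z (+ T) ≡ 0ℤ)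
            (evalℤ≡ (⟨ q ⟩ ⊠ (⟨ q ⟩ ⊠ ⟨ c ⟩)))
          (hitsℤ {row} {T} {A} {q ℕ.* (q ℕ.* c)} {T} hits-eq))
        (Tℤ {row} {T} {c} T-eq) ≡.refl)))

    -- d = q ^ (r - 3), and N lines of the cover lie in the (r - 2)-space.
    imaginary-size : ∀ {m T h N d} → let row = m ℕ.* (q ℕ.* k) ; c = q ℕ.* (q ℕ.* d) in
      T ℕ.+ row ≡ row ℕ.* (q ℕ.* (q ℕ.* c)) → HitsFormula row T h c (N ℕ.* ((k ℕ.+ k ℕ.* q) ℕ.* (q ℕ.* k))) →
      realSize (+ q) (+ c) (+ row) - + h
        ≡ + q * + q * ((+ k + + k * + q) * + d + + m * (+ d - 1ℤ) - + N * (+ k + + k * + q))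
    imaginary-size {m} {T} {h} {N} {d} T-eq hits-eq = ≡-from (*-cancel-0 qk≢0 (≡.trans
      (≡.cong₂ (λ c w → + q * + k * ((realSize (+ q) c w - + h) - + q * + q * (K₁ * + d + + m * (+ d - 1ℤ) - + N * K₁))) c≡ w≡)
      (≡.trans
      (solve 6 (λ k h T N d m →
          let q = con 1ℤ :+ k ; q+1 = con 1ℤ :+ q ; c = q :* (q :* d) ; K₁ = k :+ k :* q ; w = m :* (q :* k)
              p = N :* (K₁ :* (q :* k)) in
          q :* k :* ((w :* (c :- con 1ℤ) :+ (q :+ con 1ℤ) :* (q :* c :- con 1ℤ) :- h)
                     :- q :* q :* (K₁ :* d :+ m :* (d :- con 1ℤ) :- N :* K₁)) :=
          con (- 1ℤ) :* ((q :* (k :* h) :+ q :* (k :* q+1) :+ q+1 :* (w :* c))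
                     :- (T :+ q :* q :* p :+ q :* (k :* (q+1 :* c)) :+ q+1 :* w))
          :+ con (- 1ℤ) :* ((T :+ w) :- w :* (q :* (q :* c)))
          :+ con 0ℤ :* con 0ℤ) ≡.refl (+ k) (+ h) (+ T) (+ N) (+ d) (+ m))
      (combination₃ (- 1ℤ) (- 1ℤ) 0ℤ
        (≡.subst (λ (c , w , p) → hitsDifference w (+ T) (+ h) c p ≡ 0ℤ)
            (≡.cong₂ _,_ c≡ (≡.cong₂ _,_ w≡ p≡))
          (hitsℤ {m ℕ.* (q ℕ.* k)} {T} {h} {q ℕ.* (q ℕ.* d)} {N ℕ.* ((k ℕ.+ k ℕ.* q) ℕ.* (q ℕ.* k))} hits-eq))
        (≡.subst (λ (c , w) → (+ T + w) - w * (+ q * (+ q * c)) ≡ 0ℤ)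
            (≡.cong₂ _,_ c≡ w≡)
          (Tℤ {m ℕ.* (q ℕ.* k)} {T} {q ℕ.* (q ℕ.* d)} T-eq)) ≡.refl))))
      where
      K₁ : ℤ
      K₁ = + k + + k * + q
      c≡ : + (q ℕ.* (q ℕ.* d)) ≡ + q * (+ q * + d)
      c≡ = evalℤ≡ (⟨ q ⟩ ⊠ (⟨ q ⟩ ⊠ ⟨ d ⟩))
      w≡ : + (m ℕ.* (q ℕ.* k)) ≡ + m * (+ q * + k)
      w≡ = evalℤ≡ (⟨ m ⟩ ⊠ (⟨ q ⟩ ⊠ ⟨ k ⟩))
      p≡ : + (N ℕ.* ((k ℕ.+ k ℕ.* q) ℕ.* (q ℕ.* k))) ≡ + N * ((+ k + + k * + q) * (+ q * + k))
      p≡ = evalℤ≡ (⟨ N ⟩ ⊠ ((⟨ k ⟩ ⊞ ⟨ k ⟩ ⊠ ⟨ q ⟩) ⊠ (⟨ q ⟩ ⊠ ⟨ k ⟩)))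

  -- The factored form of D a - S₁, with D the number of nonzero forms, a the size at a real form
  -- and S₁ the sum of the sizes.
  excess : ℤ → ℤ → ℤ → ℤ
  excess q c w = (q * q * c - 1ℤ) * (c * (q * q - 1ℤ)) * (q * (q * c - 1ℤ) - w)

  first-moment-identity : ∀ q c w → let A = coverSize q c w in
    (q * q * (q * q * (c * c)) - 1ℤ) * realSize q c w - (A * (q * q * (c * c)) - A) ≡ excess q c w
  first-moment-identity = solve 3 (λ q c w →
    let A = (q :* q :* c :- con 1ℤ) :* (q :+ con 1ℤ :+ w)
        R = w :* (c :- con 1ℤ) :+ (q :+ con 1ℤ) :* (q :* c :- con 1ℤ) in
    (q :* q :* (q :* q :* (c :* c)) :- con 1ℤ) :* R :- (A :* (q :* q :* (c :* c)) :- A)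
    := (q :* q :* c :- con 1ℤ) :* (c :* (q :* q :- con 1ℤ)) :* (q :* (q :* c :- con 1ℤ) :- w)) ≡.refl

  -- The left-hand side is a S₁ - S₂. Its quotient by the excess is the only candidate for a second
  -- value.
  second-moment-identity : ∀ q c w → let A = coverSize q c w ; k = q * q - 1ℤ in
    realSize q c w * (A * (q * q * (c * c)) - A) - (c * c * (A * A + k * (k * A)) - A * A)
    ≡ (realSize q c w - k * c) * excess q c w
  second-moment-identity = solve 3 (λ q c w →
    let A = (q :* q :* c :- con 1ℤ) :* (q :+ con 1ℤ :+ w)
        R = w :* (c :- con 1ℤ) :+ (q :+ con 1ℤ) :* (q :* c :- con 1ℤ)
        k = q :* q :- con 1ℤ in
    R :* (A :* (q :* q :* (c :* c)) :- A) :- (c :* c :* (A :* A :+ k :* (k :* A)) :- A :* A)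
    := (R :- k :* c) :* ((q :* q :* c :- con 1ℤ) :* (c :* (q :* q :- con 1ℤ)) :* (q :* (q :* c :- con 1ℤ) :- w))) ≡.refl

  -- θ₁ = θ_{r-1}, c = q ^ (r - 1), a the size at a real form, S₁ and S₂ the sums of the
  -- sizes and of their squares over the D nonzero forms.
  module Moments {k m row θ₁ c A D S₁ S₂ M₂ a : ℕ} (k≢0 : k ≢ 0) (c≢0 : c ≢ 0) (m<θ₁ : m ℕ.< θ₁)
    (row≡ : row ≡ m ℕ.* (suc k ℕ.* k)) (θ₁≡ : k ℕ.* θ₁ ℕ.+ 1 ≡ suc k ℕ.* c)
    (A≡ : + A ≡ coverSize (+ suc k) (+ c) (+ row)) (a≡ : + a ≡ realSize (+ suc k) (+ c) (+ row))
    (S₁≡ : S₁ ℕ.+ A ≡ A ℕ.* (suc k ℕ.* suc k ℕ.* (c ℕ.* c))) (S₂≡ : S₂ ℕ.+ A ℕ.* A ≡ M₂)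
    (M₂≡ : suc k ℕ.* suc k ℕ.* M₂ ℕ.+ suc k ℕ.* suc k ℕ.* (c ℕ.* c) ℕ.* ((k ℕ.+ k ℕ.* suc k) ℕ.* A)
           ≡ suc k ℕ.* suc k ℕ.* (c ℕ.* c) ℕ.* (A ℕ.* A) ℕ.+ suc k ℕ.* suc k ℕ.* (suc k ℕ.* suc k ℕ.* (c ℕ.* c)) ℕ.* ((k ℕ.+ k ℕ.* suc k) ℕ.* A))
    (D≡ : D ℕ.+ 1 ≡ suc k ℕ.* suc k ℕ.* (suc k ℕ.* suc k ℕ.* (c ℕ.* c))) where

    private
      q : ℕ
      q = suc k

      Aℤ aℤ K₁ E : ℤ
      Aℤ = coverSize (+ q) (+ c) (+ row)
      aℤ = realSize (+ q) (+ c) (+ row)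
      K₁ = + q * + q - 1ℤ
      E = excess (+ q) (+ c) (+ row)

      K₁≡ : + k + + k * + q ≡ K₁
      K₁≡ = solve 1 (λ k → let q = con 1ℤ :+ k in k :+ k :* q := q :* q :- con 1ℤ) ≡.refl (+ k)

      S₁ℤ : + S₁ ≡ Aℤ * (+ q * + q * (+ c * + c)) - Aℤ
      S₁ℤ = ≡.trans (solve 2 (λ s a → s := (s :+ a) :- a) ≡.refl (+ S₁) (+ A))
        (≡.trans (≡.cong (λ z → z - + A) (toℤ (⟨ S₁ ⟩ ⊞ ⟨ A ⟩) (⟨ A ⟩ ⊠ (⟨ q ⟩ ⊠ ⟨ q ⟩ ⊠ (⟨ c ⟩ ⊠ ⟨ c ⟩))) S₁≡))
          (≡.cong (λ A → A * (+ q * + q * (+ c * + c)) - A) A≡))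

      Dℤ : + D ≡ + q * + q * (+ q * + q * (+ c * + c)) - 1ℤ
      Dℤ = ≡.trans (solve 1 (λ s → s := (s :+ con 1ℤ) :- con 1ℤ) ≡.refl (+ D))
        (≡.cong (λ z → z - 1ℤ) (toℤ (⟨ D ⟩ ⊞ ⟨ 1 ⟩) (⟨ q ⟩ ⊠ ⟨ q ⟩ ⊠ (⟨ q ⟩ ⊠ ⟨ q ⟩ ⊠ (⟨ c ⟩ ⊠ ⟨ c ⟩))) D≡))

      M₂ℤ : + M₂ ≡ + c * + c * (+ A * + A + K₁ * (K₁ * + A))
      M₂ℤ = ≡-from (*-cancel-0 {+ q * + q} (*-≢0 {+ q} {+ q} (λ ()) λ ()) (≡.trans
        (solve 4 (λ k m c a → let q = con 1ℤ :+ k ; K₁ = q :* q :- con 1ℤ ; K = k :+ k :* q in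
            q :* q :* (m :- c :* c :* (a :* a :+ K₁ :* (K₁ :* a))) :=
            (q :* q :* m :+ q :* q :* (c :* c) :* (K :* a))
            :- (q :* q :* (c :* c) :* (a :* a) :+ q :* q :* (q :* q :* (c :* c)) :* (K :* a)))
          ≡.refl (+ k) (+ M₂) (+ c) (+ A))
        (-≡0 (toℤ
          (⟨ q ⟩ ⊠ ⟨ q ⟩ ⊠ ⟨ M₂ ⟩ ⊞ ⟨ q ⟩ ⊠ ⟨ q ⟩ ⊠ (⟨ c ⟩ ⊠ ⟨ c ⟩) ⊠ ((⟨ k ⟩ ⊞ ⟨ k ⟩ ⊠ ⟨ q ⟩) ⊠ ⟨ A ⟩))
          (⟨ q ⟩ ⊠ ⟨ q ⟩ ⊠ (⟨ c ⟩ ⊠ ⟨ c ⟩) ⊠ (⟨ A ⟩ ⊠ ⟨ A ⟩)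
            ⊞ ⟨ q ⟩ ⊠ ⟨ q ⟩ ⊠ (⟨ q ⟩ ⊠ ⟨ q ⟩ ⊠ (⟨ c ⟩ ⊠ ⟨ c ⟩)) ⊠ ((⟨ k ⟩ ⊞ ⟨ k ⟩ ⊠ ⟨ q ⟩) ⊠ ⟨ A ⟩)) M₂≡))))

      S₂ℤ : + S₂ ≡ + c * + c * (Aℤ * Aℤ + K₁ * (K₁ * Aℤ)) - Aℤ * Aℤ
      S₂ℤ = ≡.trans (solve 2 (λ s a → s := (s :+ a :* a) :- a :* a) ≡.refl (+ S₂) (+ A))
        (≡.trans (≡.cong (λ z → z - + A * + A) (≡.trans (toℤ (⟨ S₂ ⟩ ⊞ ⟨ A ⟩ ⊠ ⟨ A ⟩) ⟨ M₂ ⟩ S₂≡) M₂ℤ))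
          (≡.cong (λ A → + c * + c * (A * A + K₁ * (K₁ * A)) - A * A) A≡))

      E≢0 : E ≢ 0ℤ
      E≢0 = *-≢0 (*-≢0 (E₁≢0 ∘ E₁≡) (*-≢0 (pos≢0 c≢0) (K₁≢0 ∘ ≡.trans K₁≡))) E₃≢0
        where

        K₁≢0 : + k + + k * + q ≢ 0ℤ
        K₁≢0 eq = k≢0 (ℕ.m+n≡0⇒m≡0 k (ℤ.+-injective (≡.trans (evalℤ≡ (⟨ k ⟩ ⊞ ⟨ k ⟩ ⊠ ⟨ q ⟩)) eq)))
        E₁≢0 : q ℕ.* (q ℕ.* c) ≢ 1
        E₁≢0 eq = k≢0 (ℕ.suc-injective (ℕ.m*n≡1⇒m≡1 q (q ℕ.* c) eq))
        E₁≡ : + q * + q * + c - 1ℤ ≡ 0ℤ → q ℕ.* (q ℕ.* c) ≡ 1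
        E₁≡ eq = ℤ.+-injective (≡.trans (evalℤ≡ (⟨ q ⟩ ⊠ (⟨ q ⟩ ⊠ ⟨ c ⟩))) (≡-from (≡.trans
          (≡.cong (λ z → z - 1ℤ) (≡.sym (ℤ.*-assoc (+ q) (+ q) (+ c)))) eq)))
        -- The bound on m enters here: q c - 1 = k θ₁ and w = m q k turn the last factor into a
        -- multiple of θ₁ - m.
        E₃≡ : + q * (+ q * + c - 1ℤ) - + row ≡ + q * + k * (+ θ₁ - + m)
        E₃≡ = ≡.trans (≡.cong₂ (λ x w → + q * (x - 1ℤ) - w)
            (≡.sym (toℤ (⟨ k ⟩ ⊠ ⟨ θ₁ ⟩ ⊞ ⟨ 1 ⟩) (⟨ q ⟩ ⊠ ⟨ c ⟩) θ₁≡)) (toℤ ⟨ row ⟩ (⟨ m ⟩ ⊠ (⟨ q ⟩ ⊠ ⟨ k ⟩)) row≡))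
          (solve 4 (λ q k t m → q :* (k :* t :+ con 1ℤ :- con 1ℤ) :- m :* (q :* k) := q :* k :* (t :- m))
            ≡.refl (+ q) (+ k) (+ θ₁) (+ m))
        E₃≢0 : + q * (+ q * + c - 1ℤ) - + row ≢ 0ℤ
        E₃≢0 eq = *-≢0 (*-≢0 {+ q} {+ k} (λ ()) (pos≢0 k≢0))
          (λ eq → ℕ.<⇒≢ m<θ₁ (≡.sym (ℤ.+-injective (≡-from eq)))) (≡.trans (≡.sym E₃≡) eq)

    not-constant : S₁ ≢ D ℕ.* a
    not-constant eq = E≢0 (≡.trans (≡.sym (first-moment-identity (+ q) (+ c) (+ row)))
      (-≡0 (≡.trans (≡.sym (≡.cong₂ _*_ Dℤ a≡)) (≡.trans (≡.sym (toℤ ⟨ S₁ ⟩ (⟨ D ⟩ ⊠ ⟨ a ⟩) eq)) S₁ℤ))))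

    -- The hypothesis is the sum over nonzero forms of x² + a b = (a + b) x. It rearranges to b (D a
    -- - S₁) = a S₁ - S₂, where both sides contain the nonzero factor `E`.
    second-value : ∀ b → S₂ ℕ.+ D ℕ.* (a ℕ.* b) ≡ (a ℕ.+ b) ℕ.* S₁ → + b ≡ aℤ - (+ q * + q - 1ℤ) * + c
    second-value b eq = ≡-from (*-cancel-0 E≢0 (begin
      E * (+ b - (aℤ - K₁ * + c))
        ≡⟨ solve 4 (λ e b a x → e :* (b :- (a :- x)) := b :* e :- (a :- x) :* e) ≡.refl E (+ b) aℤ (K₁ * + c) ⟩
      + b * E - (aℤ - K₁ * + c) * E
        ≡⟨ ≡.cong₂ (λ x y → + b * x - y) (first-moment-identity (+ q) (+ c) (+ row)) (second-moment-identity (+ q) (+ c) (+ row)) ⟨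
      + b * (d * aℤ - s₁) - (aℤ * s₁ - s₂)
        ≡⟨ solve 5 (λ b d a s t → b :* (d :* a :- s) :- (a :* s :- t) := (t :+ d :* (a :* b)) :- (a :+ b) :* s) ≡.refl (+ b) d aℤ s₁ s₂ ⟩
      (s₂ + d * (aℤ * + b)) - (aℤ + + b) * s₁
        ≡⟨ -≡0 substituted ⟩
      0ℤ ∎))
      where
      open ≡.≡-Reasoning
      d s₁ s₂ : ℤ
      d = + q * + q * (+ q * + q * (+ c * + c)) - 1ℤ
      s₁ = Aℤ * (+ q * + q * (+ c * + c)) - Aℤ
      s₂ = + c * + c * (Aℤ * Aℤ + K₁ * (K₁ * Aℤ)) - Aℤ * Aℤ
      substituted : s₂ + d * (aℤ * + b) ≡ (aℤ + + b) * s₁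
      substituted = ≡.trans (≡.sym (≡.cong₂ _+_ S₂ℤ (≡.cong₂ (λ x y → x * (y * + b)) Dℤ a≡)))
        (≡.trans (toℤ (⟨ S₂ ⟩ ⊞ ⟨ D ⟩ ⊠ (⟨ a ⟩ ⊠ ⟨ b ⟩)) ((⟨ a ⟩ ⊞ ⟨ b ⟩) ⊠ ⟨ S₁ ⟩) eq)
          (≡.cong₂ (λ x y → (x + + b) * y) a≡ S₁ℤ))

  -- θ₂ = θ_{r-4}, and d and N are as in imaginary-size.
  module Imaginary {k m T h N d θ₂ : ℕ} (k≢0 : k ≢ 0) (θ₂≡ : k ℕ.* θ₂ ℕ.+ 1 ≡ d)
    (T-eq : T ℕ.+ m ℕ.* (suc k ℕ.* k) ≡ m ℕ.* (suc k ℕ.* k) ℕ.* (suc k ℕ.* (suc k ℕ.* (suc k ℕ.* (suc k ℕ.* d)))))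
    (hits-eq : HitsFormula k≢0 (m ℕ.* (suc k ℕ.* k)) T h (suc k ℕ.* (suc k ℕ.* d))
                           (N ℕ.* ((k ℕ.+ k ℕ.* suc k) ℕ.* (suc k ℕ.* k)))) where

    private
      q row cᵣ : ℕ
      q   = suc k
      row = m ℕ.* (q ℕ.* k)
      cᵣ   = q ℕ.* (q ℕ.* d)

      a : ℤ
      a = realSize (+ q) (+ cᵣ) (+ row)

      -- The defect from a real size vanishes exactly when N is the larger admissible number; θ₂
      -- enters through d - 1 = k θ₂.
      size : a - + h ≡ + q * + q * + k * ((+ m * + θ₂ + + suc q * + d) - + N * + suc q)
      size = ≡.trans (imaginary-size k≢0 {m} {T} {h} {N} {d} T-eq hits-eq)
        (≡.trans (≡.cong (λ x → + q * + q * ((+ k + + k * + q) * + d + + m * (x - 1ℤ) - + N * (+ k + + k * + q))) d≡)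
          (solve 5 (λ k m θ d n → let q = con 1ℤ :+ k in
              q :* q :* ((k :+ k :* q) :* d :+ m :* (k :* θ :+ con 1ℤ :- con 1ℤ) :- n :* (k :+ k :* q)) :=
              q :* q :* k :* ((m :* θ :+ (con 1ℤ :+ q) :* d) :- n :* (con 1ℤ :+ q))) ≡.refl (+ k) (+ m) (+ θ₂) (+ d) (+ N)))
        where
        d≡ : + d ≡ + k * + θ₂ + 1ℤ
        d≡ = ≡.sym (toℤ (⟨ k ⟩ ⊠ ⟨ θ₂ ⟩ ⊞ ⟨ 1 ⟩) ⟨ d ⟩ θ₂≡)

      q²k≢0 : + q * + q * + k ≢ 0ℤ
      q²k≢0 = *-≢0 {+ q * + q} {+ k} (*-≢0 {+ q} {+ q} (λ ()) λ ()) (pos≢0 k≢0)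

      -- Lowering N by d raises a - h by q² k (q + 1) d. This is the distance between the two sizes,
      -- so they match the two admissible numbers of lines.
      gap : (+ q * + q - 1ℤ) * + cᵣ ≡ + q * + q * + k * (+ suc q * + d)
      gap = ≡.trans (≡.cong ((+ q * + q - 1ℤ) *_) (evalℤ≡ (⟨ q ⟩ ⊠ (⟨ q ⟩ ⊠ ⟨ d ⟩))))
        (solve 2 (λ k d → let q = con 1ℤ :+ k in
          (q :* q :- con 1ℤ) :* (q :* (q :* d)) := q :* q :* k :* ((con 1ℤ :+ q) :* d)) ≡.refl (+ k) (+ d))

      sizeℤ : m ℕ.* θ₂ ℕ.+ suc q ℕ.* d ≡ N ℕ.* suc q → (+ m * + θ₂ + + suc q * + d) - + N * + suc q ≡ 0ℤ
      sizeℤ eq = -≡0 (toℤ (⟨ m ⟩ ⊠ ⟨ θ₂ ⟩ ⊞ ⟨ suc q ⟩ ⊠ ⟨ d ⟩) (⟨ N ⟩ ⊠ ⟨ suc q ⟩) eq)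

    large⇒ : + h ≡ a → m ℕ.* θ₂ ℕ.+ suc q ℕ.* d ≡ N ℕ.* suc q
    large⇒ h≡ = ℤ.+-injective (≡.trans (evalℤ≡ (⟨ m ⟩ ⊠ ⟨ θ₂ ⟩ ⊞ ⟨ suc q ⟩ ⊠ ⟨ d ⟩)) (≡.trans
      (≡-from (*-cancel-0 q²k≢0 (≡.trans (≡.sym size) (-≡0 (≡.sym h≡))))) (≡.sym (evalℤ≡ (⟨ N ⟩ ⊠ ⟨ suc q ⟩)))))

    large⇐ : m ℕ.* θ₂ ℕ.+ suc q ℕ.* d ≡ N ℕ.* suc q → + h ≡ a
    large⇐ eq = ≡.sym (≡-from (≡.trans size (≡.trans (≡.cong (λ z → + q * + q * + k * z) (sizeℤ eq)) (ℤ.*-zeroʳ (+ q * + q * + k)))))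

    small⇒ : + h ≡ a - (+ q * + q - 1ℤ) * + cᵣ → m ℕ.* θ₂ ≡ N ℕ.* suc q
    small⇒ h≡ = ℤ.+-injective (≡.trans (evalℤ≡ (⟨ m ⟩ ⊠ ⟨ θ₂ ⟩)) (≡.trans
      (≡-from (*-cancel-0 q²k≢0 (begin
        x * (+ m * + θ₂ - + N * + suc q)
          ≡⟨ solve 4 (λ x t y n → x :* (t :- n) := x :* ((t :+ y) :- n) :- x :* y) ≡.refl x (+ m * + θ₂) (+ suc q * + d) (+ N * + suc q) ⟩
        x * ((+ m * + θ₂ + + suc q * + d) - + N * + suc q) - x * (+ suc q * + d)
          ≡⟨ ≡.cong₂ _-_ size gap ⟨
        (a - + h) - (+ q * + q - 1ℤ) * + cᵣ
          ≡⟨ ≡.cong (λ z → (a - z) - (+ q * + q - 1ℤ) * + cᵣ) h≡ ⟩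
        (a - (a - (+ q * + q - 1ℤ) * + cᵣ)) - (+ q * + q - 1ℤ) * + cᵣ
          ≡⟨ solve 2 (λ a g → (a :- (a :- g)) :- g := con 0ℤ) ≡.refl a ((+ q * + q - 1ℤ) * + cᵣ) ⟩
        0ℤ ∎))) (≡.sym (evalℤ≡ (⟨ N ⟩ ⊠ ⟨ suc q ⟩)))))
      where
      open ≡.≡-Reasoning
      x : ℤ
      x = + q * + q * + k

    small⇐ : m ℕ.* θ₂ ≡ N ℕ.* suc q → + h ≡ a - (+ q * + q - 1ℤ) * + cᵣ
    small⇐ eq = begin
      + h
        ≡⟨ solve 2 (λ a h → h := a :- (a :- h)) ≡.refl a (+ h) ⟩
      a - (a - + h)
        ≡⟨ ≡.cong (λ z → a - z) size ⟩
      a - x * ((+ m * + θ₂ + + suc q * + d) - + N * + suc q)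
        ≡⟨ ≡.cong (λ z → a - x * ((z + + suc q * + d) - + N * + suc q)) (toℤ (⟨ m ⟩ ⊠ ⟨ θ₂ ⟩) (⟨ N ⟩ ⊠ ⟨ suc q ⟩) eq) ⟩
      a - x * ((+ N * + suc q + + suc q * + d) - + N * + suc q)
        ≡⟨ solve 4 (λ a x n y → a :- x :* ((n :+ y) :- n) := a :- x :* y) ≡.refl a x (+ N * + suc q) (+ suc q * + d) ⟩
      a - x * (+ suc q * + d)
        ≡⟨ ≡.cong (λ z → a - z) gap ⟨
      a - (+ q * + q - 1ℤ) * + cᵣ ∎
      where
      open ≡.≡-Reasoning
      x : ℤ
      x = + q * + q * + k

open Arithmetic

-- The characterization

open import Data.Nat using (_+_; _*_)

-- The geometric sum (q - 1) θ_n = q ^ (n + 1) - 1 with q = k + 1, free of subtraction.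
θ-+ : ∀ k n → k * θ (+ n) (suc k) + 1 ≡ suc k ^ suc n
θ-+ k zero    = ℕsolve 1 (λ k → k ℕ:* ℕcon 1 ℕ:+ ℕcon 1 ℕ:= (ℕcon 1 ℕ:+ k) ℕ:* ℕcon 1) ≡.refl k
θ-+ k (suc n) = ≡.trans (ℕsolve 3 (λ k x t → k ℕ:* (x ℕ:+ t) ℕ:+ ℕcon 1 ℕ:= k ℕ:* x ℕ:+ (k ℕ:* t ℕ:+ ℕcon 1)) ≡.refl k (suc k ^ suc n) (θ (+ n) (suc k)))
  (≡.trans (≡.cong (k * suc k ^ suc n ℕ.+_) (θ-+ k n)) (ℕ.+-comm (k * suc k ^ suc n) (suc k ^ suc n)))

θ-⊖4 : ∀ k s → k * θ ((3 + s) ⊖ 4) (suc k) + 1 ≡ suc k ^ s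
-- For r = 3 the index is -1, where θ is 0.
θ-⊖4 k zero    = ≡.cong (_+ 1) (ℕ.*-zeroʳ k)
θ-⊖4 k (suc s) = θ-+ k s

square-^ : ∀ q n → (q ^ 2) ^ n ≡ q ^ n * q ^ n
square-^ q n = ≡.trans (ℕ.^-*-assoc q 2 n)
  (≡.trans (≡.cong (λ x → q ^ (n + x)) (ℕ.+-identityʳ n)) (ℕ.^-distribˡ-+-* q n n))

toℕ : ∀ e f → evalℤ e ≡ evalℤ f → evalℕ e ≡ evalℕ f
toℕ e f eq = ℤ.+-injective (≡.trans (evalℤ≡ e) (≡.trans eq (≡.sym (evalℤ≡ f))))

module Main {c ℓ₁ ℓ₂ c′ ℓ₁′ ℓ₂′ p} {k : ℕ} (k≢0 : k ≢ 0) (1<q : 1 ℕ.< suc k) (1<q² : 1 ℕ.< suc k ^ 2) (s : ℕ)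
  (F : HeytingField c ℓ₁ ℓ₂) (F-order : HasOrder F (suc k))
  (K : HeytingField c′ ℓ₁′ ℓ₂′) (K-order : HasOrder K (suc k ^ 2))
  (ι : HeytingField.Carrier F → HeytingField.Carrier K) (embedding : IsFieldEmbedding F K ι)
  {m : ℕ} {𝓛 : Pred (PG.Line F (3 + s)) p} (𝓛-resp : 𝓛 Respects (PG._≈ₛ_ F (3 + s)))
  (isCover : PG.IsCover F (3 + s) (suc k) m 𝓛) where

  private
    q r : ℕ
    q = suc k
    r = 3 + s

  open PG.IsCover isCover
  open Counts F F-order 1<q K K-order 1<q² ι embedding r 𝓛-resp positive covers
  open FiniteField K K-order 1<q² renaming (_+_ to _+ᵏ_; _*_ to _*ᵏ_)
  open PG K r hiding (basis; independent; span)
  open Subspaces K K-order 1<q² r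
    using (points; hyperplane-form; form-hyperplane)
  open Lines K K-order 1<q² r

  private
    -- d′ = q ^ (r - 3) and c″ = q ^ (r - 1).
    Q row′ d′ c″ : ℕ
    Q    = q ^ 2
    row′ = m * (q * k)
    d′   = q ^ s
    c″  = q * (q * d′)

    units≡k : units ≡ k
    units≡k = ℕ.+-cancelʳ-≡ 1 units k (≡.trans F.count-nonzero (ℕ.+-comm 1 k))

    frames-per-point≡ : F.frames-per-point ≡ q * k
    frames-per-point≡ = ≡.trans (≡.cong (ℕ._∸ q) (ℕ.*-suc q k)) (ℕ.m+n∸m≡n q (q * k))

    row≡ : row ≡ row′
    row≡ = ≡.cong (m *_) frames-per-point≡

    frames-per-line≡ : F.frames-per-line ≡ (k + k * q) * (q * k)
    frames-per-line≡ = ≡.cong ((k + k * q) *_) frames-per-point≡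

    T-eq : T + row′ ≡ row′ * (q * (q * c″))
    T-eq = ≡.subst (λ w → T + w ≡ w * (q * (q * c″))) row≡ T-value

    hits-eq : ∀ φ → HitsFormula k≢0 row′ T (hits φ) (zeros φ) (joinedIn φ)
    hits-eq φ = ≡.subst₂ (λ u w →
      q * (u * hits φ) + q * (u * suc q) + suc q * (w * zeros φ)
      ≡ T + q * q * joinedIn φ + q * (u * (suc q * zeros φ)) + suc q * w) units≡k row≡ (hits-formula φ)

    at : ∀ {h h′ z z′ j j′} → h ≡ h′ → z ≡ z′ → j ≡ j′ → HitsFormula k≢0 row′ T h z j → HitsFormula k≢0 row′ T h′ z′ j′
    at ≡.refl ≡.refl ≡.refl eq = eq

    a : ℤ
    a = realSize (+ q) (+ c″) (+ row′)

    hits-cong : ∀ {φ ψ} → φ ≋ ψ → hits φ ≡ hits ψ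
    hits-cong {φ} {ψ} φ≋ψ = ∑-cong points λ w → ≡.cong (𝟙 (inX? w) *_)
      (𝟙-≟ 0# (dot-cong {u = φ} {ψ} {w} {w} φ≋ψ ≋-refl))

  -- The zero form kills everything, so the general formula for `hits` yields the size of the whole
  -- cone.
  cover-points : + ∣X∣ ≡ coverSize (+ q) (+ c″) (+ row′)
  cover-points = cover-size k≢0 {row′} {T} {∣X∣} {c″} T-eq
    (at (hits-0 {0ᵛ} (λ _ → refl)) all-zero all-joined (hits-eq 0ᵛ))
    where
    vanishes : ∀ v → form 0ᵛ v ≈ 0#
    vanishes v = dot-0ˡ (ιᵛ v) (λ _ → refl)
    all-zero : zeros 0ᵛ ≡ q * (q * c″)
    all-zero = ≡.trans (∑-cong F.points λ v → 𝟙-yes (form 0ᵛ v ≟ 0#) (vanishes v))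
      (≡.trans (∑-const F.points 1) (ℕ.*-identityʳ _))
    all-joined : joinedIn 0ᵛ ≡ T
    all-joined = E-cong λ u v → 𝟙-yes ((form 0ᵛ u ≟ 0#) ×-dec (form 0ᵛ v ≟ 0#)) (vanishes u , vanishes v)

  -- These are the forms whose kernel is the extension of a hyperplane of PG(r, F).
  Real : V → Set _
  Real φ = ∃₂ λ ν α → ¬ ν ≈ 0# × F.Nonzero α × (∀ v → form φ v ≈ ν *ᵏ ι (F.dot α v))

  real-hits : ∀ {φ} → Real φ → + hits φ ≡ a
  real-hits {φ} (ν , α , ν≉0 , α≉0 , form≈) = real-size k≢0 {row′} {T} {hits φ} {joinedIn φ} {c″} T-eq
    (at ≡.refl zeros≡ ≡.refl (hits-eq φ))
    (≡.subst₂ (λ w z → suc q * (w * z) ≡ T + q * joinedIn φ + suc q * w) row≡ zeros≡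
      (real-formula φ ν≉0 (F.dot α) form≈))
    where
    zeros≡ : zeros φ ≡ q * c″
    zeros≡ = ≡.trans (∑-cong F.points λ v → 𝟙-cong (form φ v ≟ 0#) (F.dot α v F.≟ F.0#)
        (λ eq → ι≈0 (*-≈0 ν≉0 (trans (sym (form≈ v)) eq)))
        (λ eq → trans (form≈ v) (trans (*-congˡ (trans (ι-cong eq) ι-0)) (zeroʳ ν))))
      (F.count-ker α≉0)

  Split : V → F.V → F.V → Set _
  Split φ α β = φ ≋ joinᵛ α β

  Kernel : F.V → F.V → F.V → Set _
  Kernel α β v = F.dot α v F.≈ F.0# × F.dot β v F.≈ F.0#

  split-form : ∀ {φ α β} → Split φ α β → ∀ v → form φ v ≈ join (F.dot α v) (F.dot β v)
  split-form {φ} {α} {β} φ≋ v = trans (dot-cong {u = φ} {joinᵛ α β} {ιᵛ v} {ιᵛ v} φ≋ ≋-refl) (form-joinᵛ α β v)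

  split-zero : ∀ {φ α β} → Split φ α β → ∀ v →
               (form φ v ≈ 0# → Kernel α β v) ×
               (Kernel α β v → form φ v ≈ 0#)
  split-zero {φ} {α} {β} φ≋ v = (λ eq → join≈0 (trans (sym (split-form {φ} {α} {β} φ≋ v)) eq)) ,
                    (λ (α≈0 , β≈0) → trans (split-form {φ} {α} {β} φ≋ v) (0≈join α≈0 β≈0))

  -- The form α + ω β is then ω β or (1 + ω t) α, and both scalars are nonzero.
  dependent⇒Real : ∀ {φ α β} → Split φ α β → Nonzero φ → F.Dep α β → Real φ
  dependent⇒Real {φ} {α} {β} φ≋ φ≉0 (inj₁ α≋0) = ω , β , ω≉0 ,
    (λ β≋0 → φ≉0 (≋-trans φ≋ (0≋joinᵛ α≋0 β≋0))) ,
    λ v → trans (split-form {φ} {α} {β} φ≋ v) (trans (+-congʳ (trans (ι-cong (F.dot-0ˡ v α≋0)) ι-0)) (+-identityˡ _))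
  dependent⇒Real {φ} {α} {β} φ≋ φ≉0 (inj₂ (t , β≋)) = 1# +ᵏ ω *ᵏ ι t , α , 1+ωι≉0 t ,
    (λ α≋0 → φ≉0 (≋-trans φ≋ (0≋joinᵛ α≋0 λ j → F.trans (β≋ j) (F.trans (F.*-congˡ (α≋0 j)) (F.zeroʳ t))))) ,
    λ v → trans (split-form {φ} {α} {β} φ≋ v) (trans
      (+-congˡ (*-congˡ (trans (ι-cong (F.trans (F.dot-cong {u = β} {t F.⊙ α} {v} {v} β≋ F.≋-refl) (F.dot-⊙ˡ t α v))) (ι-* t _))))
      (solve 3 (λ x ω t → x :+ ω :* (t :* x) := (con (+ 1) :+ ω :* t) :* x) refl (ι (F.dot α v)) ω (ι t)))

  module _ {φ α β} (φ≋ : Split φ α β) (¬dep : ¬ F.Dep α β) (S : F.Space (suc s))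
           (S⊂ : ∀ {v} → v F.∈Sp S → Kernel α β v)
           (⊂S : ∀ {v} → Kernel α β v → v F.∈Sp S)
           {N} (size : HasSize (F.Spaces 1) (𝓛 ∩ (F._⊑ S)) N) where

    zeros-imaginary : zeros φ ≡ c″
    zeros-imaginary = F.q-cancel (≡.trans (≡.cong (q *_) (∑-cong F.points λ v → ≡.trans
        (𝟙-cong (form φ v ≟ 0#) ((F.dot α v F.≟ F.0#) ×-dec (F.dot β v F.≟ F.0#))
          (proj₁ (split-zero {φ} {α} {β} φ≋ v)) (proj₂ (split-zero {φ} {α} {β} φ≋ v)))
        (𝟙-× (F.dot α v F.≟ F.0#) (F.dot β v F.≟ F.0#))))
      (F.count-ker₂ ¬dep))

    joined-imaginary : joinedIn φ ≡ N * ((k + k * q) * (q * k))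
    joined-imaginary = begin
      joinedIn φ
        ≡⟨ ∑-cong F.points (λ u → ∑-cong F.points λ v → ≡.trans
             (≡.cong (J u v *_) (𝟙-cong ((form φ u ≟ 0#) ×-dec (form φ v ≟ 0#)) (F.∈Sp? u S ×-dec F.∈Sp? v S)
               (λ (fu , fv) → ⊂S (proj₁ (split-zero {φ} {α} {β} φ≋ u) fu) , ⊂S (proj₁ (split-zero {φ} {α} {β} φ≋ v) fv))
               (λ (u∈ , v∈) → proj₂ (split-zero {φ} {α} {β} φ≋ u) (S⊂ u∈) , proj₂ (split-zero {φ} {α} {β} φ≋ v) (S⊂ v∈))))
             (≡.sym (𝟙-× (joined? u v) (F.∈Sp? u S ×-dec F.∈Sp? v S)))) ⟩
      ∑[ u ∈ F.points ] ∑[ v ∈ F.points ] 𝟙 (joinedIn? S (u , v))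
        ≡⟨ ∑-× F.points F.points (λ { {u , v} {u′ , v′} (u≋ , v≋) → 𝟙-cong (joinedIn? S (u , v)) (joinedIn? S (u′ , v′))
             (move u≋ v≋) (move (F.≋-sym u≋) (F.≋-sym v≋)) }) ⟨
      ∑[ z ∈ F.pairs ] 𝟙 (joinedIn? S z)
        ≡⟨ count-frames (lines-in S) size ⟩
      N * F.frames-per-line
        ≡⟨ ≡.cong (N *_) frames-per-line≡ ⟩
      N * ((k + k * q) * (q * k)) ∎
      where
      open ≡.≡-Reasoning
      move : ∀ {u u′ v v′} → u F.≋ u′ → v F.≋ v′ → JoinedIn S (u , v) → JoinedIn S (u′ , v′)
      move u≋ v≋ (jnd , u∈ , v∈) = Joined-resp u≋ v≋ jnd ,
        F.IsSubspace.resp (F.Sp-subspace S) u≋ u∈ , F.IsSubspace.resp (F.Sp-subspace S) v≋ v∈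

    open Imaginary {k} {m} {T} {hits φ} {N} {d′} {θ (r ⊖ 4) q} k≢0 (θ-⊖4 k s) T-eq
      (at ≡.refl zeros-imaginary joined-imaginary (hits-eq φ)) public

  power-r : Q ^ r ≡ q * q * (c″ * c″)
  power-r = ≡.cong₂ _*_ (≡.cong (q *_) (ℕ.*-identityʳ q)) (square-^ q (2 + s))

  nonzero-sum : ∀ {f : V → ℕ} → (∀ {φ ψ} → φ ≋ ψ → f φ ≡ f ψ) →
                (∑[ φ ∈ points ] 𝟙 (nonzero? φ) * f φ) + f 0ᵛ ≡ ∑[ φ ∈ points ] f φ
  nonzero-sum {f} resp = begin
    (∑[ φ ∈ points ] 𝟙 (nonzero? φ) * f φ) + f 0ᵛ
      ≡⟨ ≡.cong ((∑[ φ ∈ points ] 𝟙 (nonzero? φ) * f φ) ℕ.+_) (∑-≈-* points resp 0ᵛ) ⟨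
    (∑[ φ ∈ points ] 𝟙 (nonzero? φ) * f φ) + (∑[ φ ∈ points ] 𝟙 (φ ≋? 0ᵛ) * f φ)
      ≡⟨ ∑-+ points (λ φ → 𝟙 (nonzero? φ) * f φ) (λ φ → 𝟙 (φ ≋? 0ᵛ) * f φ) ⟨
    ∑[ φ ∈ points ] 𝟙 (nonzero? φ) * f φ + 𝟙 (φ ≋? 0ᵛ) * f φ
      ≡⟨ ∑-cong points (λ φ → split φ (φ ≋? 0ᵛ)) ⟩
    ∑[ φ ∈ points ] f φ ∎
    where
    open ≡.≡-Reasoning
    split : ∀ φ (z : Dec (φ ≋ 0ᵛ)) → 𝟙 (¬? z) * f φ + 𝟙 z * f φ ≡ f φ
    split φ (yes _) = ℕ.*-identityˡ (f φ)
    split φ (no _)  = ≡.trans (ℕ.+-identityʳ _) (ℕ.*-identityˡ (f φ))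

  D S₁ S₂ : ℕ
  D  = ∑[ φ ∈ points ] 𝟙 (nonzero? φ)
  S₁ = ∑[ φ ∈ points ] 𝟙 (nonzero? φ) * hits φ
  S₂ = ∑[ φ ∈ points ] 𝟙 (nonzero? φ) * (hits φ * hits φ)

  realForm : V
  realForm = ιᵛ (F.unit zero)

  unit≉0 : F.Nonzero (F.unit zero)
  unit≉0 eq = F.1≉0 (eq zero)

  realForm≉0 : Nonzero realForm
  realForm≉0 eq = unit≉0 λ j → ι≈0 (eq j)

  realForm-Real : Real realForm
  realForm-Real = 1# , F.unit zero , 1≉0 , unit≉0 , λ v → sym (trans (*-identityˡ _) (ι-dot (F.unit zero) v))

  realForm-hits : + hits realForm ≡ a
  realForm-hits = real-hits {realForm} realForm-Real

  module M = Moments {k} {m} {row′} {θ (r ⊖ 1) q} {c″} {∣X∣} {D} {S₁} {S₂} {∑[ φ ∈ points ] hits φ * hits φ} {hits realForm}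
    k≢0 (ℕ.≢-nonZero⁻¹ c″ {{ℕ.m^n≢0 q (2 + s)}}) bounded ≡.refl (θ-+ k (2 + s)) cover-points realForm-hits
    -- The moments run over all forms; the zero form contributes ∣X∣ to the first and ∣X∣² to the
    -- second, which separates `S₁` and `S₂` from them.
    (≡.trans (≡.cong (S₁ ℕ.+_) (≡.sym (hits-0 {0ᵛ} λ _ → refl)))
      (≡.trans (nonzero-sum hits-cong) (≡.trans first-moment (≡.cong (∣X∣ *_) power-r))))
    (≡.trans (≡.cong (S₂ ℕ.+_) (≡.sym (≡.cong₂ _*_ (hits-0 {0ᵛ} λ _ → refl) (hits-0 {0ᵛ} λ _ → refl))))
      (nonzero-sum λ φ≋ → ≡.cong₂ _*_ (hits-cong φ≋) (hits-cong φ≋)))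
    (≡.subst₂ (λ x y → x * (∑[ φ ∈ points ] hits φ * hits φ) + y * ((k + k * q) * ∣X∣)
        ≡ y * (∣X∣ * ∣X∣) + x * y * ((k + k * q) * ∣X∣))
      (≡.cong (q *_) (ℕ.*-identityʳ q)) power-r second-moment)
    (≡.trans (≡.cong (D ℕ.+_) (≡.sym (∑-≈ points 0ᵛ))) (≡.trans (∑-complement points (_≋? 0ᵛ))
      (≡.cong₂ _*_ (≡.cong (q *_) (ℕ.*-identityʳ q)) power-r)))

  -- From forms to hyperplanes, and the two implications

  Link : Hyperplane → V → Set _
  Link H φ = (∀ {v} → v ∈Sp H → dot φ v ≈ 0#) × (∀ {v} → dot φ v ≈ 0# → v ∈Sp H)

  form-of : ∀ H → ∃ λ φ → Nonzero φ × Link H φ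
  form-of H = hyperplane-form (PG.basis H) (PG.independent H)

  hyperplane-of : ∀ {φ} → Nonzero φ → ∃ λ H → Link H φ
  hyperplane-of {φ} φ≉0 = record { basis = proj₁ b ; independent = proj₁ (proj₂ b) } , proj₂ (proj₂ b)
    where
    b = form-hyperplane {φ} φ≉0

  meets : Hyperplane → ℕ → Set _
  meets H = HasSize (Spaces 0) (X ∩ (_⊑ H))

  hits-meets : ∀ {H φ N} → Link H φ → meets H N → hits φ ≡ N * scalars
  hits-meets {H} {φ} (H⊂ , ⊂H) size = ≡.trans
    (∑-cong points λ w → ≡.trans
      (≡.cong (𝟙 (inX? w) *_) (𝟙-cong (dot φ w ≟ 0#) (∈Sp? w H) ⊂H H⊂))
      (≡.sym (𝟙-× (inX? w) (∈Sp? w H))))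
    (count-frames (X-in H) size)

  scalars-cancel : ∀ {x y} → x * scalars ≡ y * scalars → x ≡ y
  scalars-cancel {x} {y} = ℕ.*-cancelʳ-≡ x y scalars
    {{ℕ.≢-nonZero (Frames.nonempty (X-in (proj₁ (hyperplane-of {realForm} realForm≉0))))}}

  -- Every size x is a root of (x - h)(x - b), that is, x² + h b = (h + b) x. Summing over the
  -- nonzero forms gives the hypothesis of `M.second-value`.
  two-values : ∀ {b} → (∀ {φ} → Nonzero φ → hits φ ≡ hits realForm ⊎ hits φ ≡ b) →
               + b ≡ a ℤ.- (+ q ℤ.* + q ℤ.- + 1) ℤ.* + c″
  two-values {b} values = M.second-value b (begin
    S₂ + D * (h * b)
      ≡⟨ ≡.cong (S₂ ℕ.+_) (∑-*ʳ points (h * b) (λ φ → 𝟙 (nonzero? φ))) ⟨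
    S₂ + (∑[ φ ∈ points ] 𝟙 (nonzero? φ) * (h * b))
      ≡⟨ ∑-+ points (λ φ → 𝟙 (nonzero? φ) * (hits φ * hits φ)) (λ φ → 𝟙 (nonzero? φ) * (h * b)) ⟨
    ∑[ φ ∈ points ] 𝟙 (nonzero? φ) * (hits φ * hits φ) + 𝟙 (nonzero? φ) * (h * b)
      ≡⟨ ∑-cong points (λ φ → root φ (nonzero? φ)) ⟩
    ∑[ φ ∈ points ] (h + b) * (𝟙 (nonzero? φ) * hits φ)
      ≡⟨ ∑-*ˡ points (h + b) (λ φ → 𝟙 (nonzero? φ) * hits φ) ⟩
    (h + b) * S₁ ∎)
    where
    open ≡.≡-Reasoning
    h : ℕ
    h = hits realForm
    vieta : ∀ {x} → x ≡ h ⊎ x ≡ b → 1 * (x * x) + 1 * (h * b) ≡ (h + b) * (1 * x)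
    vieta (inj₁ ≡.refl) = ℕsolve 2 (λ h b → ℕcon 1 ℕ:* (h ℕ:* h) ℕ:+ ℕcon 1 ℕ:* (h ℕ:* b) ℕ:= (h ℕ:+ b) ℕ:* (ℕcon 1 ℕ:* h)) ≡.refl h b
    vieta (inj₂ ≡.refl) = ℕsolve 2 (λ h b → ℕcon 1 ℕ:* (b ℕ:* b) ℕ:+ ℕcon 1 ℕ:* (h ℕ:* b) ℕ:= (h ℕ:+ b) ℕ:* (ℕcon 1 ℕ:* b)) ≡.refl h b
    root : ∀ φ (d : Dec (Nonzero φ)) →
           𝟙 d * (hits φ * hits φ) + 𝟙 d * (h * b) ≡ (h + b) * (𝟙 d * hits φ)
    root φ (yes φ≉0) = vieta (values {φ} φ≉0)
    root φ (no _)    = ≡.sym (ℕ.*-zeroʳ (h + b))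

  opaque
    -- If no such form existed, `S₁` would be D times the real size, against `M.not-constant`. The
    -- search over the finitely many forms makes this a construction.
    other-form : ∃ λ φ → Nonzero φ × hits φ ≢ hits realForm
    other-form = decidable-stable (search points
        (λ φ≋ψ (φ≉0 , ≢) → Nonzero-resp φ≋ψ φ≉0 , λ eq → ≢ (≡.trans (hits-cong φ≋ψ) eq))
        (λ φ → nonzero? φ ×-dec ¬? (hits φ ℕ.≟ hits realForm)))
      λ none → M.not-constant (≡.trans
        (∑-cong points λ φ → constant none φ (nonzero? φ))
        (∑-*ʳ points (hits realForm) (λ φ → 𝟙 (nonzero? φ))))
      where
      constant : ¬ (∃ λ φ → Nonzero φ × hits φ ≢ hits realForm) → ∀ φ (d : Dec (Nonzero φ)) →
                 𝟙 d * hits φ ≡ 𝟙 d * hits realForm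
      constant none φ (no _)    = ≡.refl
      constant none φ (yes φ≉0) = ≡.cong (1 *_)
        (decidable-stable (hits φ ℕ.≟ hits realForm) λ ≢ → none (φ , φ≉0 , ≢))

  private
    fromℕ : ℕ → ℚᵘ.ℚᵘ
    fromℕ N = + N ℚᵘ./ 1

    base : ℚᵘ.ℚᵘ
    base = + (m * θ (r ⊖ 4) q) ℚᵘ./ suc q

    t : ℕ
    t = m * θ (r ⊖ 4) q

    -- Numerator and denominator of the unreduced sum of t / (q + 1) and d′ / 1, in the shape
    -- produced by unnormalised addition.
    large : Expression × Expression
    large = ⟨ t ⟩ ⊠ ⟨ 1 ⟩ ⊞ ⟨ d′ ⟩ ⊠ ⟨ suc q ⟩ , ⟨ suc q ⟩ ⊠ ⟨ 1 ⟩

  large≃⇒ : ∀ {N} → fromℕ N ℚᵘ.≃ base ℚᵘ.+ fromℕ d′ → t + suc q * d′ ≡ N * suc q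
  large≃⇒ {N} (ℚᵘ.*≡* eq) = ≡.trans
    (ℕsolve 3 (λ t d q → t ℕ:+ (ℕcon 1 ℕ:+ q) ℕ:* d ℕ:= (t ℕ:* ℕcon 1 ℕ:+ d ℕ:* (ℕcon 1 ℕ:+ q)) ℕ:* ℕcon 1) ≡.refl t d′ q)
    (≡.trans (≡.sym (toℕ (⟨ N ⟩ ⊠ proj₂ large) (proj₁ large ⊠ ⟨ 1 ⟩) eq)) (≡.cong (N *_) (ℕ.*-identityʳ (suc q))))

  large≃⇐ : ∀ {N} → t + suc q * d′ ≡ N * suc q → fromℕ N ℚᵘ.≃ base ℚᵘ.+ fromℕ d′
  large≃⇐ {N} eq = ℚᵘ.*≡* (toℤ (⟨ N ⟩ ⊠ proj₂ large) (proj₁ large ⊠ ⟨ 1 ⟩)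
    (≡.trans (≡.cong (N *_) (ℕ.*-identityʳ (suc q))) (≡.trans (≡.sym eq)
      (ℕsolve 3 (λ t d q → t ℕ:+ (ℕcon 1 ℕ:+ q) ℕ:* d ℕ:= (t ℕ:* ℕcon 1 ℕ:+ d ℕ:* (ℕcon 1 ℕ:+ q)) ℕ:* ℕcon 1) ≡.refl t d′ q))))

  small≃⇒ : ∀ {N} → fromℕ N ℚᵘ.≃ base → t ≡ N * suc q
  small≃⇒ {N} (ℚᵘ.*≡* eq) = ≡.trans (≡.sym (ℕ.*-identityʳ t)) (≡.sym (toℕ (⟨ N ⟩ ⊠ ⟨ suc q ⟩) (⟨ t ⟩ ⊠ ⟨ 1 ⟩) eq))

  small≃⇐ : ∀ {N} → t ≡ N * suc q → fromℕ N ℚᵘ.≃ base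
  small≃⇐ {N} eq = ℚᵘ.*≡* (toℤ (⟨ N ⟩ ⊠ ⟨ suc q ⟩) (⟨ t ⟩ ⊠ ⟨ 1 ⟩) (≡.trans (≡.sym eq) (≡.sym (ℕ.*-identityʳ t))))

  joinᵛ≉0 : ∀ {α β} → ¬ F.Dep α β → Nonzero (joinᵛ α β)
  joinᵛ≉0 ¬dep eq = ¬dep (inj₁ (proj₁ (joinᵛ≋0 eq)))

  -- An (r - 2)-space is the common kernel of two independent forms α, β over F, hence the real part
  -- of the hyperplane α + ω β = 0. The size of that form then determines N.
  from-two-values : ∀ {b} → (∀ {φ} → Nonzero φ → hits φ ≡ hits realForm ⊎ hits φ ≡ b) → PG.IsDualCover F r q m 𝓛
  from-two-values {b} values S = N , size , conclude (values {joinᵛ α β} (joinᵛ≉0 ¬dep))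
    where
    forms = F.codim₂-forms ≡.refl (PG.basis S) (PG.independent S)
    α β : F.V
    α = proj₁ forms
    β = proj₁ (proj₂ forms)
    ¬dep : ¬ F.Dep α β
    ¬dep = proj₁ (proj₂ (proj₂ forms))
    N : ℕ
    N = proj₁ (hasSize (lines-in S))
    size : HasSize (F.Spaces 1) (𝓛 ∩ (F._⊑ S)) N
    size = proj₂ (hasSize (lines-in S))
    S⊂ : ∀ {v} → v F.∈Sp S → Kernel α β v
    S⊂ = proj₁ (proj₂ (proj₂ (proj₂ forms)))
    ⊂S : ∀ {v} → Kernel α β v → v F.∈Sp S
    ⊂S = proj₂ (proj₂ (proj₂ (proj₂ forms)))
    φ : V
    φ = joinᵛ α β
    conclude : hits φ ≡ hits realForm ⊎ hits φ ≡ b → fromℕ N ℚᵘ.≃ base ℚᵘ.+ fromℕ d′ ⊎ fromℕ N ℚᵘ.≃ base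
    conclude (inj₁ eq) = inj₁ (large≃⇐ {N} (large⇒ {φ} {α} {β} ≋-refl ¬dep S S⊂ ⊂S size
      (≡.trans (≡.cong +_ eq) realForm-hits)))
    conclude (inj₂ eq) = inj₂ (small≃⇐ {N} (small⇒ {φ} {α} {β} ≋-refl ¬dep S S⊂ ⊂S size
      (≡.trans (≡.cong +_ eq) (two-values {b} λ {φ} → values {φ}))))

  -- The form `realForm` decides which of h₁ and h₂ is the real size; the other one becomes `b`.
  twoCharacter⇒dual : IsTwoCharacter X → PG.IsDualCover F r q m 𝓛
  twoCharacter⇒dual (h₁ , h₂ , _ , two , _) = by-real (values {realForm} realForm≉0)
    where
    values : ∀ {φ} → Nonzero φ → hits φ ≡ h₁ * scalars ⊎ hits φ ≡ h₂ * scalars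
    values {φ} φ≉0 = Sum.map (hits-meets {H} {φ} (proj₂ (hyperplane-of {φ} φ≉0))) (hits-meets {H} {φ} (proj₂ (hyperplane-of {φ} φ≉0))) (two H)
      where
      H : Hyperplane
      H = proj₁ (hyperplane-of {φ} φ≉0)
    by-real : hits realForm ≡ h₁ * scalars ⊎ hits realForm ≡ h₂ * scalars →
              PG.IsDualCover F r q m 𝓛
    by-real (inj₁ eq) = from-two-values λ {φ} φ≉0 → Sum.map₁ (λ x → ≡.trans x (≡.sym eq)) (values {φ} φ≉0)
    by-real (inj₂ eq) = from-two-values λ {φ} φ≉0 → Sum.swap (Sum.map₂ (λ x → ≡.trans x (≡.sym eq)) (values {φ} φ≉0))

  module _ (dual : PG.IsDualCover F r q m 𝓛) where

    private
      small : ℤ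
      small = a ℤ.- (+ q ℤ.* + q ℤ.- + 1) ℤ.* + c″

    dual-values : ∀ {φ} → Nonzero φ → + hits φ ≡ a ⊎ + hits φ ≡ small
    dual-values {φ} φ≉0 = by-case (F.dep? (reᵛ φ) (imᵛ φ))
      where
      by-case : Dec (F.Dep (reᵛ φ) (imᵛ φ)) → + hits φ ≡ a ⊎ + hits φ ≡ small
      by-case (yes dep) = inj₁ (real-hits {φ} (dependent⇒Real {φ} {reᵛ φ} {imᵛ φ} (joinᵛ-re-im φ) φ≉0 dep))
      by-case (no ¬dep) = Sum.map
        (λ eq → large⇐ {φ} {reᵛ φ} {imᵛ φ} (joinᵛ-re-im φ) ¬dep S S⊂ ⊂S size (large≃⇒ {N} eq))
        (λ eq → small⇐ {φ} {reᵛ φ} {imᵛ φ} (joinᵛ-re-im φ) ¬dep S S⊂ ⊂S size (small≃⇒ {N} eq)) (proj₂ (proj₂ (dual S)))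
        where
        b = F.forms-codim₂ {2 + s} ≡.refl ¬dep
        S : F.Space (suc s)
        S = record { basis = proj₁ b ; independent = proj₁ (proj₂ b) }
        S⊂ : ∀ {v} → v F.∈Sp S → Kernel (reᵛ φ) (imᵛ φ) v
        S⊂ = proj₁ (proj₂ (proj₂ b))
        ⊂S : ∀ {v} → Kernel (reᵛ φ) (imᵛ φ) v → v F.∈Sp S
        ⊂S = proj₂ (proj₂ (proj₂ b))
        N : ℕ
        N = proj₁ (dual S)
        size : HasSize (F.Spaces 1) (𝓛 ∩ (F._⊑ S)) N
        size = proj₁ (proj₂ (dual S))

    -- Both values are attained: the real size at `realForm`, and a different one at `other-form`,
    -- which by `dual-values` must be the small one. Every other hyperplane has one of these two
    -- sizes.
    dual⇒twoCharacter : IsTwoCharacter X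
    dual⇒twoCharacter = h₁ , h₂ , h₁≢h₂ , two , (H₁ , proj₂ (hasSize (X-in H₁))) , (H₂ , proj₂ (hasSize (X-in H₂)))
      where
      φ₂ : V
      φ₂ = proj₁ other-form
      φ₂≉0 : Nonzero φ₂
      φ₂≉0 = proj₁ (proj₂ other-form)
      H₁ H₂ : Hyperplane
      H₁ = proj₁ (hyperplane-of {realForm} realForm≉0)
      H₂ = proj₁ (hyperplane-of {φ₂} φ₂≉0)
      h₁ h₂ : ℕ
      h₁ = proj₁ (hasSize (X-in H₁))
      h₂ = proj₁ (hasSize (X-in H₂))
      hits₁ : hits realForm ≡ h₁ * scalars
      hits₁ = hits-meets {H₁} {realForm} (proj₂ (hyperplane-of {realForm} realForm≉0)) (proj₂ (hasSize (X-in H₁)))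
      hits₂ : hits φ₂ ≡ h₂ * scalars
      hits₂ = hits-meets {H₂} {φ₂} (proj₂ (hyperplane-of {φ₂} φ₂≉0)) (proj₂ (hasSize (X-in H₂)))
      h₁≢h₂ : h₁ ≢ h₂
      h₁≢h₂ eq = proj₂ (proj₂ other-form) (≡.trans hits₂ (≡.trans (≡.cong (_* scalars) (≡.sym eq)) (≡.sym hits₁)))
      hits₂-small : + hits φ₂ ≡ small
      hits₂-small with dual-values {φ₂} φ₂≉0
      ... | inj₁ eq = contradiction (ℤ.+-injective (≡.trans eq (≡.sym realForm-hits))) (proj₂ (proj₂ other-form))
      ... | inj₂ eq = eq
      two : (H : Hyperplane) → meets H h₁ ⊎ meets H h₂
      two H = Sum.map
        (λ eq → ≡.subst (meets H) (scalars-cancel (≡.trans (≡.sym hits-H)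
          (≡.trans (ℤ.+-injective (≡.trans eq (≡.sym realForm-hits))) hits₁))) size)
        (λ eq → ≡.subst (meets H) (scalars-cancel (≡.trans (≡.sym hits-H)
          (≡.trans (ℤ.+-injective (≡.trans eq (≡.sym hits₂-small))) hits₂))) size)
        (dual-values {proj₁ (form-of H)} (proj₁ (proj₂ (form-of H))))
        where
        size : meets H (proj₁ (hasSize (X-in H)))
        size = proj₂ (hasSize (X-in H))
        hits-H : hits (proj₁ (form-of H)) ≡ proj₁ (hasSize (X-in H)) * scalars
        hits-H = hits-meets {H} {proj₁ (form-of H)} (proj₂ (proj₂ (form-of H))) size

primePower>1 : ∀ {q} → PrimePower q → 1 ℕ.< q
primePower>1 (p , h , p-prime , 1≤h , ≡.refl) =
  ℕ.<-≤-trans (ℕ.nonTrivial⇒n>1 p {{prime⇒nonTrivial p-prime}})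
    (ℕ.≤-trans (ℕ.≤-reflexive (≡.sym (ℕ.*-identityʳ p)))
      (ℕ.^-monoʳ-≤ p {{prime⇒nonZero p-prime}} 1≤h))

theorem2p3 : ∀ {c ℓ₁ ℓ₂ c′ ℓ₁′ ℓ₂′ p} (r q m : ℕ) → 3 ≤ r → PrimePower q →
    (F : HeytingField c ℓ₁ ℓ₂) → HasOrder F q →
    (K : HeytingField c′ ℓ₁′ ℓ₂′) → HasOrder K (q ^ 2) →
    (ι : HeytingField.Carrier F → HeytingField.Carrier K) → IsFieldEmbedding F K ι →
    (𝓛 : Pred (PG.Line F r) p) → 𝓛 Respects (PG._≈ₛ_ F r) →
    PG.IsCover F r q m 𝓛 →
    PG.IsTwoCharacter K r (Extension.extendedPoints F K ι r 𝓛) ⇔ PG.IsDualCover F r q m 𝓛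
theorem2p3 (suc (suc (suc s))) zero    m _ prime-power with primePower>1 prime-power
... | ()
theorem2p3 (suc (suc (suc s))) (suc k) m _ prime-power F F-order K K-order ι embedding 𝓛 𝓛-resp isCover =
  mk⇔ twoCharacter⇒dual dual⇒twoCharacter
  where
  1<q : 1 ℕ.< suc k
  1<q = primePower>1 prime-power
  k≢0 : k ≢ 0
  k≢0 ≡.refl = ℕ.<-irrefl ≡.refl 1<q
  1<q² : 1 ℕ.< suc k ^ 2
  1<q² = ℕ.<-≤-trans 1<q (ℕ.m≤m*n (suc k) (suc k ^ 1))
  open Main k≢0 1<q 1<q² s F F-order K K-order ι embedding 𝓛-resp isCover
theorem2p3 (suc (suc zero)) q m (ℕ.s≤s (ℕ.s≤s ()))
theorem2p3 (suc zero) q m (ℕ.s≤s ())
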